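{- For any fixed integer $d \ge 2$, the transience class of the Abelian sandpile model on the $d$-dimensional grid $\square_n^d$ with $n^d$ non-sink vertices satisfies $\mathrm{tcl}(\square_n^d) = O(n^{3d-2}\log^{d+2} n)$ and $\mathrm{tcl}(\square_n^d) = \Omega(n^{3d-2})$ as $n\to\infty$.
   Context: The graph $\square_n^d$ has vertex set $\{1,\dots,n\}^d\cup\{s\}$, where $s$ is a sink vertex. Two non-sink vertices are joined by an edge if they differ by exactly $1$ in exactly one coordinate. Boundary vertices are joined to $s$ by additional (possibly parallel) edges so that every non-sink vertex has degree exactly $2d$. Abelian sandpile model on a finite multigraph $G$ with sink $s$: a configuration assigns a nonnegative integer number of grains $\sigma(v)$ to each non-sink vertex $v$. A non-sink vertex $v$ with $\sigma(v)\ge\deg(v)$ may topple, sending one grain along each incident edge; grains sent to $s$ disappear. A configuration in which no vertex can topple is stable, and stabilization is order-independent. One step of the process adds one grain at a chosen non-sink vertex and then stabilizes. A stable configuration is recurrent if it can be revisited by this process. The transience class $\mathrm{tcl}(G)$ is the maximum number of grains that can be added, one at a time at adversarially chosen non-sink vertices and stabilizing after each addition, starting from the empty configuration, before the configuration necessarily becomes recurrent. -}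

module Defs where

open import Data.Nat using (ℕ; zero; suc; _+_; _*_; _∸_; _^_; _≤_; _<_)
open import Data.Nat.Logarithm using (⌊log₂_⌋)
open import Data.Fin using (Fin; toℕ)
open import Data.Vec using (Vec; lookup)
open import Data.Product using (Σ; ∃; _×_)
open import Data.Sum using (_⊎_)
open import Relation.Binary.PropositionalEquality using (_≡_; _≢_)
open import Relation.Nullary using (¬_)

-- Non-sink vertices of the grid graph □ⁿ_d : points of {1..n}^d,
-- encoded as vectors of length d over Fin n (coordinates 0..n-1).
Vertex : ℕ → ℕ → Set
Vertex d n = Vec (Fin n) d

Config : ℕ → ℕ → Set
Config d n = Vertex d n → ℕ

module _ {d n : ℕ} where

  _≗c_ : Config d n → Config d n → Set
  σ ≗c τ = ∀ v → σ v ≡ τ v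

  Adj : Vertex d n → Vertex d n → Set
  Adj v w = Σ (Fin d) λ i →
      (toℕ (lookup v i) ≡ suc (toℕ (lookup w i)) ⊎ toℕ (lookup w i) ≡ suc (toℕ (lookup v i)))
    × (∀ j → j ≢ i → lookup v j ≡ lookup w j)

  -- Every non-sink vertex has degree 2d (the missing edges go to the sink).
  Stable : Config d n → Set
  Stable σ = ∀ v → σ v < 2 * d

  -- τ is obtained from σ by legally toppling v: v loses 2d grains,
  -- each grid neighbour gains one, grains sent to the sink disappear.
  Topple : Config d n → Vertex d n → Config d n → Set
  Topple σ v τ =
      (2 * d ≤ σ v)
    × (τ v + 2 * d ≡ σ v)
    × (∀ w → w ≢ v → (Adj v w → τ w ≡ suc (σ w)) × (¬ Adj v w → τ w ≡ σ w))

  data Topples : Config d n → Config d n → Set where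
    stop : ∀ {σ τ} → σ ≗c τ → Topples σ τ
    fire : ∀ {σ σ' τ} (v : Vertex d n) → Topple σ v σ' → Topples σ' τ → Topples σ τ

  Stabilizes : Config d n → Config d n → Set
  Stabilizes σ τ = Topples σ τ × Stable τ

  AddGrain : Vertex d n → Config d n → Config d n → Set
  AddGrain v σ σ' = (σ' v ≡ suc (σ v)) × (∀ w → w ≢ v → σ' w ≡ σ w)

  Step : Config d n → Config d n → Set
  Step σ τ = Σ (Vertex d n) λ v → Σ (Config d n) λ σ' → AddGrain v σ σ' × Stabilizes σ' τ

  data Steps : ℕ → Config d n → Config d n → Set where
    done : ∀ {σ τ} → σ ≗c τ → Steps zero σ τ
    next : ∀ {k σ ρ τ} → Step σ ρ → Steps k ρ τ → Steps (suc k) σ τ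

  Recurrent : Config d n → Set
  Recurrent τ = Stable τ × ∃ λ k → Steps (suc k) τ τ

  empty : Config d n
  empty _ = zero

  IsTcl : ℕ → Set
  IsTcl t =
      (∃ λ τ → Steps t empty τ × ¬ Recurrent τ)
    × (∀ k τ → Steps k empty τ → ¬ Recurrent τ → k ≤ t)

{-# OPTIONS --safe #-}
-- Let Δ = 2d − nb be the Laplacian with the sink grounded and u the odometer of stabilizing E to τ, so
-- E + nb u = τ + 2d u. Pairing with the Green function g of v (truncated in time and scaled to integers)
-- gives ⟨g,E⟩ + ⟨u,walks⟩ = ⟨g,τ⟩ + (4d)^M u(v).
--
-- If τ is not recurrent, then by the burning test some v never toppled, whence ⟨g,E⟩ ≤ 2d Σ g. The minimum
-- of g is at least c Π dist(v_i) n^{−(3d−2)} and Σ g, the exit time from v, is at most C dist(v_1) dist(v_2) log n,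
-- so |E| ≤ C n^{3d−2} log n. Conversely g is at most C n^{−(3d−2)} when v is near a corner and all grains fall
-- at the opposite one, so c n^{3d−2} grains leave two adjacent sites near v empty, and τ is not recurrent.
--
-- Both bounds on g come from one-dimensional ones. A lazy walk on the grid is a sum over words in the d
-- coordinate directions of products of one-dimensional walks. For these, the lower bound follows from
-- reflection and unimodality at the midpoint of an interval, and the upper bound from unimodality and two
-- comparisons with the parabola x (M − x).
module Submission where

open import Defs
open import Data.Bool using (Bool; true; false)
open import Data.Nat
open import Data.Nat.Properties
open import Data.Nat.DivMod using (m/n*n≤m; m≥n⇒m/n>0; /-monoˡ-≤; m≡m%n+[m/n]*n; m%n<n)
open import Data.Nat.Induction using (<-wellFounded)
open import Data.Nat.Logarithm using (⌊log₂_⌋; ⌊log₂⌋-mono-≤; ⌊log₂[2^n]⌋≡n)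
open import Data.Nat.Tactic.RingSolver using (solve-∀)
open import Data.Fin using (Fin; zero; suc; toℕ; fromℕ<)
open import Data.Fin.Properties using (toℕ<n; toℕ-injective; toℕ-fromℕ<; any?)
open import Data.Vec using (Vec; []; _∷_; lookup; replicate)
open import Data.Vec.Properties using (≡-dec; lookup-replicate)
open import Data.Vec.Relation.Unary.All using (All; []; _∷_)
open import Data.Vec.Relation.Unary.All.Properties using (lookup⁻)
open import Data.Empty using (⊥-elim)
open import Data.Product using (Σ; ∃; ∃₂; _×_; _,_; proj₁; proj₂)
open import Data.Sum using (_⊎_; inj₁; inj₂)
open import Function using (_∘_)
open import Induction.WellFounded using (Acc; acc)
open import Relation.Nullary using (¬_; Dec; yes; no; ¬?)
open import Relation.Nullary.Decidable using (map′; decidable-stable)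
open import Relation.Binary.PropositionalEquality
open import Algebra.Properties.Semiring.Sum +-*-semiring using (sum; sum-cong-≗; ∑-distrib-+; ∑-comm; *-distribˡ-sum; *-distribʳ-sum)

-- The exponent is born in one dimension. At times of order n² the killed walk on an interval of
-- length n goes from a site near one end to a site near the other with probability of order n⁻³.
-- The d coordinates multiply this to n^(-3d), and the order of n² relevant times brings it to
-- n^(-(3d-2)). Laziness is essential: with weight 2d for staying put, `nb` + 2d is a sum of d
-- commuting one-dimensional operators with weights 1, 2, 1. Its powers are therefore sums over
-- words, and these weights preserve unimodality. Everything lives in ℕ, without eigenfunctions,
-- quotients or infinite series. A decay factor p / q is a pair of powers `p ^ t` and `q ^ t` on the
-- two sides of an inequality, sines become polynomials, and the Green function is cut off at a
-- finite time. The cut-off leaves the term ⟨u,walks⟩. It has the right sign for the upper bound;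
-- for the lower bound the cut-off time is chosen after the odometer is known, so that the term
-- weighs less than one toppling.

-- Finite sums and Kronecker deltas

sum-mono : ∀ {n} {f g : Fin n → ℕ} → (∀ i → f i ≤ g i) → sum f ≤ sum g
sum-mono {zero} h = z≤n
sum-mono {suc n} h = +-mono-≤ (h zero) (sum-mono (h ∘ suc))

sum-const : ∀ n c → sum {n} (λ _ → c) ≡ n * c
sum-const zero c = refl
sum-const (suc n) c = cong (c +_) (sum-const n c)

sum-zero : ∀ {n} {f : Fin n → ℕ} → (∀ i → f i ≡ 0) → sum f ≡ 0
sum-zero {n} h = trans (sum-cong-≗ h) (trans (sum-const n 0) (*-zeroʳ n))

term≤sum : ∀ {n} (f : Fin n → ℕ) i → f i ≤ sum f
term≤sum f zero = m≤m+n _ _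
term≤sum f (suc i) = m≤n⇒m≤o+n (f zero) (term≤sum (f ∘ suc) i)

sum-telescope : ∀ L (F : ℕ → ℕ) → sum {L} (λ i → F (suc (toℕ i))) + F 0 ≡ sum {L} (λ i → F (toℕ i)) + F L
sum-telescope zero F = refl
sum-telescope (suc L) F = begin
  F 1 + sum {L} (λ i → F (suc (suc (toℕ i)))) + F 0 ≡⟨ lem (F 1) (sum {L} (λ i → F (suc (suc (toℕ i))))) (F 0) ⟩
  (sum {L} (λ i → F (suc (suc (toℕ i)))) + F 1) + F 0 ≡⟨ cong (_+ F 0) (sum-telescope L (F ∘ suc)) ⟩
  (sum {L} (λ i → F (suc (toℕ i))) + F (suc L)) + F 0 ≡⟨ lem2 (sum {L} (λ i → F (suc (toℕ i)))) (F (suc L)) (F 0) ⟩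
  F 0 + sum {L} (λ i → F (suc (toℕ i))) + F (suc L) ∎
  where
  open ≡-Reasoning
  lem : ∀ a b c → a + b + c ≡ b + a + c
  lem = solve-∀
  lem2 : ∀ a b c → a + b + c ≡ c + a + b
  lem2 = solve-∀

δ : ℕ → ℕ → ℕ
δ zero zero = 1
δ zero (suc b) = 0
δ (suc a) zero = 0
δ (suc a) (suc b) = δ a b

δ-refl : ∀ a → δ a a ≡ 1
δ-refl zero = refl
δ-refl (suc a) = δ-refl a

δ-≢ : ∀ a b → a ≢ b → δ a b ≡ 0
δ-≢ zero zero h = ⊥-elim (h refl)
δ-≢ zero (suc b) h = refl
δ-≢ (suc a) zero h = refl
δ-≢ (suc a) (suc b) h = δ-≢ a b (h ∘ cong suc)

δ-sym : ∀ a b → δ a b ≡ δ b a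
δ-sym zero zero = refl
δ-sym zero (suc b) = refl
δ-sym (suc a) zero = refl
δ-sym (suc a) (suc b) = δ-sym a b

δ≤1 : ∀ a b → δ a b ≤ 1
δ≤1 zero zero = s≤s z≤n
δ≤1 zero (suc b) = z≤n
δ≤1 (suc a) zero = z≤n
δ≤1 (suc a) (suc b) = δ≤1 a b

sum-δ-< : ∀ {n} a (h : ℕ → ℕ) → a < n → sum {n} (λ y → δ a (toℕ y) * h (toℕ y)) ≡ h a
sum-δ-< {suc n} zero h p = trans (cong (h 0 + 0 +_) (sum-zero {n} (λ i → refl))) (trans (+-identityʳ _) (+-identityʳ _))
sum-δ-< {suc n} (suc a) h (s≤s p) = sum-δ-< {n} a (h ∘ suc) p

sum-δ-≥ : ∀ {n} a (h : ℕ → ℕ) → n ≤ a → sum {n} (λ y → δ a (toℕ y) * h (toℕ y)) ≡ 0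
sum-δ-≥ {zero} a h p = refl
sum-δ-≥ {suc n} (suc a) h (s≤s p) = sum-δ-≥ {n} a (h ∘ suc) p

sum-δ-Fin : ∀ {n} (x : Fin n) (f : Fin n → ℕ) → sum (λ y → δ (toℕ x) (toℕ y) * f y) ≡ f x
sum-δ-Fin {suc n} zero f = trans (cong (f zero + 0 +_) (sum-zero {n} (λ i → refl))) (trans (+-identityʳ _) (+-identityʳ _))
sum-δ-Fin (suc x) f = sum-δ-Fin x (f ∘ suc)

near : ℕ → ℕ → ℕ
near a b = δ a (suc b) + δ (suc a) b

near-sym : ∀ a b → near a b ≡ near b a
near-sym a b = trans (+-comm (δ a (suc b)) (δ (suc a) b)) (cong₂ _+_ (δ-sym (suc a) b) (δ-sym a (suc b)))

-- Coordinate `y` sits at position `suc (toℕ y)` of an interval from 0 to `suc n` whose two ends are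
-- the sink. As `h` vanishes there, a missing neighbour is a zero summand and the boundary needs no
-- separate formula.
sum-near : ∀ {n} (x : Fin n) (h : ℕ → ℕ) → h 0 ≡ 0 → h (suc n) ≡ 0 →
  sum {n} (λ y → near (toℕ x) (toℕ y) * h (suc (toℕ y))) ≡ h (toℕ x) + h (suc (suc (toℕ x)))
sum-near {n} x h h0 hn = begin
  sum {n} (λ y → near (toℕ x) (toℕ y) * h (suc (toℕ y)))
    ≡⟨ sum-cong-≗ {n} (λ y → *-distribʳ-+ (h (suc (toℕ y))) (δ (toℕ x) (suc (toℕ y))) (δ (suc (toℕ x)) (toℕ y))) ⟩
  sum {n} (λ y → δ (toℕ x) (suc (toℕ y)) * h (suc (toℕ y)) + δ (suc (toℕ x)) (toℕ y) * h (suc (toℕ y)))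
    ≡⟨ ∑-distrib-+ {n} (λ y → δ (toℕ x) (suc (toℕ y)) * h (suc (toℕ y))) (λ y → δ (suc (toℕ x)) (toℕ y) * h (suc (toℕ y))) ⟩
  sum {n} (λ y → δ (toℕ x) (suc (toℕ y)) * h (suc (toℕ y))) + sum {n} (λ y → δ (suc (toℕ x)) (toℕ y) * h (suc (toℕ y)))
    ≡⟨ cong₂ _+_ (below (toℕ x) (toℕ<n x)) (above (toℕ x) (toℕ<n x)) ⟩
  h (toℕ x) + h (suc (suc (toℕ x))) ∎
  where
  open ≡-Reasoning
  below : ∀ a → a < n → sum {n} (λ y → δ a (suc (toℕ y)) * h (suc (toℕ y))) ≡ h a
  below zero p = trans (sum-zero {n} (λ i → refl)) (sym h0)
  below (suc a) p = sum-δ-< {n} a (h ∘ suc) (<-trans (n<1+n a) p)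
  above : ∀ a → a < n → sum {n} (λ y → δ (suc a) (toℕ y) * h (suc (toℕ y))) ≡ h (suc (suc a))
  above a p with suc a <? n
  ... | yes q = sum-δ-< {n} (suc a) (h ∘ suc) q
  ... | no q = trans (sum-δ-≥ {n} (suc a) (h ∘ suc) (≮⇒≥ q)) (trans (sym hn) (cong h (cong suc (≤-antisym (≮⇒≥ q) p))))

-- Sums over the vertices of the grid

∑V : ∀ {d n} → (Vertex d n → ℕ) → ℕ
∑V {zero} f = f []
∑V {suc d} f = sum (λ x → ∑V (λ xs → f (x ∷ xs)))

∑V-cong : ∀ {d n} {f g : Vertex d n → ℕ} → (∀ v → f v ≡ g v) → ∑V f ≡ ∑V g
∑V-cong {zero} h = h []
∑V-cong {suc d} h = sum-cong-≗ (λ x → ∑V-cong (λ xs → h (x ∷ xs)))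

∑V-mono : ∀ {d n} {f g : Vertex d n → ℕ} → (∀ v → f v ≤ g v) → ∑V f ≤ ∑V g
∑V-mono {zero} h = h []
∑V-mono {suc d} h = sum-mono (λ x → ∑V-mono (λ xs → h (x ∷ xs)))

∑V-+ : ∀ {d n} (f g : Vertex d n → ℕ) → ∑V (λ v → f v + g v) ≡ ∑V f + ∑V g
∑V-+ {zero} f g = refl
∑V-+ {suc d} f g = trans (sum-cong-≗ (λ x → ∑V-+ (λ xs → f (x ∷ xs)) (λ xs → g (x ∷ xs))))
  (∑-distrib-+ (λ x → ∑V (λ xs → f (x ∷ xs))) (λ x → ∑V (λ xs → g (x ∷ xs))))

∑V-* : ∀ {d n} c (f : Vertex d n → ℕ) → ∑V (λ v → c * f v) ≡ c * ∑V f
∑V-* {zero} c f = refl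
∑V-* {suc d} c f = trans (sum-cong-≗ (λ x → ∑V-* c (λ xs → f (x ∷ xs))))
  (sym (*-distribˡ-sum c (λ x → ∑V (λ xs → f (x ∷ xs)))))

∑V-zero : ∀ {d n} {f : Vertex d n → ℕ} → (∀ v → f v ≡ 0) → ∑V f ≡ 0
∑V-zero {zero} h = h []
∑V-zero {suc d} h = sum-zero (λ x → ∑V-zero (λ xs → h (x ∷ xs)))

term≤∑V : ∀ {d n} (f : Vertex d n → ℕ) v → f v ≤ ∑V f
term≤∑V {zero} f [] = ≤-refl
term≤∑V {suc d} f (x ∷ xs) = ≤-trans (term≤∑V (λ xs → f (x ∷ xs)) xs) (term≤sum (λ x → ∑V (λ xs → f (x ∷ xs))) x)

∑V-sum : ∀ {d n m} (f : Vertex d n → Fin m → ℕ) → ∑V (λ v → sum (f v)) ≡ sum (λ i → ∑V (λ v → f v i))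
∑V-sum {zero} f = refl
∑V-sum {suc d} {n} {m} f = trans (sum-cong-≗ (λ x → ∑V-sum (λ xs → f (x ∷ xs))))
  (∑-comm {n} {m} (λ x i → ∑V (λ xs → f (x ∷ xs) i)))

∑V-comm : ∀ {d n e m} (f : Vertex d n → Vertex e m → ℕ) → ∑V (λ v → ∑V (f v)) ≡ ∑V (λ w → ∑V (λ v → f v w))
∑V-comm {d} {n} {zero} f = refl
∑V-comm {d} {n} {suc e} f = trans (∑V-sum (λ v y → ∑V (λ ys → f v (y ∷ ys))))
  (sum-cong-≗ (λ y → ∑V-comm (λ v ys → f v (y ∷ ys))))

eqV : ∀ {d n} → Vertex d n → Vertex d n → ℕ
eqV [] [] = 1
eqV (x ∷ xs) (y ∷ ys) = δ (toℕ x) (toℕ y) * eqV xs ys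

-- Adjacency in a Cartesian product of paths: a move in the first coordinate and equality in the
-- rest, or the reverse. As a matrix it makes `nb` a linear operator; `adj-cases` matches it with
-- `Adj`.
adjV : ∀ {d n} → Vertex d n → Vertex d n → ℕ
adjV [] [] = 0
adjV (x ∷ xs) (y ∷ ys) = near (toℕ x) (toℕ y) * eqV xs ys + δ (toℕ x) (toℕ y) * adjV xs ys

eqV-sym : ∀ {d n} (v w : Vertex d n) → eqV v w ≡ eqV w v
eqV-sym [] [] = refl
eqV-sym (x ∷ xs) (y ∷ ys) = cong₂ _*_ (δ-sym (toℕ x) (toℕ y)) (eqV-sym xs ys)

adjV-sym : ∀ {d n} (v w : Vertex d n) → adjV v w ≡ adjV w v
adjV-sym [] [] = refl
adjV-sym (x ∷ xs) (y ∷ ys) = cong₂ _+_ (cong₂ _*_ (near-sym (toℕ x) (toℕ y)) (eqV-sym xs ys))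
  (cong₂ _*_ (δ-sym (toℕ x) (toℕ y)) (adjV-sym xs ys))

∑V-eqV : ∀ {d n} (v : Vertex d n) (f : Vertex d n → ℕ) → ∑V (λ w → eqV v w * f w) ≡ f v
∑V-eqV [] f = +-identityʳ _
∑V-eqV (x ∷ xs) f = begin
  sum (λ y → ∑V (λ ys → δ (toℕ x) (toℕ y) * eqV xs ys * f (y ∷ ys)))
    ≡⟨ sum-cong-≗ (λ y → trans (∑V-cong (λ ys → *-assoc (δ (toℕ x) (toℕ y)) (eqV xs ys) (f (y ∷ ys))))
         (trans (∑V-* (δ (toℕ x) (toℕ y)) (λ ys → eqV xs ys * f (y ∷ ys)))
           (cong (δ (toℕ x) (toℕ y) *_) (∑V-eqV xs (λ ys → f (y ∷ ys)))))) ⟩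
  sum (λ y → δ (toℕ x) (toℕ y) * f (y ∷ xs)) ≡⟨ sum-δ-Fin x (λ y → f (y ∷ xs)) ⟩
  f (x ∷ xs) ∎
  where open ≡-Reasoning

-- The sink counts as 0.
nb : ∀ {d n} → (Vertex d n → ℕ) → Vertex d n → ℕ
nb u v = ∑V (λ w → adjV v w * u w)

nb1 : ∀ {n} → (Fin n → ℕ) → Fin n → ℕ
nb1 f x = sum (λ y → near (toℕ x) (toℕ y) * f y)

nb-∷ : ∀ {d n} (u : Vertex (suc d) n → ℕ) x xs →
  nb u (x ∷ xs) ≡ nb1 (λ y → u (y ∷ xs)) x + nb (λ ys → u (x ∷ ys)) xs
nb-∷ u x xs = begin
  sum (λ y → ∑V (λ ys → (near (toℕ x) (toℕ y) * eqV xs ys + δ (toℕ x) (toℕ y) * adjV xs ys) * u (y ∷ ys)))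
    ≡⟨ sum-cong-≗ (λ y → trans (∑V-cong (λ ys → lem (near (toℕ x) (toℕ y)) (eqV xs ys) (δ (toℕ x) (toℕ y)) (adjV xs ys) (u (y ∷ ys))))
        (trans (∑V-+ (λ ys → near (toℕ x) (toℕ y) * (eqV xs ys * u (y ∷ ys))) (λ ys → δ (toℕ x) (toℕ y) * (adjV xs ys * u (y ∷ ys))))
          (cong₂ _+_ (trans (∑V-* (near (toℕ x) (toℕ y)) (λ ys → eqV xs ys * u (y ∷ ys))) (cong (near (toℕ x) (toℕ y) *_) (∑V-eqV xs (λ ys → u (y ∷ ys)))))
            (∑V-* (δ (toℕ x) (toℕ y)) (λ ys → adjV xs ys * u (y ∷ ys)))))) ⟩
  sum (λ y → near (toℕ x) (toℕ y) * u (y ∷ xs) + δ (toℕ x) (toℕ y) * nb (λ ys → u (y ∷ ys)) xs)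
    ≡⟨ ∑-distrib-+ (λ y → near (toℕ x) (toℕ y) * u (y ∷ xs)) (λ y → δ (toℕ x) (toℕ y) * nb (λ ys → u (y ∷ ys)) xs) ⟩
  nb1 (λ y → u (y ∷ xs)) x + sum (λ y → δ (toℕ x) (toℕ y) * nb (λ ys → u (y ∷ ys)) xs)
    ≡⟨ cong (nb1 (λ y → u (y ∷ xs)) x +_) (sum-δ-Fin x (λ y → nb (λ ys → u (y ∷ ys)) xs)) ⟩
  nb1 (λ y → u (y ∷ xs)) x + nb (λ ys → u (x ∷ ys)) xs ∎
  where
  open ≡-Reasoning
  lem : ∀ a b c d e → (a * b + c * d) * e ≡ a * (b * e) + c * (d * e)
  lem = solve-∀

nb-cong : ∀ {d n} {u w : Vertex d n → ℕ} → (∀ v → u v ≡ w v) → ∀ v → nb u v ≡ nb w v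
nb-cong h v = ∑V-cong (λ y → cong (adjV v y *_) (h y))

nb-mono : ∀ {d n} {u w : Vertex d n → ℕ} → (∀ v → u v ≤ w v) → ∀ v → nb u v ≤ nb w v
nb-mono h v = ∑V-mono (λ y → *-monoʳ-≤ (adjV v y) (h y))

nb-+ : ∀ {d n} (f g : Vertex d n → ℕ) v → nb (λ x → f x + g x) v ≡ nb f v + nb g v
nb-+ f g v = trans (∑V-cong (λ y → *-distribˡ-+ (adjV v y) (f y) (g y))) (∑V-+ (λ y → adjV v y * f y) (λ y → adjV v y * g y))

nb-* : ∀ {d n} c (f : Vertex d n → ℕ) v → nb (λ x → c * f x) v ≡ c * nb f v
nb-* c f v = trans (∑V-cong (λ y → lem (adjV v y) c (f y))) (∑V-* c (λ y → adjV v y * f y))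
  where
  lem : ∀ a b c → a * (b * c) ≡ b * (a * c)
  lem = solve-∀

nb-sum : ∀ {d n m} (f : Fin m → Vertex d n → ℕ) v → nb (λ x → sum (λ i → f i x)) v ≡ sum (λ i → nb (f i) v)
nb-sum f v = trans (∑V-cong (λ y → *-distribˡ-sum (adjV v y) (λ i → f i y))) (∑V-sum (λ y i → adjV v y * f i y))

nb-eqV : ∀ {d n} (v w : Vertex d n) → nb (eqV v) w ≡ adjV v w
nb-eqV v w = trans (∑V-cong (λ y → *-comm (adjV w y) (eqV v y))) (trans (∑V-eqV v (adjV w)) (adjV-sym w v))

nb-selfAdjoint : ∀ {d n} (f g : Vertex d n → ℕ) → ∑V (λ v → f v * nb g v) ≡ ∑V (λ v → g v * nb f v)
nb-selfAdjoint f g = begin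
  ∑V (λ v → f v * nb g v) ≡⟨ ∑V-cong (λ v → sym (∑V-* (f v) (λ w → adjV v w * g w))) ⟩
  ∑V (λ v → ∑V (λ w → f v * (adjV v w * g w))) ≡⟨ ∑V-comm (λ v w → f v * (adjV v w * g w)) ⟩
  ∑V (λ w → ∑V (λ v → f v * (adjV v w * g w))) ≡⟨ ∑V-cong (λ w → ∑V-cong (λ v → trans (cong (λ a → f v * (a * g w)) (adjV-sym v w)) (lem (f v) (adjV w v) (g w)))) ⟩
  ∑V (λ w → ∑V (λ v → g w * (adjV w v * f v))) ≡⟨ ∑V-cong (λ w → ∑V-* (g w) (λ v → adjV w v * f v)) ⟩
  ∑V (λ w → g w * nb f w) ∎
  where
  open ≡-Reasoning
  lem : ∀ a b c → a * (b * c) ≡ c * (b * a)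
  lem = solve-∀

-- One-dimensional walks

mask : ℕ → (ℕ → ℕ) → ℕ → ℕ
mask M f zero = 0
mask M f (suc x) with suc x <? M
... | yes _ = f (suc x)
... | no _ = 0

mask-in : ∀ {M x} f → suc x < M → mask M f (suc x) ≡ f (suc x)
mask-in {M} {x} f p with suc x <? M
... | yes _ = refl
... | no q = ⊥-elim (q p)

mask-out : ∀ {M x} f → M ≤ x → mask M f x ≡ 0
mask-out {x = zero} f p = refl
mask-out {M} {suc x} f p with suc x <? M
... | yes q = ⊥-elim (<⇒≱ q p)
... | no q = refl

-- At 0 the neighbour `pred x` is 0 itself, which is meaningless but harmless: `T` masks that value
-- and all comparisons are made at positive `x`.
stencil : (ℕ → ℕ) → ℕ → ℕ
stencil f x = f (pred x) + 2 * f x + f (suc x)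

-- Four times the lazy walk killed at 0 and M.
T : ℕ → (ℕ → ℕ) → ℕ → ℕ
T M f = mask M (stencil f)

evol : ℕ → ℕ → (ℕ → ℕ) → ℕ → ℕ
evol M zero f = f
evol M (suc t) f = T M (evol M t f)

K : ℕ → ℕ → ℕ → ℕ → ℕ
K M t a = evol M t (δ a)

one : ℕ → ℕ → ℕ
one M = mask M (λ _ → 1)

one≤1 : ∀ M x → one M x ≤ 1
one≤1 M zero = z≤n
one≤1 M (suc x) with suc x <? M
... | yes _ = s≤s z≤n
... | no _ = z≤n

-- The inner case writes `M` as `2 + p + q`, which removes truncated subtraction and leaves
-- polynomial identities in `p` and `q` to the ring solver.
data Place (M : ℕ) : ℕ → Set where
  left  : Place M 0
  inner : ∀ {p} q → M ≡ 2 + p + q → Place M (suc p)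
  right : ∀ {x} → M ≤ x → Place M x

place : ∀ M x → Place M x
place M zero = left
place M (suc p) with suc p <? M
... | no h = right (≮⇒≥ h)
... | yes h with m≤n⇒∃[o]m+o≡n h
... | q , e = inner q (sym e)

inner-< : ∀ {M p q} → M ≡ 2 + p + q → suc p < M
inner-< {p = p} {q} refl = s≤s (s≤s (m≤m+n p q))

T-inner : ∀ {M p q} f → M ≡ 2 + p + q → T M f (suc p) ≡ f p + 2 * f (suc p) + f (2 + p)
T-inner f e = mask-in (stencil f) (inner-< e)

Vanish : ℕ → (ℕ → ℕ) → Set
Vanish M f = f 0 ≡ 0 × (∀ x → M ≤ x → f x ≡ 0)

mask-vanish : ∀ M f → Vanish M (mask M f)
mask-vanish M f = refl , λ x h → mask-out f h

evol-vanish : ∀ M t {f} → Vanish M f → Vanish M (evol M t f)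
evol-vanish M zero h = h
evol-vanish M (suc t) {f} h = mask-vanish M (stencil (evol M t f))

δ-vanish : ∀ {M a} → 0 < a → a < M → Vanish M (δ a)
δ-vanish {M} {a} p q = δ-≢ a 0 (λ e → <⇒≢ p (sym e)) , λ x h → δ-≢ a x (λ e → <⇒≱ q (≤-trans h (≤-reflexive (sym e))))

K-vanish : ∀ {M a} t → 0 < a → a < M → Vanish M (K M t a)
K-vanish {M} t p q = evol-vanish M t (δ-vanish p q)

T-ext : ∀ M {f g : ℕ → ℕ} → (∀ x → f x ≡ g x) → ∀ x → T M f x ≡ T M g x
T-ext M h zero = refl
T-ext M {f} {g} h (suc x) with suc x <? M
... | yes _ = cong₂ _+_ (cong₂ _+_ (h x) (cong (2 *_) (h (suc x)))) (h (2 + x))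
... | no _ = refl

T-mono : ∀ M {f g : ℕ → ℕ} → (∀ x → f x ≤ g x) → ∀ x → T M f x ≤ T M g x
T-mono M h zero = z≤n
T-mono M h (suc x) with suc x <? M
... | yes _ = +-mono-≤ (+-mono-≤ (h x) (*-monoʳ-≤ 2 (h (suc x)))) (h (2 + x))
... | no _ = z≤n

T-+ : ∀ M (f g : ℕ → ℕ) x → T M (λ y → f y + g y) x ≡ T M f x + T M g x
T-+ M f g zero = refl
T-+ M f g (suc x) with suc x <? M
... | yes _ = lem (f x) (f (suc x)) (f (2 + x)) (g x) (g (suc x)) (g (2 + x))
  where
  lem : ∀ a b c p q r → a + p + 2 * (b + q) + (c + r) ≡ a + 2 * b + c + (p + 2 * q + r)
  lem = solve-∀
... | no _ = refl

T-* : ∀ M c (f : ℕ → ℕ) x → T M (λ y → c * f y) x ≡ c * T M f x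
T-* M c f zero = sym (*-zeroʳ c)
T-* M c f (suc x) with suc x <? M
... | yes _ = lem c (f x) (f (suc x)) (f (2 + x))
  where
  lem : ∀ c a b d → c * a + 2 * (c * b) + c * d ≡ c * (a + 2 * b + d)
  lem = solve-∀
... | no _ = sym (*-zeroʳ c)

evol-mono : ∀ M t {f g : ℕ → ℕ} → (∀ x → f x ≤ g x) → ∀ x → evol M t f x ≤ evol M t g x
evol-mono M zero h = h
evol-mono M (suc t) h = T-mono M (evol-mono M t h)

evol-* : ∀ M t c (f : ℕ → ℕ) x → evol M t (λ y → c * f y) x ≡ c * evol M t f x
evol-* M zero c f x = refl
evol-* M (suc t) c f x = trans (T-ext M (evol-* M t c f) x) (T-* M c (evol M t f) x)

evol-+ : ∀ M s t (f : ℕ → ℕ) x → evol M (s + t) f x ≡ evol M s (evol M t f) x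
evol-+ M zero t f x = refl
evol-+ M (suc s) t f x = T-ext M (evol-+ M s t f) x

pair : ℕ → (ℕ → ℕ) → (ℕ → ℕ) → ℕ
pair M f g = sum {M} (λ i → f (toℕ i) * g (toℕ i))

pair-comm : ∀ M f g → pair M f g ≡ pair M g f
pair-comm M f g = sum-cong-≗ {M} (λ i → *-comm (f (toℕ i)) (g (toℕ i)))

-- Summation by parts: `sum-telescope` shifts the index of the two off-diagonal sums, and the
-- boundary terms contain values of `f` or `g` at 0 or `M`.
T-selfAdjoint : ∀ M {f g} → Vanish M f → Vanish M g → pair M (T M f) g ≡ pair M f (T M g)
T-selfAdjoint zero vf vg = refl
T-selfAdjoint (suc L) {f} {g} (f0 , f1) (g0 , g1) = begin
  S (λ i → T (suc L) f (suc i) * g (suc i))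
    ≡⟨ sum-cong-≗ {L} (λ i → trans (cong (_* g (suc (toℕ i))) (mask-in (stencil f) (s≤s (toℕ<n i))))
          (lem (f (toℕ i)) (f (suc (toℕ i))) (f (2 + toℕ i)) (g (suc (toℕ i))))) ⟩
  S (λ i → (a i + b i) + c i) ≡⟨ split (λ i → a i + b i) c ⟩
  S (λ i → a i + b i) + S c ≡⟨ cong₂ _+_ (split a b) (shift f g f1 g0) ⟩
  S a + S b + S c′ ≡⟨ cong (λ z → z + S b + S c′) (sym (shift′)) ⟩
  S a′ + S b + S c′ ≡⟨ lem2 (S a′) (S b) (S c′) ⟩
  S c′ + S b + S a′ ≡⟨ cong (_+ S a′) (sym (split c′ b)) ⟩
  S (λ i → c′ i + b i) + S a′ ≡⟨ sym (split (λ i → c′ i + b i) a′) ⟩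
  S (λ i → (c′ i + b i) + a′ i)
    ≡⟨ sum-cong-≗ {L} (λ i → trans (lem3 (f (suc (toℕ i))) (g (toℕ i)) (g (suc (toℕ i))) (g (2 + toℕ i)))
         (cong (f (suc (toℕ i)) *_) (sym (mask-in (stencil g) (s≤s (toℕ<n i)))))) ⟩
  S (λ i → f (suc i) * T (suc L) g (suc i)) ≡⟨ cong (_+ S (λ i → f (suc i) * T (suc L) g (suc i))) (sym (*-zeroʳ (f 0))) ⟩
  f 0 * 0 + S (λ i → f (suc i) * T (suc L) g (suc i)) ∎
  where
  open ≡-Reasoning
  S : (ℕ → ℕ) → ℕ
  S h = sum {L} (λ i → h (toℕ i))
  a b c a′ c′ : ℕ → ℕ
  a i = f i * g (suc i)
  b i = 2 * (f (suc i) * g (suc i))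
  c i = f (2 + i) * g (suc i)
  a′ i = f (suc i) * g (2 + i)
  c′ i = f (suc i) * g i
  split : ∀ u w → S (λ i → u i + w i) ≡ S u + S w
  split u w = ∑-distrib-+ {L} (u ∘ toℕ) (w ∘ toℕ)
  shift : ∀ p q → (∀ x → suc L ≤ x → p x ≡ 0) → q 0 ≡ 0 → S (λ i → p (2 + i) * q (suc i)) ≡ S (λ i → p (suc i) * q i)
  shift p q p1 q0 = begin
    S (λ i → p (2 + i) * q (suc i)) ≡⟨ sym (+-identityʳ _) ⟩
    S (λ i → p (2 + i) * q (suc i)) + 0 ≡⟨ cong (S (λ i → p (2 + i) * q (suc i)) +_) (sym (trans (cong (p 1 *_) q0) (*-zeroʳ (p 1)))) ⟩
    S (λ i → p (2 + i) * q (suc i)) + p 1 * q 0 ≡⟨ sum-telescope L (λ i → p (suc i) * q i) ⟩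
    S (λ i → p (suc i) * q i) + p (suc L) * q L ≡⟨ cong (λ z → S (λ i → p (suc i) * q i) + z * q L) (p1 (suc L) ≤-refl) ⟩
    S (λ i → p (suc i) * q i) + 0 ≡⟨ +-identityʳ _ ⟩
    S (λ i → p (suc i) * q i) ∎
  shift′ : S a′ ≡ S a
  shift′ = trans (sum-cong-≗ {L} (λ i → *-comm (f (suc (toℕ i))) (g (2 + toℕ i))))
    (trans (shift g f g1 f0) (sum-cong-≗ {L} (λ i → *-comm (g (suc (toℕ i))) (f (toℕ i)))))
  lem : ∀ x y z w → (x + 2 * y + z) * w ≡ x * w + 2 * (y * w) + z * w
  lem = solve-∀
  lem2 : ∀ x y z → x + y + z ≡ z + y + x
  lem2 = solve-∀
  lem3 : ∀ w x y z → w * x + 2 * (w * y) + w * z ≡ w * (x + 2 * y + z)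
  lem3 = solve-∀

evol-selfAdjoint : ∀ M t {f g} → Vanish M f → Vanish M g → pair M (evol M t f) g ≡ pair M f (evol M t g)
evol-selfAdjoint M zero vf vg = refl
evol-selfAdjoint M (suc t) {f} {g} vf vg = begin
  pair M (T M (evol M t f)) g ≡⟨ T-selfAdjoint M (evol-vanish M t vf) vg ⟩
  pair M (evol M t f) (T M g) ≡⟨ evol-selfAdjoint M t vf (mask-vanish M (stencil g)) ⟩
  pair M f (evol M t (T M g)) ≡⟨ sum-cong-≗ {M} (λ i → cong (f (toℕ i) *_)
     (trans (sym (evol-+ M t 1 g (toℕ i))) (cong (λ s → evol M s g (toℕ i)) (+-comm t 1)))) ⟩
  pair M f (evol M (suc t) g) ∎
  where open ≡-Reasoning

evol-pairing : ∀ {M} t {f b} → Vanish M f → 0 < b → b < M → evol M t f b ≡ pair M f (K M t b)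
evol-pairing {M} t {f} {b} vf p q = begin
  evol M t f b ≡⟨ sym (sum-δ-< b (evol M t f) q) ⟩
  pair M (δ b) (evol M t f) ≡⟨ pair-comm M (δ b) (evol M t f) ⟩
  pair M (evol M t f) (δ b) ≡⟨ evol-selfAdjoint M t vf (δ-vanish p q) ⟩
  pair M f (K M t b) ∎
  where open ≡-Reasoning

K-sym : ∀ {M} t {a b} → 0 < a → a < M → 0 < b → b < M → K M t a b ≡ K M t b a
K-sym {M} t {a} {b} pa qa pb qb = trans (evol-pairing t (δ-vanish pa qa) pb qb) (sum-δ-< a (K M t b) qa)

-- Chapman-Kolmogorov: self-adjointness hands the last `s` steps to a walk started at `b`.
K-chain : ∀ {M} s t {a b} → 0 < a → a < M → 0 < b → b < M → K M (s + t) a b ≡ pair M (K M t a) (K M s b)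
K-chain {M} s t {a} pa qa pb qb = trans (evol-+ M s t (δ a) _) (evol-pairing s (K-vanish t pa qa) pb qb)

-- Time reversal turns the surviving mass into the evolved indicator as a function of the starting
-- point, to which comparison functions apply.
K-mass : ∀ {M} t {a} → 0 < a → a < M → sum {M} (λ i → K M t a (toℕ i)) ≡ evol M t (one M) a
K-mass {M} t {a} p q = sym (trans (evol-pairing t (mask-vanish M (λ _ → 1)) p q) (sum-cong-≗ {M} go))
  where
  go : ∀ i → one M (toℕ i) * K M t a (toℕ i) ≡ K M t a (toℕ i)
  go i with toℕ i | toℕ<n i
  ... | zero | _ = sym (proj₁ (K-vanish t p q))
  ... | suc x | h = trans (cong (_* K M t a (suc x)) (mask-in (λ _ → 1) h)) (+-identityʳ _)

-- Comparison with sub- and supersolutions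

-- `p / q` is the growth factor per application of `T`, where 4 would mean no loss. The inequality
-- passes from one time to the next because the stencil has nonnegative weights.
subsolution : ∀ M p q φ → Vanish M φ → (∀ x → 0 < x → x < M → p * φ x ≤ q * stencil φ x) →
  ∀ t x → p ^ t * φ x ≤ q ^ t * evol M t φ x
subsolution M p q φ vφ h zero x = ≤-refl
subsolution M p q φ (v0 , v1) h (suc t) x with place M x
... | left = ≤-trans (≤-reflexive (trans (cong (p * p ^ t *_) v0) (*-zeroʳ (p * p ^ t)))) z≤n
... | right r = ≤-trans (≤-reflexive (trans (cong (p * p ^ t *_) (v1 x r)) (*-zeroʳ (p * p ^ t)))) z≤n
... | inner {y} z e = begin
  p * p ^ t * φ (suc y) ≡⟨ lem p (p ^ t) (φ (suc y)) ⟩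
  p ^ t * (p * φ (suc y)) ≤⟨ *-monoʳ-≤ (p ^ t) (h (suc y) (s≤s z≤n) (inner-< e)) ⟩
  p ^ t * (q * (φ y + 2 * φ (suc y) + φ (2 + y))) ≡⟨ lem2 (p ^ t) q (φ y) (φ (suc y)) (φ (2 + y)) ⟩
  q * (p ^ t * φ y + 2 * (p ^ t * φ (suc y)) + p ^ t * φ (2 + y))
    ≤⟨ *-monoʳ-≤ q (+-mono-≤ (+-mono-≤ (ih y) (*-monoʳ-≤ 2 (ih (suc y)))) (ih (2 + y))) ⟩
  q * (q ^ t * E y + 2 * (q ^ t * E (suc y)) + q ^ t * E (2 + y)) ≡⟨ lem3 q (q ^ t) (E y) (E (suc y)) (E (2 + y)) ⟩
  q * q ^ t * (E y + 2 * E (suc y) + E (2 + y)) ≡⟨ cong (q * q ^ t *_) (sym (T-inner E e)) ⟩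
  q * q ^ t * T M E (suc y) ∎
  where
  open ≤-Reasoning
  E = evol M t φ
  ih = subsolution M p q φ (v0 , v1) h t
  lem : ∀ a b c → a * b * c ≡ b * (a * c)
  lem = solve-∀
  lem2 : ∀ a b c d e → a * (b * (c + 2 * d + e)) ≡ b * (a * c + 2 * (a * d) + a * e)
  lem2 = solve-∀
  lem3 : ∀ a b c d e → a * (b * c + 2 * (b * d) + b * e) ≡ a * b * (c + 2 * d + e)
  lem3 = solve-∀

-- A parabolic maximum principle on [0,b]. At 0 the walk is dead after one step, so the only
-- boundary to control at all times is `b`.
supersolution : ∀ M b p q (f φ : ℕ → ℕ) → b ≤ M → (∀ x → x ≤ b → f x ≤ φ x) →
  (∀ t → q ^ t * evol M t f b ≤ p ^ t * φ b) →
  (∀ x → 0 < x → x < b → q * stencil φ x ≤ p * φ x) →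
  ∀ t x → x ≤ b → q ^ t * evol M t f x ≤ p ^ t * φ x
supersolution M b p q f φ bM h0 hb h zero x xb = *-monoʳ-≤ 1 (h0 x xb)
supersolution M b p q f φ bM h0 hb h (suc t) zero xb = ≤-trans (≤-reflexive (*-zeroʳ (q * q ^ t))) z≤n
supersolution M b p q f φ bM h0 hb h (suc t) (suc y) xb with m≤n⇒m<n∨m≡n xb
... | inj₂ refl = hb (suc t)
... | inj₁ yb = begin
  q * q ^ t * T M E (suc y) ≡⟨ cong (q * q ^ t *_) (mask-in (stencil E) (≤-trans yb bM)) ⟩
  q * q ^ t * (E y + 2 * E (suc y) + E (2 + y)) ≡⟨ lem3 q (q ^ t) (E y) (E (suc y)) (E (2 + y)) ⟩
  q * (q ^ t * E y + 2 * (q ^ t * E (suc y)) + q ^ t * E (2 + y))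
    ≤⟨ *-monoʳ-≤ q (+-mono-≤ (+-mono-≤ (ih y (≤-trans (n≤1+n y) xb)) (*-monoʳ-≤ 2 (ih (suc y) xb))) (ih (2 + y) yb)) ⟩
  q * (p ^ t * φ y + 2 * (p ^ t * φ (suc y)) + p ^ t * φ (2 + y)) ≡⟨ lem2 (p ^ t) q (φ y) (φ (suc y)) (φ (2 + y)) ⟩
  p ^ t * (q * (φ y + 2 * φ (suc y) + φ (2 + y))) ≤⟨ *-monoʳ-≤ (p ^ t) (h (suc y) (s≤s z≤n) yb) ⟩
  p ^ t * (p * φ (suc y)) ≡⟨ lem p (p ^ t) (φ (suc y)) ⟩
  p * p ^ t * φ (suc y) ∎
  where
  open ≤-Reasoning
  E = evol M t f
  ih = supersolution M b p q f φ bM h0 hb h t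
  lem : ∀ a b c → b * (a * c) ≡ a * b * c
  lem = solve-∀
  lem2 : ∀ a b c d e → b * (a * c + 2 * (a * d) + a * e) ≡ a * (b * (c + 2 * d + e))
  lem2 = solve-∀
  lem3 : ∀ a b c d e → a * b * (c + 2 * d + e) ≡ a * (b * c + 2 * (b * d) + b * e)
  lem3 = solve-∀

four-*-≤-square : ∀ x y → 4 * (x * y) ≤ (x + y) * (x + y)
four-*-≤-square x y with ≤-total x y
... | inj₁ h with m≤n⇒∃[o]m+o≡n h
... | k , refl = ≤-trans (m≤m+n _ (k * k)) (≤-reflexive (lem x k))
  where
  lem : ∀ x k → 4 * (x * (x + k)) + k * k ≡ (x + (x + k)) * (x + (x + k))
  lem = solve-∀
four-*-≤-square x y | inj₂ h with m≤n⇒∃[o]m+o≡n h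
... | k , refl = ≤-trans (m≤m+n _ (k * k)) (≤-reflexive (lem y k))
  where
  lem : ∀ x k → 4 * ((x + k) * x) + k * k ≡ (x + k + x) * (x + k + x)
  lem = solve-∀

-- Half the expected exit time from [0,M] of the lazy walk; it decays at rate at least 2 / M².
e : ℕ → ℕ → ℕ
e M x = x * (M ∸ x)

inner-sub : ∀ p q → 2 + p + q ∸ p ≡ 2 + q
inner-sub p q = trans (cong (_∸ p) (lem p q)) (m+n∸m≡n p (2 + q))
  where
  lem : ∀ p q → 2 + p + q ≡ p + (2 + q)
  lem = solve-∀

inner-sub₁ : ∀ p q → 2 + p + q ∸ suc p ≡ 1 + q
inner-sub₁ p q = trans (cong (_∸ p) (lem p q)) (m+n∸m≡n p (1 + q))
  where
  lem : ∀ p q → 1 + p + q ≡ p + (1 + q)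
  lem = solve-∀

inner-sub₂ : ∀ p q → 2 + p + q ∸ suc (suc p) ≡ q
inner-sub₂ p q = m+n∸m≡n p q

e-vanish : ∀ M → Vanish M (e M)
e-vanish M = refl , λ x h → trans (cong (x *_) (m≤n⇒m∸n≡0 h)) (*-zeroʳ x)

e-stencil : ∀ {M} x → 0 < x → x < M → stencil (e M) x + 2 ≡ 4 * e M x
e-stencil {M} x 0<x x<M with place M x
e-stencil {M} .0 () x<M | left
e-stencil {M} x 0<x x<M | right h = ⊥-elim (<⇒≱ x<M h)
e-stencil {.(2 + p + q)} (suc p) 0<x x<M | inner q refl
  rewrite inner-sub p q | inner-sub₁ p q | inner-sub₂ p q = lem p q
  where
  lem : ∀ p q → p * (2 + q) + 2 * (suc p * (1 + q)) + suc (suc p) * q + 2 ≡ 4 * (suc p * (1 + q))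
  lem = solve-∀

four-e≤ : ∀ M x → 4 * e M x ≤ M * M
four-e≤ M x with ≤-total x M
... | inj₁ h = ≤-trans (four-*-≤-square x (M ∸ x)) (≤-reflexive (cong (λ z → z * z) (m+[n∸m]≡n h)))
... | inj₂ h = ≤-trans (≤-reflexive (cong (4 *_) (proj₂ (e-vanish M) x h))) z≤n

-- Unimodality and the reflection principle

-- A strict descent is never followed by a strict ascent. No mode is named, so none has to be
-- tracked as it moves under `T`.
Unimodal : (ℕ → ℕ) → Set
Unimodal f = ∀ x y → x ≤ y → f (suc x) < f x → f (suc y) ≤ f y

-- Convolution with the log-concave weights 1, 2, 1 preserves unimodality. A strict fall of `f` at
-- `x` or `suc x` settles all later differences, and without a fall up to `3 + x` the function
-- `T M f` could not have fallen. The remaining case is a peak of `f` at `2 + x`.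
T-unimodal : ∀ M {f} → Unimodal f → Unimodal (T M f)
T-unimodal M {f} uf zero y x≤y ()
T-unimodal M {f} uf (suc x) y x≤y dec with suc x <? M
T-unimodal M {f} uf (suc x) y x≤y () | no _
T-unimodal M {f} uf (suc x) (suc y) (s≤s x≤y) dec | yes p with suc (suc x) <? M | suc (suc y) <? M | suc y <? M
... | _ | no _ | _ = z≤n
... | _ | yes q | no r = ⊥-elim (r (<-trans (n<1+n (suc y)) q))
... | no q | yes r | yes _ = ⊥-elim (q (≤-trans (s≤s (s≤s (s≤s x≤y))) r))
... | yes q | yes _ | yes _ with f x ≤? f (suc x)
... | no a = +-mono-≤ (+-mono-≤ (down y x≤y) (*-monoʳ-≤ 2 (down (suc y) (m≤n⇒m≤1+n x≤y)))) (down (2 + y) (m≤n⇒m≤1+n (m≤n⇒m≤1+n x≤y)))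
  where
  down : ∀ z → x ≤ z → f (suc z) ≤ f z
  down z h = uf x z h (≰⇒> a)
... | yes a with m≤n⇒m<n∨m≡n x≤y
... | inj₂ refl = <⇒≤ dec
... | inj₁ x<y with f (suc x) ≤? f (2 + x)
... | no b = +-mono-≤ (+-mono-≤ (down y x<y) (*-monoʳ-≤ 2 (down (suc y) (m≤n⇒m≤1+n x<y)))) (down (2 + y) (m≤n⇒m≤1+n (m≤n⇒m≤1+n x<y)))
  where
  down : ∀ z → suc x ≤ z → f (suc z) ≤ f z
  down z h = uf (suc x) z h (≰⇒> b)
... | yes b with f (2 + x) ≤? f (3 + x)
... | yes c = ⊥-elim (<⇒≱ dec (+-mono-≤ (+-mono-≤ a (*-monoʳ-≤ 2 b)) c))
... | no c = go y x<y
  where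
  down : ∀ z → 2 + x ≤ z → f (suc z) ≤ f z
  down z h = uf (2 + x) z h (≰⇒> c)
  A B C D : ℕ
  A = f x
  B = f (suc x)
  C = f (2 + x)
  D = f (3 + x)
  open ≤-Reasoning
  -- With `A ≤ B`, the fall `B + 2C + D < A + 2B + C` forces `C + D ≤ 2B`. As `D < C`, this gives
  -- `D ≤ B`: after its peak `f` drops at least to the value before it, which is what the next
  -- difference of `T M f` needs.
  CD : C + D ≤ 2 * B
  CD = +-cancelʳ-≤ (B + C) (C + D) (2 * B) (begin
    C + D + (B + C) ≡⟨ lem C D B ⟩
    B + 2 * C + D ≤⟨ <⇒≤ dec ⟩
    A + 2 * B + C ≤⟨ +-monoˡ-≤ C (+-monoˡ-≤ (2 * B) a) ⟩
    B + 2 * B + C ≡⟨ lem2 B C ⟩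
    2 * B + (B + C) ∎)
    where
    lem : ∀ c d b → c + d + (b + c) ≡ b + 2 * c + d
    lem = solve-∀
    lem2 : ∀ b c → b + 2 * b + c ≡ 2 * b + (b + c)
    lem2 = solve-∀
  D≤B : D ≤ B
  D≤B = *-cancelˡ-≤ 2 (begin
    2 * D ≡⟨ cong (D +_) (+-identityʳ D) ⟩
    D + D ≤⟨ +-monoˡ-≤ D (<⇒≤ (≰⇒> c)) ⟩
    C + D ≤⟨ CD ⟩
    2 * B ∎)
  go : ∀ y → suc x ≤ y → f (suc y) + 2 * f (2 + y) + f (3 + y) ≤ f y + 2 * f (suc y) + f (2 + y)
  go y h with m≤n⇒m<n∨m≡n h
  ... | inj₁ k = +-mono-≤ (+-mono-≤ (down y k) (*-monoʳ-≤ 2 (down (suc y) (m≤n⇒m≤1+n k)))) (down (2 + y) (m≤n⇒m≤1+n (m≤n⇒m≤1+n k)))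
  ... | inj₂ refl = begin
    C + 2 * D + f (4 + x) ≤⟨ +-monoʳ-≤ (C + 2 * D) (≤-trans (down (3 + x) (n≤1+n (2 + x))) D≤B) ⟩
    C + 2 * D + B ≡⟨ lem B C D ⟩
    B + C + D + D ≤⟨ +-monoʳ-≤ (B + C + D) (<⇒≤ (≰⇒> c)) ⟩
    B + C + D + C ≡⟨ lem2 B C D ⟩
    B + 2 * C + D ∎
    where
    lem : ∀ b c d → c + 2 * d + b ≡ b + c + d + d
    lem = solve-∀
    lem2 : ∀ b c d → b + c + d + c ≡ b + 2 * c + d
    lem2 = solve-∀

evol-unimodal : ∀ M t {f} → Unimodal f → Unimodal (evol M t f)
evol-unimodal M zero h = h
evol-unimodal M (suc t) h = T-unimodal M (evol-unimodal M t h)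

δ-unimodal : ∀ a → Unimodal (δ a)
δ-unimodal zero x y h d = z≤n
δ-unimodal (suc a) zero y h ()
δ-unimodal (suc a) (suc x) (suc y) (s≤s h) d = δ-unimodal a x y h d

increasing-or-decreasing : ∀ {f} → Unimodal f → ∀ r →
  (∀ x → x < r → f x ≤ f (suc x)) ⊎ (∀ y → r ≤ y → f (suc y) ≤ f y)
increasing-or-decreasing {f} uf zero = inj₁ (λ x ())
increasing-or-decreasing {f} uf (suc r) with increasing-or-decreasing uf r
... | inj₂ h = inj₂ (λ y q → h y (<⇒≤ q))
... | inj₁ h with f r ≤? f (suc r)
... | no q = inj₂ (λ y p → uf r y (<⇒≤ p) (≰⇒> q))
... | yes q = inj₁ go
  where
  go : ∀ x → x < suc r → f x ≤ f (suc x)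
  go x (s≤s p) with m≤n⇒m<n∨m≡n p
  ... | inj₁ k = h x k
  ... | inj₂ refl = q

increasing : ∀ {f : ℕ → ℕ} {r} → (∀ x → x < r → f x ≤ f (suc x)) → ∀ x w → x + w ≤ r → f x ≤ f (x + w)
increasing {f} h x zero p = ≤-reflexive (cong f (sym (+-identityʳ x)))
increasing {f} {r} h x (suc w) p = ≤-trans (increasing h x w (≤-trans (n≤1+n _) p′))
  (≤-trans (h (x + w) p′) (≤-reflexive (cong f (sym (+-suc x w)))))
  where p′ = ≤-trans (≤-reflexive (sym (+-suc x w))) p

decreasing : ∀ {f : ℕ → ℕ} {r} → (∀ y → r ≤ y → f (suc y) ≤ f y) → ∀ x w → r ≤ x → f (x + w) ≤ f x
decreasing {f} h x zero p = ≤-reflexive (cong f (+-identityʳ x))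
decreasing {f} h x (suc w) p = ≤-trans (≤-reflexive (cong f (+-suc x w)))
  (≤-trans (h (x + w) (m≤n⇒m≤n+o w p)) (decreasing h x w p))

double : ∀ r → 2 * r ≡ r + r
double r = cong (r +_) (+-identityʳ r)

-- The reflection principle: the walk on [0,2r] minus its mirror image is the walk on [0,r].
reflection : ∀ r t {a} → 0 < a → a ≤ r → ∀ x w → x + w ≡ r →
  K (2 * r) t a x ≡ K (2 * r) t a (r + w) + evol r t (mask r (δ a)) x
-- The start `a = r` is included: there `mask r (δ a)` is 0 and the identity is the symmetry of the
-- walk about its midpoint.
reflection r zero {a} 0<a a≤r zero w refl = trans (δ-≢ a 0 (λ k → <⇒≢ 0<a (sym k)))
  (sym (trans (+-identityʳ _) (δ-≢ a (w + w) (λ k → <⇒≢ (≤-<-trans a≤r (m<m+n w (≤-trans 0<a a≤r))) k))))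
reflection r zero {a} 0<a a≤r (suc x) w k with suc x <? r
... | yes p = sym (cong (_+ δ a (suc x)) (δ-≢ a (r + w) (λ k′ → <⇒≢ (≤-<-trans a≤r (m<m+n r w>0)) k′)))
  where
  w>0 : 0 < w
  w>0 = n≢0⇒n>0 (λ { refl → <⇒≢ p (trans (sym (+-identityʳ _)) k) })
... | no p = sym (trans (+-identityʳ _) (cong (δ a) (trans (cong (r +_) w0) (trans (+-identityʳ r) (trans (sym k) (trans (cong (suc x +_) w0) (+-identityʳ _)))))))
  where
  w0 : w ≡ 0
  w0 = n≤0⇒n≡0 (+-cancelˡ-≤ (suc x) w 0 (≤-trans (≤-reflexive k) (≤-trans (≮⇒≥ p) (≤-reflexive (sym (+-identityʳ _))))))
reflection r (suc t) {a} 0<a a≤r zero w refl = sym (trans (+-identityʳ _) (mask-out {2 * r} _ (≤-reflexive (double r))))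
reflection r (suc t) {a} 0<a a≤r (suc x) zero k =
  trans (cong (K (2 * r) (suc t) a) (trans (sym (+-identityʳ _)) (trans k (sym (+-identityʳ r)))))
    (sym (trans (cong (K (2 * r) (suc t) a (r + 0) +_) (mask-out {r} _ (≤-reflexive (trans (sym k) (+-identityʳ _))))) (+-identityʳ _)))
reflection r (suc t) {a} 0<a a≤r (suc x) (suc w) refl = begin
  T (2 * r) F (suc x) ≡⟨ mask-in (stencil F) (≤-trans x<r (m≤m+n r _)) ⟩
  F x + 2 * F (suc x) + F (2 + x)
    ≡⟨ cong₂ _+_ (cong₂ _+_ (ih x (2 + w) (lem₁ x w)) (cong (2 *_) (ih (suc x) (suc w) refl))) (ih (2 + x) w (lem₂ x w)) ⟩
  F (r + (2 + w)) + H x + 2 * (F (r + suc w) + H (suc x)) + (F (r + w) + H (2 + x))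
    ≡⟨ lem₃ (F (r + (2 + w))) (H x) (F (r + suc w)) (H (suc x)) (F (r + w)) (H (2 + x)) ⟩
  (F (r + w) + 2 * F (r + suc w) + F (r + (2 + w))) + (H x + 2 * H (suc x) + H (2 + x))
    ≡⟨ sym (cong₂ _+_ right-side (mask-in (stencil H) x<r)) ⟩
  T (2 * r) F (r + suc w) + T r H (suc x) ∎
  where
  open ≡-Reasoning
  F = K (2 * r) t a
  H = evol r t (mask r (δ a))
  ih = reflection r t {a} 0<a a≤r
  x<r : suc x < r
  x<r = m<m+n (suc x) (s≤s z≤n)
  right-side : T (2 * r) F (r + suc w) ≡ F (r + w) + 2 * F (r + suc w) + F (r + (2 + w))
  right-side = trans (cong (T (2 * r) F) (+-suc r w)) (trans (mask-in (stencil F)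
     (≤-trans (s≤s (≤-reflexive (sym (+-suc r w)))) (≤-trans (+-monoʳ-< r (m<n+m (suc w) (s≤s z≤n))) (≤-reflexive (sym (double r))))))
     (cong₂ _+_ (cong (F (r + w) +_) (cong (λ z → 2 * F z) (sym (+-suc r w)))) (cong F (sym (trans (+-suc r (suc w)) (cong suc (+-suc r w)))))))
  lem₁ : ∀ x w → x + (2 + w) ≡ suc x + suc w
  lem₁ = solve-∀
  lem₂ : ∀ x w → 2 + x + w ≡ suc x + suc w
  lem₂ = solve-∀
  lem₃ : ∀ p a q b s c → p + a + 2 * (q + b) + (s + c) ≡ (s + 2 * q + p) + (a + 2 * b + c)
  lem₃ = solve-∀

sum-split : ∀ m n (F : ℕ → ℕ) → sum {m + n} (F ∘ toℕ) ≡ sum {m} (F ∘ toℕ) + sum {n} (λ i → F (m + toℕ i))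
sum-split zero n F = refl
sum-split (suc m) n F = trans (cong (F 0 +_) (sum-split m n (F ∘ suc))) (sym (+-assoc (F 0) _ _))

sum-rev : ∀ n (F : ℕ → ℕ) → sum {n} (F ∘ toℕ) ≡ sum {n} (λ i → F (n ∸ suc (toℕ i)))
sum-rev zero F = refl
sum-rev (suc n) F = begin
  F 0 + sum {n} (λ i → F (suc (toℕ i))) ≡⟨ +-comm (F 0) _ ⟩
  sum {n} (λ i → F (suc (toℕ i))) + F 0 ≡⟨ sum-telescope n F ⟩
  sum {n} (F ∘ toℕ) + F n ≡⟨ +-comm _ (F n) ⟩
  F n + sum {n} (F ∘ toℕ) ≡⟨ cong (F n +_) (sum-rev n F) ⟩
  F n + sum {n} (λ i → F (n ∸ suc (toℕ i))) ∎
  where open ≡-Reasoning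

-- Makes a pointwise bound at the midpoint out of survival. Reflection gives
-- `F (r + w) ≤ F (r − w)`, so by unimodality no value right of `r` exceeds `F r`. A value on the
-- left is its mirror image plus `H`, and the sum of `H` is the survival in the half interval [0,r].
centre-mass : ∀ r t {a} → 0 < a → a ≤ r →
  evol (2 * r) t (one (2 * r)) a ≤ 2 * r * K (2 * r) t a r + evol r t (one r) a
centre-mass r t {a} 0<a a≤r = begin
  evol (2 * r) t (one (2 * r)) a ≡⟨ sym (K-mass t 0<a (≤-<-trans a≤r r<2r)) ⟩
  sum {2 * r} (F ∘ toℕ) ≡⟨ cong (λ z → sum {z} (F ∘ toℕ)) (double r) ⟩
  sum {r + r} (F ∘ toℕ) ≡⟨ sum-split r r F ⟩
  sum {r} (F ∘ toℕ) + sum {r} (λ i → F (r + toℕ i))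
    ≤⟨ +-mono-≤ (sum-mono {r} (λ i → left-bound (toℕ i) (<⇒≤ (toℕ<n i)))) (sum-mono {r} (λ i → right-bound (toℕ i) (<⇒≤ (toℕ<n i)))) ⟩
  sum {r} (λ i → F r + H (toℕ i)) + sum {r} (λ _ → F r)
    ≡⟨ cong₂ _+_ (trans (∑-distrib-+ {r} (λ _ → F r) (H ∘ toℕ)) (cong (_+ sum {r} (H ∘ toℕ)) (sum-const r (F r)))) (sum-const r (F r)) ⟩
  r * F r + sum {r} (H ∘ toℕ) + r * F r ≡⟨ lem r (F r) (sum {r} (H ∘ toℕ)) ⟩
  2 * r * F r + sum {r} (H ∘ toℕ) ≤⟨ +-monoʳ-≤ (2 * r * F r) H-mass ⟩
  2 * r * F r + evol r t (one r) a ∎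
  where
  open ≤-Reasoning
  F = K (2 * r) t a
  H = evol r t (mask r (δ a))
  r<2r : r < 2 * r
  r<2r = ≤-trans (m<m+n r (≤-trans 0<a a≤r)) (≤-reflexive (sym (double r)))
  lem : ∀ r f s → r * f + s + r * f ≡ 2 * r * f + s
  lem = solve-∀
  refl-le : ∀ x w → x + w ≡ r → F (r + w) ≤ F x
  refl-le x w k = ≤-trans (m≤m+n _ (H x)) (≤-reflexive (sym (reflection r t 0<a a≤r x w k)))
  right-bound : ∀ w → w ≤ r → F (r + w) ≤ F r
  right-bound w p with increasing-or-decreasing (evol-unimodal (2 * r) t (δ-unimodal a)) r
  ... | inj₁ up = ≤-trans (refl-le (r ∸ w) w (m∸n+n≡m p))
     (≤-trans (increasing up (r ∸ w) w (≤-reflexive (m∸n+n≡m p))) (≤-reflexive (cong F (m∸n+n≡m p))))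
  ... | inj₂ down = decreasing down r w ≤-refl
  left-bound : ∀ x → x ≤ r → F x ≤ F r + H x
  left-bound x p = ≤-trans (≤-reflexive (reflection r t 0<a a≤r x (r ∸ x) (m+[n∸m]≡n p)))
     (+-monoˡ-≤ (H x) (right-bound (r ∸ x) (m∸n≤m r x)))
  mask≤ : ∀ x → mask r (δ a) x ≤ δ a x
  mask≤ zero = z≤n
  mask≤ (suc x) with suc x <? r
  ... | yes _ = ≤-refl
  ... | no _ = z≤n
  pair-one : ∀ {f} → Vanish r f → sum {r} (f ∘ toℕ) ≡ pair r f (one r)
  pair-one {f} vf = sum-cong-≗ {r} go
    where
    go : ∀ i → f (toℕ i) ≡ f (toℕ i) * one r (toℕ i)
    go i with toℕ i | toℕ<n i
    ... | zero | _ = trans (proj₁ vf) (sym (*-zeroʳ (f 0)))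
    ... | suc x | h = sym (trans (cong (f (suc x) *_) (mask-in (λ _ → 1) h)) (*-identityʳ _))
  H-mass : sum {r} (H ∘ toℕ) ≤ evol r t (one r) a
  H-mass = begin
    sum {r} (H ∘ toℕ) ≡⟨ pair-one (evol-vanish r t (mask-vanish r (δ a))) ⟩
    pair r H (one r) ≡⟨ evol-selfAdjoint r t (mask-vanish r (δ a)) (mask-vanish r (λ _ → 1)) ⟩
    pair r (mask r (δ a)) (evol r t (one r)) ≤⟨ sum-mono {r} (λ i → *-monoˡ-≤ (evol r t (one r) (toℕ i)) (mask≤ (toℕ i))) ⟩
    pair r (δ a) (evol r t (one r)) ≤⟨ in-or-out ⟩
    evol r t (one r) a ∎
    where
    in-or-out : pair r (δ a) (evol r t (one r)) ≤ evol r t (one r) a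
    in-or-out with a <? r
    ... | yes p = ≤-reflexive (sum-δ-< a (evol r t (one r)) p)
    ... | no p = ≤-trans (≤-reflexive (sum-δ-≥ a (evol r t (one r)) (≮⇒≥ p))) z≤n

K-reflect : ∀ M t {a b} → 0 < a → 0 < b → a + b ≡ M → ∀ x y → x + y ≡ M → K M t a x ≡ K M t b y
K-reflect M zero {a} {b} pa pb refl x y k with a ≟ x
... | yes refl = trans (δ-refl a) (sym (trans (cong (δ b) (+-cancelˡ-≡ a y b k)) (δ-refl b)))
... | no h = trans (δ-≢ a x h) (sym (δ-≢ b y (λ { refl → h (+-cancelʳ-≡ b a x (sym k)) })))
K-reflect M (suc t) {a} {b} pa pb k zero y refl = sym (mask-out {y} (stencil (K M t b)) ≤-refl)
K-reflect M (suc t) {a} pa pb k (suc x) zero l = mask-out (stencil (K M t a)) (≤-reflexive (trans (sym l) (+-identityʳ _)))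
K-reflect M (suc t) {a} {b} pa pb k (suc x) (suc y) l = begin
  T M (K M t a) (suc x) ≡⟨ T-inner {q = y} (K M t a) (trans (sym l) (cong suc (+-suc x y))) ⟩
  K M t a x + 2 * K M t a (suc x) + K M t a (2 + x)
    ≡⟨ cong₂ _+_ (cong₂ _+_ (ih x (2 + y) (trans (lem x y) l)) (cong (2 *_) (ih (suc x) (suc y) l))) (ih (2 + x) y (trans (lem′ x y) l)) ⟩
  K M t b (2 + y) + 2 * K M t b (suc y) + K M t b y ≡⟨ lem″ (K M t b (2 + y)) (K M t b (suc y)) (K M t b y) ⟩
  K M t b y + 2 * K M t b (suc y) + K M t b (2 + y)
    ≡⟨ sym (T-inner {q = x} (K M t b) (trans (sym l) (cong suc (trans (+-suc x y) (cong suc (+-comm x y)))))) ⟩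
  T M (K M t b) (suc y) ∎
  where
  open ≡-Reasoning
  ih = K-reflect M t {a} {b} pa pb k
  lem : ∀ x y → x + (2 + y) ≡ suc x + suc y
  lem = solve-∀
  lem′ : ∀ x y → 2 + x + y ≡ suc x + suc y
  lem′ = solve-∀
  lem″ : ∀ a b c → a + 2 * b + c ≡ c + 2 * b + a
  lem″ = solve-∀

-- Survival on an interval and on its left half

-- The quartic x (M − x) (M² + x (M − x)) imitates sin (π x / M): its decay rate is at most 3 / M² per lazy step.
ψ : ℕ → ℕ → ℕ
ψ M x = e M x * (M * M + e M x)

ψ-vanish : ∀ M → Vanish M (ψ M)
ψ-vanish M = refl , λ x h → cong (_* (M * M + e M x)) (proj₂ (e-vanish M) x h)

ψ-stencil : ∀ {M} x → 0 < x → x < M → stencil (ψ M) x + 12 * e M x ≡ 4 * ψ M x + 2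
ψ-stencil {M} x 0<x x<M with place M x
ψ-stencil {M} .0 () x<M | left
ψ-stencil {M} x 0<x x<M | right h = ⊥-elim (<⇒≱ x<M h)
ψ-stencil {.(2 + p + q)} (suc p) 0<x x<M | inner q refl
  rewrite inner-sub p q | inner-sub₁ p q | inner-sub₂ p q = lem p q
  where
  lem : ∀ p q → p * (2 + q) * ((2 + p + q) * (2 + p + q) + p * (2 + q))
    + 2 * (suc p * (1 + q) * ((2 + p + q) * (2 + p + q) + suc p * (1 + q)))
    + suc (suc p) * q * ((2 + p + q) * (2 + p + q) + suc (suc p) * q) + 12 * (suc p * (1 + q))
    ≡ 4 * (suc p * (1 + q) * ((2 + p + q) * (2 + p + q) + suc p * (1 + q))) + 2
  lem = solve-∀

-- By `ψ-stencil` the relative loss is at most 12e / 4ψ = 3 / (M² + e) ≤ 3 / M², that is, the rate m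
-- / M² with `m` = M² - 3.
ψ-subsolution : ∀ M m → M * M ≡ m + 3 → ∀ x → 0 < x → x < M → 4 * m * ψ M x ≤ M * M * stencil (ψ M) x
ψ-subsolution M m hm x p q = +-cancelʳ-≤ (12 * (M * M * E)) (4 * m * ψ M x) (M * M * stencil (ψ M) x) (begin
  4 * m * ψ M x + 12 * (M * M * E) ≤⟨ +-monoʳ-≤ (4 * m * ψ M x) (*-monoʳ-≤ 12 (≤-trans (≤-reflexive (*-comm (M * M) E)) (*-monoʳ-≤ E (m≤m+n (M * M) E)))) ⟩
  4 * m * ψ M x + 12 * ψ M x ≡⟨ lem m (ψ M x) ⟩
  (m + 3) * (4 * ψ M x) ≡⟨ cong (_* (4 * ψ M x)) (sym hm) ⟩
  M * M * (4 * ψ M x) ≤⟨ *-monoʳ-≤ (M * M) (m≤m+n (4 * ψ M x) 2) ⟩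
  M * M * (4 * ψ M x + 2) ≡⟨ cong (M * M *_) (sym (ψ-stencil x p q)) ⟩
  M * M * (stencil (ψ M) x + 12 * E) ≡⟨ lem2 (M * M) (stencil (ψ M) x) E ⟩
  M * M * stencil (ψ M) x + 12 * (M * M * E) ∎)
  where
  open ≤-Reasoning
  E = e M x
  lem : ∀ m s → 4 * m * s + 12 * s ≡ (m + 3) * (4 * s)
  lem = solve-∀
  lem2 : ∀ a b c → a * (b + 12 * c) ≡ a * b + 12 * (a * c)
  lem2 = solve-∀

-- From e ≤ M²/4 follows ψ ≤ (M²/4)(5M²/4) = 5M⁴/16.
ψ≤one : ∀ M x → 16 * ψ M x ≤ 5 * (M * M) * (M * M) * one M x
ψ≤one M x with place M x
... | left = z≤n
... | right h = ≤-trans (≤-reflexive (cong (16 *_) (proj₂ (ψ-vanish M) x h))) z≤n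
... | inner {p} q k = begin
  16 * (E * (S + E)) ≡⟨ lem E S ⟩
  4 * E * (4 * S + 4 * E) ≤⟨ *-mono-≤ (four-e≤ M (suc p)) (+-monoʳ-≤ (4 * S) (four-e≤ M (suc p))) ⟩
  S * (4 * S + S) ≡⟨ lem2 S ⟩
  5 * S * S * 1 ≡⟨ cong (5 * S * S *_) (sym (mask-in (λ _ → 1) (inner-< k))) ⟩
  5 * S * S * one M (suc p) ∎
  where
  open ≤-Reasoning
  E = e M (suc p)
  S = M * M
  lem : ∀ a s → 16 * (a * (s + a)) ≡ 4 * a * (4 * s + 4 * a)
  lem = solve-∀
  lem2 : ∀ s → s * (4 * s + s) ≡ 5 * s * s * 1
  lem2 = solve-∀

survival-lower : ∀ M m → M * M ≡ m + 3 → ∀ t a →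
  16 * ((4 * m) ^ t * e M a) ≤ (M * M) ^ t * (5 * (M * M) * evol M t (one M) a)
survival-lower M m hm t a = *-cancelˡ-≤ (M * M) {{subst NonZero (trans (+-comm 3 m) (sym hm)) _}} (begin
  S * (16 * (P * E)) ≡⟨ lem S P E ⟩
  16 * (P * (E * S)) ≤⟨ *-monoʳ-≤ 16 (*-monoʳ-≤ P (*-monoʳ-≤ E (m≤m+n S E))) ⟩
  16 * (P * ψ M a) ≤⟨ *-monoʳ-≤ 16 (subsolution M (4 * m) S (ψ M) (ψ-vanish M) (ψ-subsolution M m hm) t a) ⟩
  16 * (S ^ t * evol M t (ψ M) a) ≡⟨ lem3 16 (S ^ t) (evol M t (ψ M) a) ⟩
  S ^ t * (16 * evol M t (ψ M) a) ≡⟨ cong (S ^ t *_) (sym (evol-* M t 16 (ψ M) a)) ⟩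
  S ^ t * evol M t (λ x → 16 * ψ M x) a ≤⟨ *-monoʳ-≤ (S ^ t) (evol-mono M t (ψ≤one M) a) ⟩
  S ^ t * evol M t (λ x → 5 * S * S * one M x) a ≡⟨ cong (S ^ t *_) (evol-* M t (5 * S * S) (one M) a) ⟩
  S ^ t * (5 * S * S * evol M t (one M) a) ≡⟨ lem2 (S ^ t) S (evol M t (one M) a) ⟩
  S * (S ^ t * (5 * S * evol M t (one M) a)) ∎)
  where
  open ≤-Reasoning
  S = M * M
  P = (4 * m) ^ t
  E = e M a
  lem : ∀ s p x → s * (16 * (p * x)) ≡ 16 * (p * (x * s))
  lem = solve-∀
  lem2 : ∀ p s x → p * (5 * s * s * x) ≡ s * (p * (5 * s * x))
  lem2 = solve-∀
  lem3 : ∀ a b c → a * (b * c) ≡ b * (a * c)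
  lem3 = solve-∀

e-one : ∀ M t x → evol M (suc t) (e M) x + 2 * evol M t (one M) x ≡ 4 * evol M t (e M) x
e-one M zero x with place M x
... | left = refl
... | right h = trans (cong₂ _+_ (mask-out (stencil (e M)) h) (cong (2 *_) (mask-out (λ _ → 1) h))) (sym (cong (4 *_) (proj₂ (e-vanish M) x h)))
... | inner {p} q k = trans (cong₂ _+_ (mask-in (stencil (e M)) (inner-< k)) (cong (2 *_) (mask-in (λ _ → 1) (inner-< k))))
  (e-stencil (suc p) (s≤s z≤n) (inner-< k))
e-one M (suc t) x = begin
  T M X′ x + 2 * T M Y x ≡⟨ cong (T M X′ x +_) (sym (T-* M 2 Y x)) ⟩
  T M X′ x + T M (λ y → 2 * Y y) x ≡⟨ sym (T-+ M X′ (λ y → 2 * Y y) x) ⟩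
  T M (λ y → X′ y + 2 * Y y) x ≡⟨ T-ext M (e-one M t) x ⟩
  T M (λ y → 4 * X y) x ≡⟨ T-* M 4 X x ⟩
  4 * T M X x ∎
  where
  open ≡-Reasoning
  X = evol M t (e M)
  X′ = evol M (suc t) (e M)
  Y = evol M t (one M)

one-decreasing : ∀ M t x → evol M (suc t) (one M) x ≤ 4 * evol M t (one M) x
one-decreasing M zero x with place M x
... | left = z≤n
... | right h = ≤-trans (≤-reflexive (mask-out (stencil (one M)) h)) z≤n
... | inner {p} q k = ≤-trans (≤-reflexive (T-inner (one M) k))
  (≤-trans (+-mono-≤ (+-mono-≤ (one≤1 M p) (*-monoʳ-≤ 2 (one≤1 M (suc p)))) (one≤1 M (2 + p)))
    (≤-reflexive (cong (4 *_) (sym (mask-in (λ _ → 1) (inner-< k))))))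
one-decreasing M (suc t) x = ≤-trans (T-mono M (one-decreasing M t) x) (≤-reflexive (T-* M 4 (evol M t (one M)) x))

-- In each step `e` loses twice the current survival, and survival, measured in units of 4 per step,
-- does not increase; so `j` steps lose at least `j` times the final survival. This gains a factor 1
-- / j over bounding survival by `e` itself.
exit-time : ∀ M j t x → 4 * evol M (j + t) (e M) x + 2 * (j * evol M (j + t) (one M) x) ≤ 4 ^ j * (4 * evol M t (e M) x)
exit-time M zero t x = ≤-refl
exit-time M (suc j) t x = begin
  4 * X′ + 2 * (Y′ + j * Y′) ≤⟨ +-monoʳ-≤ (4 * X′) (*-monoʳ-≤ 2 (+-mono-≤ (one-decreasing M (j + t) x) (*-monoʳ-≤ j (one-decreasing M (j + t) x)))) ⟩
  4 * X′ + 2 * (4 * Y + j * (4 * Y)) ≡⟨ lem X′ Y j ⟩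
  4 * (X′ + 2 * Y) + 8 * (j * Y) ≡⟨ cong (λ z → 4 * z + 8 * (j * Y)) (e-one M (j + t) x) ⟩
  4 * (4 * X) + 8 * (j * Y) ≡⟨ lem2 X Y j ⟩
  4 * (4 * X + 2 * (j * Y)) ≤⟨ *-monoʳ-≤ 4 (exit-time M j t x) ⟩
  4 * (4 ^ j * (4 * X₀)) ≡⟨ sym (*-assoc 4 (4 ^ j) (4 * X₀)) ⟩
  4 ^ suc j * (4 * X₀) ∎
  where
  open ≤-Reasoning
  X₀ = evol M t (e M) x
  X = evol M (j + t) (e M) x
  X′ = evol M (suc j + t) (e M) x
  Y = evol M (j + t) (one M) x
  Y′ = evol M (suc j + t) (one M) x
  lem : ∀ a b j → 4 * a + 2 * (4 * b + j * (4 * b)) ≡ 4 * (a + 2 * b) + 8 * (j * b)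
  lem = solve-∀
  lem2 : ∀ a b j → 4 * (4 * a) + 8 * (j * b) ≡ 4 * (4 * a + 2 * (j * b))
  lem2 = solve-∀

e-decay : ∀ r k → r * r ≡ k + 2 → ∀ t x → x ≤ r → (r * r) ^ t * evol r t (e r) x ≤ (4 * k) ^ t * e r x
e-decay r k hk t x xr = supersolution r r (4 * k) (r * r) (e r) (e r) ≤-refl (λ _ _ → ≤-refl) edge inside t x xr
  where
  open ≤-Reasoning
  edge : ∀ t → (r * r) ^ t * evol r t (e r) r ≤ (4 * k) ^ t * e r r
  edge t = ≤-trans (≤-reflexive (trans (cong ((r * r) ^ t *_) (proj₂ (evol-vanish r t (e-vanish r)) r ≤-refl)) (*-zeroʳ ((r * r) ^ t)))) z≤n
  inside : ∀ x → 0 < x → x < r → r * r * stencil (e r) x ≤ 4 * k * e r x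
  inside x p q = +-cancelʳ-≤ (2 * (r * r)) (r * r * stencil (e r) x) (4 * k * e r x) (begin
    r * r * stencil (e r) x + 2 * (r * r) ≡⟨ lem (r * r) (stencil (e r) x) ⟩
    r * r * (stencil (e r) x + 2) ≡⟨ cong₂ _*_ hk (e-stencil x p q) ⟩
    (k + 2) * (4 * e r x) ≡⟨ lem2 k (e r x) ⟩
    4 * k * e r x + 2 * (4 * e r x) ≤⟨ +-monoʳ-≤ (4 * k * e r x) (*-monoʳ-≤ 2 (four-e≤ r x)) ⟩
    4 * k * e r x + 2 * (r * r) ∎)
    where
    lem : ∀ s x → s * x + 2 * s ≡ s * (x + 2)
    lem = solve-∀
    lem2 : ∀ k x → (k + 2) * (4 * x) ≡ 4 * k * x + 2 * (4 * x)
    lem2 = solve-∀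

^-distribʳ-* : ∀ a b t → (a * b) ^ t ≡ a ^ t * b ^ t
^-distribʳ-* a b zero = refl
^-distribʳ-* a b (suc t) = trans (cong (a * b *_) (^-distribʳ-* a b t)) (lem a b (a ^ t) (b ^ t))
  where
  lem : ∀ a b c d → a * b * (c * d) ≡ a * c * (b * d)
  lem = solve-∀

two-e≤ : ∀ r a → 2 * e r a ≤ e (2 * r) a
two-e≤ r a = begin
  2 * (a * (r ∸ a)) ≡⟨ lem a (r ∸ a) ⟩
  a * (2 * (r ∸ a)) ≤⟨ *-monoʳ-≤ a (≤-trans (≤-reflexive (*-distribˡ-∸ 2 r a)) (∸-monoʳ-≤ (2 * r) (m≤m+n a _))) ⟩
  a * (2 * r ∸ a) ∎
  where
  open ≤-Reasoning
  lem : ∀ a b → 2 * (a * b) ≡ a * (2 * b)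
  lem = solve-∀

-- In the half interval the lazy rate is 1 - 2/r² = 1 - 8/Q, which is at most (1 - 3/Q)², the square
-- of the rate used on [0,2r]. The first `Q` steps are spent on `exit-time`, to gain 1 / Q; the
-- remaining `Q + t₂` steps still count double.
half-survival : ∀ r k m → r * r ≡ k + 2 → 4 * (r * r) ≡ m + 3 → ∀ t₂ a → a ≤ r →
  let Q = 4 * (r * r); t = Q + (Q + t₂) in
  Q * (Q ^ t * evol r t (one r) a) ≤ (4 * m) ^ t * e (2 * r) a
half-survival r k m hk hm t₂ a ar = begin
  4 * S * (Q ^ t * Y) ≡⟨ lem₁ S (Q ^ t) Y ⟩
  2 * (Q ^ t * (2 * (S * Y))) ≤⟨ *-monoʳ-≤ 2 (*-cancelʳ-≤ (Q ^ t * (2 * (S * Y))) ((4 * m) ^ t * E) (Q ^ t₂) {{m^n≢0 Q t₂ {{Q≢0}}}} core) ⟩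
  2 * ((4 * m) ^ t * e r a) ≡⟨ lem₂ ((4 * m) ^ t) (e r a) ⟩
  (4 * m) ^ t * (2 * e r a) ≤⟨ *-monoʳ-≤ ((4 * m) ^ t) (two-e≤ r a) ⟩
  (4 * m) ^ t * e (2 * r) a ∎
  where
  open ≤-Reasoning
  S = r * r
  Q = 4 * S
  t₁ = Q + t₂
  t = Q + t₁
  Y = evol r t (one r) a
  X = evol r t₁ (e r) a
  E = e r a
  Q≢0 : NonZero Q
  Q≢0 = subst NonZero (trans (+-comm 3 m) (sym hm)) _
  lem₁ : ∀ s q y → 4 * s * (q * y) ≡ 2 * (q * (2 * (s * y)))
  lem₁ = solve-∀
  lem₂ : ∀ a b → 2 * (a * b) ≡ a * (2 * b)
  lem₂ = solve-∀
  exit : 2 * (S * Y) ≤ 4 ^ Q * X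
  exit = *-cancelˡ-≤ 4 (begin
    4 * (2 * (S * Y)) ≡⟨ l S Y ⟩
    2 * (4 * S * Y) ≤⟨ m≤n+m _ (4 * evol r t (e r) a) ⟩
    4 * evol r t (e r) a + 2 * (Q * Y) ≤⟨ exit-time r Q t₁ a ⟩
    4 ^ Q * (4 * X) ≡⟨ l2 (4 ^ Q) X ⟩
    4 * (4 ^ Q * X) ∎)
    where
    l : ∀ s y → 4 * (2 * (s * y)) ≡ 2 * (4 * s * y)
    l = solve-∀
    l2 : ∀ p x → p * (4 * x) ≡ 4 * (p * x)
    l2 = solve-∀
  m≡ : m ≡ 4 * k + 5
  m≡ = +-cancelʳ-≡ 3 m (4 * k + 5) (trans (sym hm) (trans (cong (4 *_) hk) (l k)))
    where
    l : ∀ k → 4 * (k + 2) ≡ 4 * k + 5 + 3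
    l = solve-∀
  rates : 4 * k * Q ≤ m * m
  rates = ≤-trans (≤-reflexive (cong (4 * k *_) hm)) (≤-trans (≤-reflexive (cong (λ z → 4 * k * (z + 3)) m≡))
    (≤-trans (≤-trans (m≤m+n _ (8 * k + 25)) (≤-reflexive (l k))) (≤-reflexive (cong₂ _*_ (sym m≡) (sym m≡)))))
    where
    l : ∀ k → 4 * k * (4 * k + 5 + 3) + (8 * k + 25) ≡ (4 * k + 5) * (4 * k + 5)
    l = solve-∀
  decay : Q ^ t₁ * X ≤ 4 ^ t₁ * ((4 * k) ^ t₁ * E)
  decay = ≤-trans (≤-reflexive (trans (cong (_* X) (^-distribʳ-* 4 S t₁)) (*-assoc (4 ^ t₁) (S ^ t₁) X)))
    (*-monoʳ-≤ (4 ^ t₁) (e-decay r k hk t₁ a ar))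
  -- Doubling pays for the spent steps: 2 t₁ = `t + t₂`, and the surplus `m ^ t₂` is estimated by
  -- `Q ^ t₂`, which cancels in `core`.
  powers : (4 * k) ^ t₁ * Q ^ t₁ ≤ m ^ t * Q ^ t₂
  powers = begin
    (4 * k) ^ t₁ * Q ^ t₁ ≡⟨ sym (^-distribʳ-* (4 * k) Q t₁) ⟩
    (4 * k * Q) ^ t₁ ≤⟨ ^-monoˡ-≤ t₁ rates ⟩
    (m * m) ^ t₁ ≡⟨ ^-distribʳ-* m m t₁ ⟩
    m ^ t₁ * m ^ t₁ ≡⟨ sym (^-distribˡ-+-* m t₁ t₁) ⟩
    m ^ (t₁ + t₁) ≡⟨ cong (m ^_) (l Q t₂) ⟩
    m ^ (t + t₂) ≡⟨ ^-distribˡ-+-* m t t₂ ⟩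
    m ^ t * m ^ t₂ ≤⟨ *-monoʳ-≤ (m ^ t) (^-monoˡ-≤ t₂ (≤-trans (m≤m+n m 3) (≤-reflexive (sym hm)))) ⟩
    m ^ t * Q ^ t₂ ∎
    where
    l : ∀ q t → q + t + (q + t) ≡ q + (q + t) + t
    l = solve-∀
  core : Q ^ t * (2 * (S * Y)) * Q ^ t₂ ≤ (4 * m) ^ t * E * Q ^ t₂
  core = begin
    Q ^ t * (2 * (S * Y)) * Q ^ t₂ ≡⟨ l₁ (Q ^ t) (2 * (S * Y)) (Q ^ t₂) ⟩
    Q ^ t * Q ^ t₂ * (2 * (S * Y)) ≤⟨ *-monoʳ-≤ (Q ^ t * Q ^ t₂) exit ⟩
    Q ^ t * Q ^ t₂ * (4 ^ Q * X) ≡⟨ cong (_* (4 ^ Q * X)) (trans (sym (^-distribˡ-+-* Q t t₂)) (trans (cong (Q ^_) (l₃ Q t₂)) (^-distribˡ-+-* Q t₁ t₁))) ⟩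
    Q ^ t₁ * Q ^ t₁ * (4 ^ Q * X) ≡⟨ l₂ (Q ^ t₁) (4 ^ Q) X ⟩
    4 ^ Q * (Q ^ t₁ * (Q ^ t₁ * X)) ≤⟨ *-monoʳ-≤ (4 ^ Q) (*-monoʳ-≤ (Q ^ t₁) decay) ⟩
    4 ^ Q * (Q ^ t₁ * (4 ^ t₁ * ((4 * k) ^ t₁ * E))) ≡⟨ l₄ (4 ^ Q) (Q ^ t₁) (4 ^ t₁) ((4 * k) ^ t₁) E ⟩
    4 ^ Q * 4 ^ t₁ * ((4 * k) ^ t₁ * Q ^ t₁) * E ≤⟨ *-monoˡ-≤ E (*-monoʳ-≤ (4 ^ Q * 4 ^ t₁) powers) ⟩
    4 ^ Q * 4 ^ t₁ * (m ^ t * Q ^ t₂) * E ≡⟨ cong (λ z → z * (m ^ t * Q ^ t₂) * E) (sym (^-distribˡ-+-* 4 Q t₁)) ⟩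
    4 ^ t * (m ^ t * Q ^ t₂) * E ≡⟨ l₅ (4 ^ t) (m ^ t) (Q ^ t₂) E ⟩
    4 ^ t * m ^ t * E * Q ^ t₂ ≡⟨ cong (λ z → z * E * Q ^ t₂) (sym (^-distribʳ-* 4 m t)) ⟩
    (4 * m) ^ t * E * Q ^ t₂ ∎
    where
    l₁ : ∀ a b c → a * b * c ≡ a * c * b
    l₁ = solve-∀
    l₂ : ∀ a b c → a * a * (b * c) ≡ b * (a * (a * c))
    l₂ = solve-∀
    l₃ : ∀ q t → q + (q + t) + t ≡ q + t + (q + t)
    l₃ = solve-∀
    l₄ : ∀ a b c d x → a * (b * (c * (d * x))) ≡ a * c * (d * b) * x
    l₄ = solve-∀
    l₅ : ∀ a b c d → a * (b * c) * d ≡ a * b * d * c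
    l₅ = solve-∀

-- At most 5/16 of the survivors can be charged to the half interval, so `centre-mass` leaves 11/16
-- of them to be carried by 2r values of size at most the midpoint value. The slack between 11 · 16
-- = 176 and 5 · 32 = 160 makes the final constant 1.
centre-lower : ∀ r m → 2 ≤ r → 4 * (r * r) ≡ m + 3 → ∀ t → 8 * (r * r) ≤ t → ∀ a → 0 < a → a ≤ r →
  (4 * m) ^ t * e (2 * r) a ≤ (4 * (r * r)) ^ t * (4 * (r * r) * r * K (2 * r) t a r)
centre-lower r m 2≤r hm t 8S≤t a 0<a ar with m≤n⇒∃[o]m+o≡n 8S≤t
... | t₂ , refl = *-cancelˡ-≤ 160 (begin
  160 * Z ≤⟨ *-monoˡ-≤ Z (m≤m+n 160 16) ⟩
  176 * Z ≡⟨ l₁ Z ⟩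
  11 * (16 * Z) ≤⟨ *-monoʳ-≤ 11 lower ⟩
  11 * (Q ^ t * (5 * Q * Sv)) ≡⟨ l₂ (Q ^ t) Q Sv ⟩
  Q ^ t * (5 * Q) * (11 * Sv) ≤⟨ *-monoʳ-≤ (Q ^ t * (5 * Q)) mass ⟩
  Q ^ t * (5 * Q) * (32 * (r * F)) ≡⟨ l₃ (Q ^ t) Q r F ⟩
  160 * (Q ^ t * (Q * r * F)) ∎)
  where
  open ≤-Reasoning
  S = r * r
  Q = 4 * S
  Sv = evol (2 * r) t (one (2 * r)) a
  Y = evol r t (one r) a
  F = K (2 * r) t a r
  Z = (4 * m) ^ t * e (2 * r) a
  l₁ : ∀ z → 176 * z ≡ 11 * (16 * z)
  l₁ = solve-∀
  l₂ : ∀ p q s → 11 * (p * (5 * q * s)) ≡ p * (5 * q) * (11 * s)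
  l₂ = solve-∀
  l₃ : ∀ p q r f → p * (5 * q) * (32 * (r * f)) ≡ 160 * (p * (q * r * f))
  l₃ = solve-∀
  4≤S : 4 ≤ S
  4≤S = *-mono-≤ 2≤r 2≤r
  Q≢0 : NonZero Q
  Q≢0 = subst NonZero (trans (+-comm 3 m) (sym hm)) _
  sq : 2 * r * (2 * r) ≡ Q
  sq = l r
    where
    l : ∀ r → 2 * r * (2 * r) ≡ 4 * (r * r)
    l = solve-∀
  lower : 16 * Z ≤ Q ^ t * (5 * Q * Sv)
  lower = subst (λ q → 16 * Z ≤ q ^ t * (5 * q * Sv)) sq (survival-lower (2 * r) m (trans sq hm) t a)
  half : Q * (Q ^ t * Y) ≤ Z
  half = subst (λ s → Q * (Q ^ s * evol r s (one r) a) ≤ (4 * m) ^ s * e (2 * r) a) (l S t₂)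
    (half-survival r (S ∸ 2) m (sym (m∸n+n≡m (≤-trans (s≤s (s≤s z≤n)) 4≤S))) hm t₂ a ar)
    where
    l : ∀ s t → 4 * s + (4 * s + t) ≡ 8 * s + t
    l = solve-∀
  survivors : 16 * Y ≤ 5 * Sv
  survivors = *-cancelˡ-≤ (Q * Q ^ t) {{m*n≢0 Q (Q ^ t) {{Q≢0}} {{m^n≢0 Q t {{Q≢0}}}}}} (begin
    Q * Q ^ t * (16 * Y) ≡⟨ l Q (Q ^ t) Y ⟩
    16 * (Q * (Q ^ t * Y)) ≤⟨ *-monoʳ-≤ 16 half ⟩
    16 * Z ≤⟨ lower ⟩
    Q ^ t * (5 * Q * Sv) ≡⟨ l2 Q (Q ^ t) Sv ⟩
    Q * Q ^ t * (5 * Sv) ∎)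
    where
    l : ∀ q p y → q * p * (16 * y) ≡ 16 * (q * (p * y))
    l = solve-∀
    l2 : ∀ q p y → p * (5 * q * y) ≡ q * p * (5 * y)
    l2 = solve-∀
  -- 16 times `centre-mass`, with `16 * Y` replaced by `5 * Sv` and cancelled from both sides.
  mass : 11 * Sv ≤ 32 * (r * F)
  mass = +-cancelʳ-≤ (5 * Sv) (11 * Sv) (32 * (r * F)) (begin
    11 * Sv + 5 * Sv ≡⟨ l Sv ⟩
    16 * Sv ≤⟨ *-monoʳ-≤ 16 (centre-mass r t 0<a ar) ⟩
    16 * (2 * r * F + Y) ≡⟨ l2 r F Y ⟩
    32 * (r * F) + 16 * Y ≤⟨ +-monoʳ-≤ (32 * (r * F)) survivors ⟩
    32 * (r * F) + 5 * Sv ∎)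
    where
    l : ∀ s → 11 * s + 5 * s ≡ 16 * s
    l = solve-∀
    l2 : ∀ r f y → 16 * (2 * r * f + y) ≡ 32 * (r * f) + 16 * y
    l2 = solve-∀

-- Lower bound for the one-dimensional kernel

dist : ℕ → ℕ → ℕ
dist N a = a ⊓ (N ∸ a)

δ-+ : ∀ s a x → δ (s + a) (s + x) ≡ δ a x
δ-+ zero a x = refl
δ-+ (suc s) a x = δ-+ s a x

-- Domain monotonicity: every path surviving in the subinterval survives in the larger interval.
K-shift : ∀ {M N} s t {a} → s + M ≤ N → ∀ x → K M t a x ≤ K N t (s + a) (s + x)
K-shift s zero {a} h x = ≤-reflexive (sym (δ-+ s a x))
K-shift s (suc t) h zero = z≤n
K-shift {M} {N} s (suc t) {a} h (suc x) with suc x <? M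
... | no _ = z≤n
... | yes p = begin
  F x + 2 * F (suc x) + F (2 + x) ≤⟨ +-mono-≤ (+-mono-≤ (ih x) (*-monoʳ-≤ 2 (ih (suc x)))) (ih (2 + x)) ⟩
  G (s + x) + 2 * G (s + suc x) + G (s + (2 + x))
    ≡⟨ cong₂ _+_ (cong (λ z → G (s + x) + 2 * G z) (+-suc s x)) (cong G (trans (+-suc s (suc x)) (cong suc (+-suc s x)))) ⟩
  G (s + x) + 2 * G (suc (s + x)) + G (2 + (s + x))
    ≡⟨ sym (mask-in (stencil G) (≤-trans (≤-trans (≤-reflexive (cong suc (sym (+-suc s x)))) (+-monoʳ-< s p)) h)) ⟩
  T N G (suc (s + x)) ≡⟨ cong (T N G) (sym (+-suc s x)) ⟩
  T N G (s + suc x) ∎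
  where
  open ≤-Reasoning
  F = K M t a
  G = K N t (s + a)
  ih = K-shift s t {a} h

sum-window : ∀ N b q X (F : ℕ → ℕ) → b + q ≤ N → (∀ i → i < q → X ≤ F (b + i)) → q * X ≤ sum {N} (F ∘ toℕ)
sum-window N b q X F bq≤N h = begin
  q * X ≡⟨ sym (sum-const q X) ⟩
  sum {q} (λ _ → X) ≤⟨ sum-mono {q} (λ i → h (toℕ i) (toℕ<n i)) ⟩
  sum {q} (λ i → F (b + toℕ i)) ≤⟨ m≤n+m _ (sum {b} (F ∘ toℕ)) ⟩
  sum {b} (F ∘ toℕ) + sum {q} (λ i → F (b + toℕ i)) ≡⟨ sym (sum-split b q F) ⟩
  sum {b + q} (F ∘ toℕ) ≤⟨ m≤m+n _ _ ⟩
  sum {b + q} (F ∘ toℕ) + sum {N ∸ (b + q)} (λ i → F (b + q + toℕ i)) ≡⟨ sym (sum-split (b + q) (N ∸ (b + q)) F) ⟩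
  sum {b + q + (N ∸ (b + q))} (F ∘ toℕ) ≡⟨ cong (λ m → sum {m} (F ∘ toℕ)) (m+[n∸m]≡n bq≤N) ⟩
  sum {N} (F ∘ toℕ) ∎
  where open ≤-Reasoning

-- The rate w / (w + 5) = 1 − 5 / N² per lazy step serves all the subintervals used.
module Lower (N w q : ℕ) (hw : N * N ≡ w + 5) (q≥8 : 8 ≤ q) (20q≤N : 20 * q ≤ N) (N≤ : N ≤ 20 * q + 20) where

  P : ℕ
  P = N * N

  hop₀ : ∀ t r a → 2 * P ≤ t → 2 * N ≤ 5 * r → 2 * r ≤ N → 2 ≤ r → 0 < a → a ≤ r →
    (4 * w) ^ t * a ≤ P ^ t * (P * K (2 * r) t a r)
  hop₀ t r a ht h₁ h₂ r≥2 a>0 a≤r with m≤n⇒∃[o]m+o≡n {3} {4 * (r * r)} (≤-trans (s≤s (s≤s (s≤s z≤n))) (*-monoʳ-≤ 4 (*-mono-≤ r≥2 r≥2)))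
  ... | m , hm′ = *-cancelʳ-≤ ((4 * w) ^ t * a) (P ^ t * (P * K (2 * r) t a r)) (Q ^ t * r) {{m*n≢0 (Q ^ t) r {{m^n≢0 Q t {{Q≢0}}}} {{>-nonZero (≤-trans (s≤s z≤n) r≥2)}}}} (begin
    (4 * w) ^ t * a * (Q ^ t * r) ≡⟨ l₁ ((4 * w) ^ t) a (Q ^ t) r ⟩
    (4 * w) ^ t * Q ^ t * (a * r) ≤⟨ *-mono-≤ rate (*-monoʳ-≤ a r≤) ⟩
    (4 * m) ^ t * P ^ t * e (2 * r) a ≡⟨ l₂ ((4 * m) ^ t) (P ^ t) (e (2 * r) a) ⟩
    P ^ t * ((4 * m) ^ t * e (2 * r) a) ≤⟨ *-monoʳ-≤ (P ^ t) (centre-lower r m r≥2 hm t (≤-trans 8≤ ht) a a>0 a≤r) ⟩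
    P ^ t * (Q ^ t * (Q * r * K (2 * r) t a r)) ≤⟨ *-monoʳ-≤ (P ^ t) (*-monoʳ-≤ (Q ^ t) (*-monoˡ-≤ (K (2 * r) t a r) (*-monoˡ-≤ r Q≤P))) ⟩
    P ^ t * (Q ^ t * (P * r * K (2 * r) t a r)) ≡⟨ l₃ (P ^ t) (Q ^ t) P r (K (2 * r) t a r) ⟩
    P ^ t * (P * K (2 * r) t a r) * (Q ^ t * r) ∎)
    where
    open ≤-Reasoning
    Q = 4 * (r * r)
    hm : Q ≡ m + 3
    hm = trans (sym hm′) (+-comm 3 m)
    Q≢0 : NonZero Q
    Q≢0 = subst NonZero (trans (+-comm 3 m) (sym hm)) _
    l₁ : ∀ a b c d → a * b * (c * d) ≡ a * c * (b * d)
    l₁ = solve-∀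
    l₂ : ∀ a b c → a * b * c ≡ b * (a * c)
    l₂ = solve-∀
    l₃ : ∀ a b c d f → a * (b * (c * d * f)) ≡ a * (c * f) * (b * d)
    l₃ = solve-∀
    r≤ : r ≤ 2 * r ∸ a
    r≤ = m+n≤o⇒m≤o∸n r (≤-trans (+-monoʳ-≤ r a≤r) (≤-reflexive (sym (double r))))
    Q≤P : Q ≤ P
    Q≤P = ≤-trans (≤-reflexive (l r)) (*-mono-≤ h₂ h₂)
      where
      l : ∀ r → 4 * (r * r) ≡ 2 * r * (2 * r)
      l = solve-∀
    8≤ : 8 * (r * r) ≤ 2 * P
    8≤ = ≤-trans (≤-reflexive (l r)) (*-monoʳ-≤ 2 Q≤P)
      where
      l : ∀ r → 8 * (r * r) ≡ 2 * (4 * (r * r))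
      l = solve-∀
    -- r ≥ 2N/5 makes Q = 4r² at least 16N²/25, more than 3N²/5. Hence 3/Q ≤ 5/N², so the rate 1 -
    -- 3/Q on [0,2r] is no worse than `w / (w + 5)`.
    3P≤5Q : 3 * P ≤ 5 * Q
    3P≤5Q = *-cancelˡ-≤ 4 (begin
      4 * (3 * P) ≡⟨ a₁ N ⟩
      3 * (2 * N * (2 * N)) ≤⟨ *-monoʳ-≤ 3 (*-mono-≤ h₁ h₁) ⟩
      3 * (5 * r * (5 * r)) ≤⟨ m≤m+n _ (5 * (r * r)) ⟩
      3 * (5 * r * (5 * r)) + 5 * (r * r) ≡⟨ a₂ r ⟩
      4 * (5 * Q) ∎)
      where
      a₁ : ∀ n → 4 * (3 * (n * n)) ≡ 3 * (2 * n * (2 * n))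
      a₁ = solve-∀
      a₂ : ∀ r → 3 * (5 * r * (5 * r)) + 5 * (r * r) ≡ 4 * (5 * (4 * (r * r)))
      a₂ = solve-∀
    wQ≤mP : w * Q ≤ m * P
    wQ≤mP = +-cancelʳ-≤ (5 * Q) (w * Q) (m * P) (begin
      w * Q + 5 * Q ≡⟨ sym (*-distribʳ-+ Q w 5) ⟩
      (w + 5) * Q ≡⟨ cong₂ _*_ (sym hw) hm ⟩
      P * (m + 3) ≡⟨ b P m ⟩
      m * P + 3 * P ≤⟨ +-monoʳ-≤ (m * P) 3P≤5Q ⟩
      m * P + 5 * Q ∎)
      where
      b : ∀ p m → p * (m + 3) ≡ m * p + 3 * p
      b = solve-∀
    rate : (4 * w) ^ t * Q ^ t ≤ (4 * m) ^ t * P ^ t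
    rate = begin
      (4 * w) ^ t * Q ^ t ≡⟨ sym (^-distribʳ-* (4 * w) Q t) ⟩
      (4 * w * Q) ^ t ≤⟨ ^-monoˡ-≤ t (≤-trans (≤-reflexive (*-assoc 4 w Q)) (≤-trans (*-monoʳ-≤ 4 wQ≤mP) (≤-reflexive (sym (*-assoc 4 m P))))) ⟩
      (4 * m * P) ^ t ≡⟨ ^-distribʳ-* (4 * m) P t ⟩
      (4 * m) ^ t * P ^ t ∎

  -- The window of `q` sites from `lo` lies in [2N/5, N/2). Its start 8q + 8 is two fifths of 20q +
  -- 20 ≥ N, and `q ≥ 8` keeps its end below 10q ≤ N/2. Each of its sites `z` is the midpoint of an
  -- interval [0,2z] inside [0,N].
  lo : ℕ
  lo = 8 * q + 8

  z-lower : ∀ i → 2 * N ≤ 5 * (lo + i)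
  z-lower i = ≤-trans (*-monoʳ-≤ 2 N≤) (≤-trans (m≤m+n _ (5 * i)) (≤-reflexive (l q i)))
    where
    l : ∀ q i → 2 * (20 * q + 20) + 5 * i ≡ 5 * (8 * q + 8 + i)
    l = solve-∀

  z-upper : ∀ i → i < q → 2 * (lo + i) < N
  z-upper i i<q = begin
    suc (2 * (lo + i)) ≤⟨ n≤1+n _ ⟩
    2 + 2 * (lo + i) ≡⟨ l q i ⟩
    2 * (8 * q + 8 + suc i) ≤⟨ *-monoʳ-≤ 2 (+-mono-≤ (+-monoʳ-≤ (8 * q) q≥8) i<q) ⟩
    2 * (8 * q + q + q) ≡⟨ l2 q ⟩
    20 * q ≤⟨ 20q≤N ⟩
    N ∎
    where
    open ≤-Reasoning
    l : ∀ q i → 2 + 2 * (8 * q + 8 + i) ≡ 2 * (8 * q + 8 + suc i)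
    l = solve-∀
    l2 : ∀ q → 2 * (8 * q + q + q) ≡ 20 * q
    l2 = solve-∀

  z≥2 : ∀ i → 2 ≤ lo + i
  z≥2 i = ≤-trans (≤-trans (s≤s (s≤s z≤n)) (m≤n+m 8 (8 * q))) (m≤m+n lo i)

  hop-left : ∀ t i a → 2 * P ≤ t → i < q → 0 < a → a ≤ lo + i → (4 * w) ^ t * a ≤ P ^ t * (P * K N t a (lo + i))
  hop-left t i a ht i<q a>0 a≤z = ≤-trans (hop₀ t z a ht (z-lower i) (<⇒≤ (z-upper i i<q)) (z≥2 i) a>0 a≤z)
    (*-monoʳ-≤ (P ^ t) (*-monoʳ-≤ P (K-shift {2 * z} 0 t {a} (<⇒≤ (z-upper i i<q)) z)))
    where z = lo + i

  hop-right : ∀ t i a → 2 * P ≤ t → i < q → lo + i ≤ a → a < 2 * (lo + i) →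
    (4 * w) ^ t * (2 * (lo + i) ∸ a) ≤ P ^ t * (P * K N t a (lo + i))
  hop-right t i a ht i<q z≤a a<2z = ≤-trans
    (hop₀ t z a′ ht (z-lower i) (<⇒≤ (z-upper i i<q)) (z≥2 i) a′>0
      (≤-trans (∸-monoʳ-≤ (2 * z) z≤a) (≤-reflexive (trans (cong (_∸ z) (double z)) (m+n∸n≡m z z)))))
    (*-monoʳ-≤ (P ^ t) (*-monoʳ-≤ P (≤-trans (≤-reflexive mirror) (K-shift {2 * z} 0 t {a} (<⇒≤ (z-upper i i<q)) z))))
    where
    z = lo + i
    a′ = 2 * z ∸ a
    a′>0 : 0 < a′
    a′>0 = m<n⇒0<n∸m a<2z
    mirror : K (2 * z) t a′ z ≡ K (2 * z) t a z
    mirror = K-reflect (2 * z) t a′>0 (≤-trans (≤-trans (s≤s z≤n) (z≥2 i)) z≤a) (m∸n+n≡m (<⇒≤ a<2z)) z z (sym (double z))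

  to-window : ∀ t i a → 2 * P ≤ t → i < q → 0 < a → 2 * a ≤ N → (4 * w) ^ t * a ≤ 2 * (P ^ t * (P * K N t a (lo + i)))
  to-window t i a ht i<q a>0 2a≤N with ≤-total a (lo + i)
  ... | inj₁ a≤z = ≤-trans (hop-left t i a ht i<q a>0 a≤z) (m≤m+n _ _)
  ... | inj₂ z≤a = ≤-trans (*-monoʳ-≤ ((4 * w) ^ t) a≤) (≤-trans (≤-reflexive (l ((4 * w) ^ t) (2 * z ∸ a)))
      (*-monoʳ-≤ 2 (hop-right t i a ht i<q z≤a a<2z)))
    where
    z = lo + i
    l : ∀ x y → x * (2 * y) ≡ 2 * (x * y)
    l = solve-∀
    open ≤-Reasoning
    -- For `a` beyond `z`, the relevant distance is that to the right end of [0,2z]. From a ≤ N/2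
    -- and z ≥ 2N/5 it is at least a/2, whence the factor 2.
    4a≤5z : 4 * a ≤ 5 * z
    4a≤5z = *-cancelˡ-≤ 2 (begin
      2 * (4 * a) ≡⟨ l₁ a ⟩
      4 * (2 * a) ≤⟨ *-monoʳ-≤ 4 2a≤N ⟩
      4 * N ≡⟨ l₂ N ⟩
      2 * (2 * N) ≤⟨ *-monoʳ-≤ 2 (z-lower i) ⟩
      2 * (5 * z) ∎)
      where
      l₁ : ∀ a → 2 * (4 * a) ≡ 4 * (2 * a)
      l₁ = solve-∀
      l₂ : ∀ n → 4 * n ≡ 2 * (2 * n)
      l₂ = solve-∀
    3a≤4z : 3 * a ≤ 4 * z
    3a≤4z = *-cancelˡ-≤ 4 (begin
      4 * (3 * a) ≡⟨ l₁ a ⟩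
      3 * (4 * a) ≤⟨ *-monoʳ-≤ 3 4a≤5z ⟩
      3 * (5 * z) ≤⟨ m≤m+n _ z ⟩
      3 * (5 * z) + z ≡⟨ l₂ z ⟩
      4 * (4 * z) ∎)
      where
      l₁ : ∀ a → 4 * (3 * a) ≡ 3 * (4 * a)
      l₁ = solve-∀
      l₂ : ∀ z → 3 * (5 * z) + z ≡ 4 * (4 * z)
      l₂ = solve-∀
    a≤ : a ≤ 2 * (2 * z ∸ a)
    a≤ = ≤-trans (m+n≤o⇒m≤o∸n a (≤-trans (≤-reflexive (l₁ a)) (≤-trans 3a≤4z (≤-reflexive (l₂ z))))) (≤-reflexive (sym (*-distribˡ-∸ 2 (2 * z) a)))
      where
      l₁ : ∀ a → a + 2 * a ≡ 3 * a
      l₁ = solve-∀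
      l₂ : ∀ z → 4 * z ≡ 2 * (2 * z)
      l₂ = solve-∀
    a<2z : a < 2 * z
    a<2z = *-cancelˡ-< 4 a (2 * z) (≤-<-trans 4a≤5z (<-≤-trans (*-monoˡ-< z {{>-nonZero (≤-trans (s≤s z≤n) (z≥2 i))}} (m<m+n 5 {3} (s≤s z≤n))) (≤-reflexive (l₁ z))))
      where
      l₁ : ∀ z → 8 * z ≡ 4 * (2 * z)
      l₁ = solve-∀

  -- For `a` in the middle fifth both possible distances are at least N/5: left of `z` it is `a`
  -- itself, right of it 2z - a ≥ 4N/5 - 3N/5.
  across-window : ∀ t i a → 2 * P ≤ t → i < q → 2 * N ≤ 5 * a → 5 * a ≤ 3 * N → (4 * w) ^ t * N ≤ 5 * (P ^ t * (P * K N t a (lo + i)))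
  across-window t i a ht i<q h₁ h₂ with ≤-total a (lo + i)
  ... | inj₁ a≤z = ≤-trans (*-monoʳ-≤ ((4 * w) ^ t) (≤-trans (m≤m+n N (1 * N)) h₁)) (≤-trans (≤-reflexive (l ((4 * w) ^ t) a))
      (*-monoʳ-≤ 5 (hop-left t i a ht i<q a>0 a≤z)))
    where
    l : ∀ x y → x * (5 * y) ≡ 5 * (x * y)
    l = solve-∀
    a>0 : 0 < a
    a>0 = n≢0⇒n>0 (λ { refl → <⇒≱ (≤-<-trans z≤n (z-upper i i<q)) (≤-trans (m≤m+n N (1 * N)) h₁) })
  ... | inj₂ z≤a = ≤-trans (*-monoʳ-≤ ((4 * w) ^ t) N≤5) (≤-trans (≤-reflexive (l ((4 * w) ^ t) (2 * z ∸ a)))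
      (*-monoʳ-≤ 5 (hop-right t i a ht i<q z≤a a<2z)))
    where
    z = lo + i
    l : ∀ x y → x * (5 * y) ≡ 5 * (x * y)
    l = solve-∀
    sum≤ : N + 5 * a ≤ 5 * (2 * z)
    sum≤ = ≤-trans (+-monoʳ-≤ N h₂) (≤-trans (≤-reflexive (l₁ N)) (≤-trans (*-monoʳ-≤ 2 (z-lower i)) (≤-reflexive (l₂ z))))
      where
      l₁ : ∀ n → n + 3 * n ≡ 2 * (2 * n)
      l₁ = solve-∀
      l₂ : ∀ z → 2 * (5 * z) ≡ 5 * (2 * z)
      l₂ = solve-∀
    N≤5 : N ≤ 5 * (2 * z ∸ a)
    N≤5 = ≤-trans (m+n≤o⇒m≤o∸n N sum≤) (≤-reflexive (sym (*-distribˡ-∸ 5 (2 * z) a)))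
    a<2z : a < 2 * z
    a<2z = *-cancelˡ-< 5 a (2 * z) (<-≤-trans (m<n+m (5 * a) (≤-<-trans z≤n (z-upper i i<q))) sum≤)

  -- The window left of the centre and its mirror image, so that each endpoint of a walk can use the
  -- one on its own side.
  z : Bool → ℕ → ℕ
  z true i = lo + i
  z false i = N ∸ (lo + i)

  z≤N : ∀ i → i < q → lo + i ≤ N
  z≤N i h = ≤-trans (m≤m+n _ _) (<⇒≤ (z-upper i h))

  z>0 : ∀ s i → i < q → 0 < z s i
  z>0 true i h = ≤-trans (s≤s z≤n) (z≥2 i)
  z>0 false i h = m<n⇒0<n∸m (≤-<-trans (m≤m+n (lo + i) _) (z-upper i h))

  z<N : ∀ s i → i < q → z s i < N
  z<N true i h = ≤-<-trans (m≤m+n _ _) (z-upper i h)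
  z<N false i h = ∸-monoʳ-< (≤-trans (s≤s z≤n) (z≥2 i)) (z≤N i h)

  mirror : ∀ t {a} → 0 < a → a < N → ∀ {x} → x ≤ N → K N t a (N ∸ x) ≡ K N t (N ∸ a) x
  mirror t {a} p h {x} k = K-reflect N t p (m<n⇒0<n∸m h) (m+[n∸m]≡n (<⇒≤ h)) (N ∸ x) x (m∸n+n≡m k)

  reach : ∀ a → 0 < a → a < N → ∃ λ s → ∀ t i → 2 * P ≤ t → i < q → (4 * w) ^ t * dist N a ≤ 2 * (P ^ t * (P * K N t a (z s i)))
  reach a a>0 a<N with ≤-total (2 * a) N
  ... | inj₁ h = true , λ t i ht i<q → ≤-trans (*-monoʳ-≤ ((4 * w) ^ t) (m⊓n≤m a (N ∸ a))) (to-window t i a ht i<q a>0 h)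
  ... | inj₂ h = false , λ t i ht i<q → ≤-trans (*-monoʳ-≤ ((4 * w) ^ t) (m⊓n≤n a (N ∸ a)))
      (subst (λ k → (4 * w) ^ t * (N ∸ a) ≤ 2 * (P ^ t * (P * k))) (sym (mirror t a>0 a<N (z≤N i i<q)))
        (to-window t i (N ∸ a) ht i<q (m<n⇒0<n∸m a<N) (≤-trans (≤-reflexive (*-distribˡ-∸ 2 N a)) (≤-trans (∸-monoʳ-≤ (2 * N) h) (≤-reflexive (trans (cong (_∸ N) (double N)) (m+n∸n≡m N N)))))))

  central₁ : ∀ s i → i < q → 2 * N ≤ 5 * z s i
  central₁ true i h = z-lower i
  central₁ false i h = ≤-trans (m+n≤o⇒m≤o∸n (2 * N) (*-cancelˡ-≤ 2 (begin
    2 * (2 * N + 5 * (lo + i)) ≡⟨ l₁ N (lo + i) ⟩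
    4 * N + 5 * (2 * (lo + i)) ≤⟨ +-monoʳ-≤ (4 * N) (*-monoʳ-≤ 5 (<⇒≤ (z-upper i h))) ⟩
    4 * N + 5 * N ≤⟨ m≤m+n _ N ⟩
    4 * N + 5 * N + N ≡⟨ l₂ N ⟩
    2 * (5 * N) ∎))) (≤-reflexive (sym (*-distribˡ-∸ 5 N (lo + i))))
    where
    open ≤-Reasoning
    l₁ : ∀ n z → 2 * (2 * n + 5 * z) ≡ 4 * n + 5 * (2 * z)
    l₁ = solve-∀
    l₂ : ∀ n → 4 * n + 5 * n + n ≡ 2 * (5 * n)
    l₂ = solve-∀

  central₂ : ∀ s i → i < q → 5 * z s i ≤ 3 * N
  central₂ true i h = *-cancelˡ-≤ 2 (begin
    2 * (5 * (lo + i)) ≡⟨ l₁ (lo + i) ⟩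
    5 * (2 * (lo + i)) ≤⟨ *-monoʳ-≤ 5 (<⇒≤ (z-upper i h)) ⟩
    5 * N ≤⟨ m≤m+n _ N ⟩
    5 * N + N ≡⟨ l₂ N ⟩
    2 * (3 * N) ∎)
    where
    open ≤-Reasoning
    l₁ : ∀ z → 2 * (5 * z) ≡ 5 * (2 * z)
    l₁ = solve-∀
    l₂ : ∀ n → 5 * n + n ≡ 2 * (3 * n)
    l₂ = solve-∀
  central₂ false i h = ≤-trans (≤-reflexive (*-distribˡ-∸ 5 N (lo + i))) (≤-trans (∸-monoʳ-≤ (5 * N) (z-lower i))
    (≤-reflexive (trans (cong (_∸ 2 * N) (l N)) (m+n∸n≡m (3 * N) (2 * N)))))
    where
    l : ∀ n → 5 * n ≡ 3 * n + 2 * n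
    l = solve-∀

  bridge : ∀ t s s′ i j → 2 * P ≤ t → i < q → j < q → (4 * w) ^ t * N ≤ 5 * (P ^ t * (P * K N t (z s i) (z s′ j)))
  bridge t s true i j ht i<q j<q = across-window t j (z s i) ht j<q (central₁ s i i<q) (central₂ s i i<q)
  bridge t true false i j ht i<q j<q = subst (λ k → (4 * w) ^ t * N ≤ 5 * (P ^ t * (P * k))) (sym (mirror t (z>0 true i i<q) (z<N true i i<q) (z≤N j j<q)))
    (across-window t j (z false i) ht j<q (central₁ false i i<q) (central₂ false i i<q))
  bridge t false false i j ht i<q j<q = subst (λ k → (4 * w) ^ t * N ≤ 5 * (P ^ t * (P * k)))
    (sym (trans (mirror t (z>0 false i i<q) (z<N false i i<q) (z≤N j j<q)) (cong (λ a → K N t a (lo + j)) (m∸[m∸n]≡n (z≤N i i<q)))))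
    (across-window t j (lo + i) ht j<q (central₁ true i i<q) (central₂ true i i<q))

  window-sum : ∀ s X (F : ℕ → ℕ) → (∀ i → i < q → X ≤ F (z s i)) → q * X ≤ sum {N} (F ∘ toℕ)
  window-sum true X F h = sum-window N lo q X F lo+q≤N h
    where
    lo+q≤N : lo + q ≤ N
    lo+q≤N = ≤-trans (≤-trans (+-monoˡ-≤ q (+-monoʳ-≤ (8 * q) q≥8)) (≤-trans (m≤m+n _ (10 * q)) (≤-reflexive (l q)))) 20q≤N
      where
      l : ∀ q → 8 * q + q + q + 10 * q ≡ 20 * q
      l = solve-∀
  -- `sum-rev` reads the sum at `N ∸ suc x`, so the mirrored window starts at `lo` - 1 = 8q + 7.
  window-sum false X F h = ≤-trans (sum-window N (8 * q + 7) q X (λ x → F (N ∸ suc x)) bound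
      (λ i i<q → ≤-trans (h i i<q) (≤-reflexive (cong (λ k → F (N ∸ k)) (l₀ q i))))) (≤-reflexive (sym (sum-rev N F)))
    where
    l₀ : ∀ q i → 8 * q + 8 + i ≡ suc (8 * q + 7 + i)
    l₀ = solve-∀
    bound : 8 * q + 7 + q ≤ N
    bound = ≤-trans (≤-trans (+-monoˡ-≤ q (+-monoʳ-≤ (8 * q) (≤-trans (n≤1+n 7) q≥8))) (≤-trans (m≤m+n _ (10 * q)) (≤-reflexive (l q)))) 20q≤N
      where
      l : ∀ q → 8 * q + q + q + 10 * q ≡ 20 * q
      l = solve-∀

  -- Three hops of at least 2P steps each: from `a` to the window on its side, from there to the
  -- window of `b`, then to `b`. Their constants 2, 5, 2 multiply to 20. Each intermediate sum has
  -- `q` terms, and N ≤ 40q turns q² into N²/1600; this gives 32000 = 20 · 40².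
  K-lower : ∀ t a b → 0 < a → a < N → 0 < b → b < N → 6 * P ≤ t →
    (4 * w) ^ t * (dist N a * dist N b) ≤ P ^ t * (N * P * 32000 * K N t a b)
  K-lower t a b a>0 a<N b>0 b<N ht with reach a a>0 a<N | reach b b>0 b<N | m≤n⇒∃[o]m+o≡n ht
  ... | s , fromA | s′ , fromB | t₂ , refl = *-cancelˡ-≤ (N * P) {{m*n≢0 N P {{N≢0}} {{m*n≢0 N N {{N≢0}} {{N≢0}}}}}} (begin
    N * P * (A t * (da * db)) ≤⟨ *-monoˡ-≤ (A t * (da * db)) (*-monoʳ-≤ N (*-mono-≤ N≤40q N≤40q)) ⟩
    N * (q * 40 * (q * 40)) * (A t * (da * db)) ≡⟨ l₁ N 40 q (A t) da db ⟩
    q * (q * (A t * (da * N * db))) * 1600 ≤⟨ *-monoˡ-≤ 1600 second ⟩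
    20 * (P * (P * P)) * (B t * K N t a b) * 1600 ≡⟨ l₂ 20 1600 N (B t) (K N t a b) ⟩
    N * P * (B t * (N * P * 32000 * K N t a b)) ∎)
    where
    open ≤-Reasoning
    da db : ℕ
    da = dist N a
    db = dist N b
    A B : ℕ → ℕ
    A s = (4 * w) ^ s
    B s = P ^ s
    u : ℕ
    u = 2 * P
    t₃ : ℕ
    t₃ = 2 * P + t₂
    N≢0 : NonZero N
    N≢0 = >-nonZero (≤-<-trans z≤n a<N)
    N≤40q : N ≤ q * 40
    N≤40q = ≤-trans N≤ (≤-trans (+-monoʳ-≤ (20 * q) (≤-trans (m≤m+n 20 140) (*-monoʳ-≤ 20 q≥8))) (≤-reflexive (l q)))
      where
      l : ∀ q → 20 * q + 20 * q ≡ q * 40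
      l = solve-∀
    l₁ : ∀ n c q x y z → n * (q * c * (q * c)) * (x * (y * z)) ≡ q * (q * (x * (y * n * z))) * (c * c)
    l₁ = solve-∀
    l₂ : ∀ d c n b k → d * (n * n * (n * n * (n * n))) * (b * k) * c ≡ n * (n * n) * (b * (n * (n * n) * (d * c) * k))
    l₂ = solve-∀
    first : ∀ j → j < q → q * (A (u + u) * (da * N)) ≤ 10 * (P * P) * (B (u + u) * K N (u + u) a (z s′ j))
    first j j<q = begin
      q * (A (u + u) * (da * N)) ≤⟨ window-sum s (A (u + u) * (da * N)) (λ x → 10 * (P * P) * B (u + u) * (K N u a x * K N u (z s′ j) x)) each ⟩
      sum {N} (λ x → 10 * (P * P) * B (u + u) * (K N u a (toℕ x) * K N u (z s′ j) (toℕ x)))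
        ≡⟨ sym (*-distribˡ-sum {N} (10 * (P * P) * B (u + u)) (λ x → K N u a (toℕ x) * K N u (z s′ j) (toℕ x))) ⟩
      10 * (P * P) * B (u + u) * pair N (K N u a) (K N u (z s′ j))
        ≡⟨ cong (10 * (P * P) * B (u + u) *_) (sym (K-chain u u a>0 a<N (z>0 s′ j j<q) (z<N s′ j j<q))) ⟩
      10 * (P * P) * B (u + u) * K N (u + u) a (z s′ j) ≡⟨ *-assoc (10 * (P * P)) (B (u + u)) _ ⟩
      10 * (P * P) * (B (u + u) * K N (u + u) a (z s′ j)) ∎
      where
      each : ∀ i → i < q → A (u + u) * (da * N) ≤ 10 * (P * P) * B (u + u) * (K N u a (z s i) * K N u (z s′ j) (z s i))
      each i i<q = begin
        A (u + u) * (da * N) ≡⟨ cong (_* (da * N)) (^-distribˡ-+-* (4 * w) u u) ⟩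
        A u * A u * (da * N) ≡⟨ m₁ (A u) da N ⟩
        (A u * da) * (A u * N) ≤⟨ *-mono-≤ (fromA u i ≤-refl i<q) (bridge u s′ s j i ≤-refl j<q i<q) ⟩
        2 * (B u * (P * ka)) * (5 * (B u * (P * kb))) ≡⟨ m₂ (B u) P ka kb ⟩
        10 * (P * P) * (B u * B u) * (ka * kb) ≡⟨ cong (λ y → 10 * (P * P) * y * (ka * kb)) (sym (^-distribˡ-+-* P u u)) ⟩
        10 * (P * P) * B (u + u) * (ka * kb) ∎
        where
        ka kb : ℕ
        ka = K N u a (z s i)
        kb = K N u (z s′ j) (z s i)
        m₁ : ∀ x y z → x * x * (y * z) ≡ (x * y) * (x * z)
        m₁ = solve-∀
        m₂ : ∀ b p x y → 2 * (b * (p * x)) * (5 * (b * (p * y))) ≡ 10 * (p * p) * (b * b) * (x * y)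
        m₂ = solve-∀
    t≡ : t₃ + (u + u) ≡ t
    t≡ = l P t₂
      where
      l : ∀ p t → 2 * p + t + (2 * p + 2 * p) ≡ 6 * p + t
      l = solve-∀
    second : q * (q * (A t * (da * N * db))) ≤ 20 * (P * (P * P)) * (B t * K N t a b)
    second = subst (λ s → q * (q * (A s * (da * N * db))) ≤ 20 * (P * (P * P)) * (B s * K N s a b)) t≡ (begin
      q * (q * (A (t₃ + (u + u)) * (da * N * db)))
        ≤⟨ window-sum s′ _ (λ x → C * (K N (u + u) a x * K N t₃ b x)) each ⟩
      sum {N} (λ x → C * (K N (u + u) a (toℕ x) * K N t₃ b (toℕ x)))
        ≡⟨ sym (*-distribˡ-sum {N} C (λ x → K N (u + u) a (toℕ x) * K N t₃ b (toℕ x))) ⟩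
      C * pair N (K N (u + u) a) (K N t₃ b) ≡⟨ cong (C *_) (sym (K-chain t₃ (u + u) a>0 a<N b>0 b<N)) ⟩
      C * K N (t₃ + (u + u)) a b ≡⟨ *-assoc (20 * (P * (P * P))) (B (t₃ + (u + u))) _ ⟩
      20 * (P * (P * P)) * (B (t₃ + (u + u)) * K N (t₃ + (u + u)) a b) ∎)
      where
      C : ℕ
      C = 20 * (P * (P * P)) * B (t₃ + (u + u))
      each : ∀ j → j < q → q * (A (t₃ + (u + u)) * (da * N * db)) ≤ C * (K N (u + u) a (z s′ j) * K N t₃ b (z s′ j))
      each j j<q = begin
        q * (A (t₃ + (u + u)) * (da * N * db)) ≡⟨ cong (λ y → q * (y * (da * N * db))) (^-distribˡ-+-* (4 * w) t₃ (u + u)) ⟩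
        q * (A t₃ * A (u + u) * (da * N * db)) ≡⟨ m₁ q (A t₃) (A (u + u)) da N db ⟩
        q * (A (u + u) * (da * N)) * (A t₃ * db) ≤⟨ *-mono-≤ (first j j<q) (fromB t₃ j (m≤m+n u t₂) j<q) ⟩
        10 * (P * P) * (B (u + u) * ka) * (2 * (B t₃ * (P * kb))) ≡⟨ m₂ P (B (u + u)) (B t₃) ka kb ⟩
        20 * (P * (P * P)) * (B t₃ * B (u + u)) * (ka * kb) ≡⟨ cong (λ y → 20 * (P * (P * P)) * y * (ka * kb)) (sym (^-distribˡ-+-* P t₃ (u + u))) ⟩
        C * (ka * kb) ∎
        where
        ka kb : ℕ
        ka = K N (u + u) a (z s′ j)
        kb = K N t₃ b (z s′ j)
        m₁ : ∀ q x y d n f → q * (x * y * (d * n * f)) ≡ q * (y * (d * n)) * (x * f)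
        m₁ = solve-∀
        m₂ : ∀ p b c x y → 10 * (p * p) * (b * x) * (2 * (c * (p * y))) ≡ 20 * (p * (p * p)) * (c * b) * (x * y)
        m₂ = solve-∀

K-lower : ∀ N w q C → N * N ≡ w + 5 → 8 ≤ q → 20 * q ≤ N → N ≤ 20 * q + 20 → C ≡ N * (N * N) * 32000 →
  ∀ t a b → 0 < a → a < N → 0 < b → b < N → 6 * (w + 5) ≤ t →
  (4 * w) ^ t * (dist N a * dist N b) ≤ (w + 5) ^ t * (C * K N t a b)
K-lower N w q C hw q≥8 20q≤N N≤ refl t a b a>0 a<N b>0 b<N ht =
  subst (λ P → (4 * w) ^ t * (dist N a * dist N b) ≤ P ^ t * (N * (N * N) * 32000 * K N t a b)) hw
    (Lower.K-lower N w q hw q≥8 20q≤N N≤ t a b a>0 a<N b>0 b<N (≤-trans (≤-reflexive (cong (6 *_) hw)) ht))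

-- Upper bound for the one-dimensional kernel

-- e on [0,3M] shifted by M: a supersolution bounded below on [0,M].
φ : ℕ → ℕ → ℕ
φ M x = (x + M) * (M ∸ x + M)

φ-stencil : ∀ {M} x → 0 < x → x < M → stencil (φ M) x + 2 ≡ 4 * φ M x
φ-stencil {M} x 0<x x<M with place M x
φ-stencil {M} .0 () x<M | left
φ-stencil {M} x 0<x x<M | right h = ⊥-elim (<⇒≱ x<M h)
φ-stencil {.(2 + p + q)} (suc p) 0<x x<M | inner q refl
  rewrite inner-sub p q | inner-sub₁ p q | inner-sub₂ p q = lem p q
  where
  lem : ∀ p q → (p + (2 + p + q)) * (2 + q + (2 + p + q)) + 2 * ((suc p + (2 + p + q)) * (1 + q + (2 + p + q)))
    + (suc (suc p) + (2 + p + q)) * (q + (2 + p + q)) + 2 ≡ 4 * ((suc p + (2 + p + q)) * (1 + q + (2 + p + q)))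
  lem = solve-∀

φ-upper : ∀ M x → x ≤ M → 4 * φ M x ≤ 9 * (M * M)
φ-upper M x h = ≤-trans (four-*-≤-square (x + M) (M ∸ x + M)) (≤-reflexive (trans (cong (λ z → z * z) (trans (l₀ x M (M ∸ x)) (cong (_+ 2 * M) (m+[n∸m]≡n h)))) (l M)))
  where
  l₀ : ∀ x m y → x + m + (y + m) ≡ x + y + 2 * m
  l₀ = solve-∀
  l : ∀ m → (m + 2 * m) * (m + 2 * m) ≡ 9 * (m * m)
  l = solve-∀

φ-lower : ∀ M x → x ≤ M → 2 * (M * M) ≤ φ M x
φ-lower M x h = begin
  2 * (M * M) ≡⟨ cong (M * M +_) (+-identityʳ (M * M)) ⟩
  M * M + M * M ≡⟨ cong (λ k → k * M + M * M) (sym (m+[n∸m]≡n h)) ⟩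
  (x + (M ∸ x)) * M + M * M ≤⟨ m≤n+m _ (x * (M ∸ x)) ⟩
  x * (M ∸ x) + ((x + (M ∸ x)) * M + M * M) ≡⟨ l x M (M ∸ x) ⟩
  φ M x ∎
  where
  open ≤-Reasoning
  l : ∀ x m y → x * y + ((x + y) * m + m * m) ≡ (x + m) * (y + m)
  l = solve-∀

half-bounds : ∀ n → 2 * ⌊ n /2⌋ ≤ n × n ≤ suc (2 * ⌊ n /2⌋)
half-bounds zero = z≤n , z≤n
half-bounds (suc zero) = z≤n , s≤s z≤n
half-bounds (suc (suc n)) with half-bounds n
... | p , q = ≤-trans (≤-reflexive (l ⌊ n /2⌋)) (s≤s (s≤s p)) , ≤-trans (s≤s (s≤s q)) (≤-reflexive (cong suc (sym (l ⌊ n /2⌋))))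
  where
  l : ∀ h → 2 * suc h ≡ suc (suc (2 * h))
  l = solve-∀

-- The rate is 1 − 2 / G per lazy step.
module Upper (r G g : ℕ) (r≥4 : 4 ≤ r) (hG : G ≡ 9 * (2 * r * (2 * r))) (hg : G ≡ g + 2) where

  M : ℕ
  M = 2 * r

  r≥3 : 3 ≤ r
  r≥3 = ≤-trans (n≤1+n 3) r≥4

  instance
    r≢0 : NonZero r
    r≢0 = >-nonZero (≤-trans (s≤s z≤n) r≥3)

  r<M : r < M
  r<M = ≤-trans (m<m+n r (≤-trans (s≤s z≤n) r≥3)) (≤-reflexive (sym (double r)))

  -- Losing 2 out of 4f ≤ G is a relative loss of at least 2 / G. Both `φ` and `e` satisfy this
  -- equation, so they share the rate.
  rate : ∀ f x → f x * 4 ≤ G → stencil f x + 2 ≡ 4 * f x → G * stencil f x ≤ 4 * g * f x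
  rate f x hf hs = +-cancelʳ-≤ (2 * G) (G * stencil f x) (4 * g * f x) (begin
    G * stencil f x + 2 * G ≡⟨ l₁ G (stencil f x) ⟩
    G * (stencil f x + 2) ≡⟨ cong₂ _*_ hg hs ⟩
    (g + 2) * (4 * f x) ≡⟨ l₂ g (f x) ⟩
    4 * g * f x + 2 * (f x * 4) ≤⟨ +-monoʳ-≤ (4 * g * f x) (*-monoʳ-≤ 2 hf) ⟩
    4 * g * f x + 2 * G ∎)
    where
    open ≤-Reasoning
    l₁ : ∀ g s → g * s + 2 * g ≡ g * (s + 2)
    l₁ = solve-∀
    l₂ : ∀ g x → (g + 2) * (4 * x) ≡ 4 * g * x + 2 * (x * 4)
    l₂ = solve-∀

  -- On [0,M] the comparison function `φ` stays between 2M² and 9M²/4, so it dominates the indicator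
  -- up to the ends at the cost of a factor 9/8 ≤ 2.
  survival-upper : ∀ t x → x ≤ M → G ^ t * evol M t (one M) x ≤ 2 * (4 * g) ^ t
  survival-upper t x xM = *-cancelˡ-≤ (8 * (M * M)) {{nz}} (begin
    8 * (M * M) * (G ^ t * evol M t (one M) x) ≡⟨ l₁ (M * M) (G ^ t) (evol M t (one M) x) ⟩
    4 * (G ^ t * (2 * (M * M) * evol M t (one M) x)) ≡⟨ cong (λ k → 4 * (G ^ t * k)) (sym (evol-* M t (2 * (M * M)) (one M) x)) ⟩
    4 * (G ^ t * evol M t (λ y → 2 * (M * M) * one M y) x) ≤⟨ *-monoʳ-≤ 4 (supersolution M M (4 * g) G _ (φ M) ≤-refl initial edge inside t x xM) ⟩
    4 * ((4 * g) ^ t * φ M x) ≡⟨ l₂ ((4 * g) ^ t) (φ M x) ⟩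
    (4 * g) ^ t * (4 * φ M x) ≤⟨ *-monoʳ-≤ ((4 * g) ^ t) (φ-upper M x xM) ⟩
    (4 * g) ^ t * (9 * (M * M)) ≤⟨ *-monoʳ-≤ ((4 * g) ^ t) (*-monoˡ-≤ (M * M) (m≤m+n 9 7)) ⟩
    (4 * g) ^ t * (16 * (M * M)) ≡⟨ l₃ ((4 * g) ^ t) (M * M) ⟩
    8 * (M * M) * (2 * (4 * g) ^ t) ∎)
    where
    open ≤-Reasoning
    instance
      M≢0 : NonZero M
      M≢0 = >-nonZero (≤-<-trans z≤n r<M)
    nz : NonZero (8 * (M * M))
    nz = m*n≢0 8 (M * M) {{_}} {{m*n≢0 M M}}
    l₁ : ∀ m p s → 8 * m * (p * s) ≡ 4 * (p * (2 * m * s))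
    l₁ = solve-∀
    l₂ : ∀ p x → 4 * (p * x) ≡ p * (4 * x)
    l₂ = solve-∀
    l₃ : ∀ p m → p * (16 * m) ≡ 8 * m * (2 * p)
    l₃ = solve-∀
    initial : ∀ y → y ≤ M → 2 * (M * M) * one M y ≤ φ M y
    initial y h = ≤-trans (*-monoʳ-≤ (2 * (M * M)) (one≤1 M y)) (≤-trans (≤-reflexive (*-identityʳ _)) (φ-lower M y h))
    edge : ∀ t → G ^ t * evol M t (λ y → 2 * (M * M) * one M y) M ≤ (4 * g) ^ t * φ M M
    edge t = ≤-trans (≤-reflexive (trans (cong (G ^ t *_) (trans (evol-* M t (2 * (M * M)) (one M) M)
       (trans (cong (2 * (M * M) *_) (proj₂ (evol-vanish M t (mask-vanish M (λ _ → 1))) M ≤-refl)) (*-zeroʳ (2 * (M * M)))))) (*-zeroʳ (G ^ t)))) z≤n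
    inside : ∀ x → 0 < x → x < M → G * stencil (φ M) x ≤ 4 * g * φ M x
    inside x p q = rate (φ M) x (≤-trans (≤-reflexive (*-comm (φ M x) 4)) (≤-trans (φ-upper M x (<⇒≤ q)) (≤-reflexive (sym hG)))) (φ-stencil x p q)

  K≤2 : ∀ t a x → 0 < a → a < M → x ≤ M → G ^ t * K M t a x ≤ 2 * (4 * g) ^ t
  K≤2 t a x a>0 a<M xM = ≤-trans (*-monoʳ-≤ (G ^ t) (evol-mono M t δ≤one x)) (survival-upper t x xM)
    where
    δ≤one : ∀ y → δ a y ≤ one M y
    δ≤one y with place M y
    ... | left = ≤-reflexive (δ-≢ a 0 (λ k → <⇒≢ a>0 (sym k)))
    ... | right h = ≤-trans (≤-reflexive (δ-≢ a y (λ k → <⇒≱ a<M (≤-trans h (≤-reflexive (sym k)))))) z≤n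
    ... | inner {p} q k = ≤-trans (δ≤1 a (suc p)) (≤-reflexive (sym (mask-in (λ _ → 1) (inner-< k))))

  -- A quantity starting at 0 on [0,b] and bounded at b is bounded linearly near 0, by comparison with e.
  layer : ∀ X Y a b → b < a → b ≤ M → (∀ t → X * (G ^ t * K M t a b) ≤ (4 * g) ^ t * (Y * e M b)) →
    ∀ t x → x ≤ b → X * (G ^ t * K M t a x) ≤ (4 * g) ^ t * (Y * e M x)
  layer X Y a b b<a bM h t x xb = ≤-trans (≤-reflexive (scale t x)) (supersolution M b (4 * g) G (λ y → X * δ a y) (λ y → Y * e M y) bM initial
      (λ t → ≤-trans (≤-reflexive (sym (scale t b))) (h t)) inside t x xb)
    where
    open ≤-Reasoning
    scale : ∀ t x → X * (G ^ t * K M t a x) ≡ G ^ t * evol M t (λ y → X * δ a y) x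
    scale t x = trans (l X (G ^ t) (K M t a x)) (cong (G ^ t *_) (sym (evol-* M t X (δ a) x)))
      where
      l : ∀ x y z → x * (y * z) ≡ y * (x * z)
      l = solve-∀
    initial : ∀ y → y ≤ b → X * δ a y ≤ Y * e M y
    initial y yb = ≤-trans (≤-reflexive (trans (cong (X *_) (δ-≢ a y (λ k → <⇒≱ b<a (≤-trans (≤-reflexive k) yb)))) (*-zeroʳ X))) z≤n
    inside : ∀ y → 0 < y → y < b → G * stencil (λ y → Y * e M y) y ≤ 4 * g * (Y * e M y)
    inside y p q = begin
      G * (Y * e M (pred y) + 2 * (Y * e M y) + Y * e M (suc y)) ≡⟨ l₁ G Y (e M (pred y)) (e M y) (e M (suc y)) ⟩
      Y * (G * stencil (e M) y) ≤⟨ *-monoʳ-≤ Y (rate (e M) y small (e-stencil y p (<-≤-trans q bM))) ⟩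
      Y * (4 * g * e M y) ≡⟨ l₂ Y g (e M y) ⟩
      4 * g * (Y * e M y) ∎
      where
      small : e M y * 4 ≤ G
      small = ≤-trans (≤-reflexive (*-comm (e M y) 4)) (≤-trans (four-e≤ M y) (≤-trans (m≤m+n (M * M) _) (≤-reflexive (sym hG))))
      l₁ : ∀ g y a b c → g * (y * a + 2 * (y * b) + y * c) ≡ y * (g * (a + 2 * b + c))
      l₁ = solve-∀
      l₂ : ∀ y g x → y * (4 * g * x) ≡ 4 * g * (y * x)
      l₂ = solve-∀

  k : ℕ
  k = ⌊ r /2⌋

  2k≤r : 2 * k ≤ r
  2k≤r = proj₁ (half-bounds r)

  r≤2k+1 : r ≤ suc (2 * k)
  r≤2k+1 = proj₂ (half-bounds r)

  x₁ : ℕ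
  x₁ = r ∸ k

  k≤r : k ≤ r
  k≤r = ≤-trans (m≤m+n k _) 2k≤r

  x₁+k : x₁ + k ≡ r
  x₁+k = m∸n+n≡m k≤r

  centre-symmetric : ∀ t x y → x + y ≡ M → K M t r x ≡ K M t r y
  centre-symmetric t = K-reflect M t r>0 r>0 (sym (double r))
    where r>0 = ≤-trans (s≤s z≤n) r≥3

  centre-monotone : ∀ t x j → x + j ≡ r → x₁ ≤ x → K M t r x₁ ≤ K M t r x
  centre-monotone t x j xj h with increasing-or-decreasing (evol-unimodal M t (δ-unimodal r)) r
  ... | inj₁ up = ≤-trans (increasing up x₁ (x ∸ x₁) (≤-trans (≤-reflexive (m+[n∸m]≡n h)) (m+n≤o⇒m≤o x (≤-reflexive xj))))
     (≤-reflexive (cong (K M t r) (m+[n∸m]≡n h)))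
  ... | inj₂ down = ≤-trans (≤-reflexive (centre-symmetric t x₁ (r + k) (trans (l x₁ r k) (trans (cong (_+ r) x₁+k) (sym (double r))))))
     (≤-trans (≤-reflexive (cong (λ z → K M t r (r + z)) (sym (m+[n∸m]≡n j≤k))))
     (≤-trans (≤-reflexive (cong (K M t r) (sym (+-assoc r j (k ∸ j)))))
     (≤-trans (decreasing down (r + j) (k ∸ j) (m≤m+n r j)) (≤-reflexive (centre-symmetric t (r + j) x (trans (l₂ r j x) (trans (cong (r +_) xj) (sym (double r)))))))))
    where
    l : ∀ x r k → x + (r + k) ≡ x + k + r
    l = solve-∀
    l₂ : ∀ r j x → r + j + x ≡ r + (x + j)
    l₂ = solve-∀
    j≤k : j ≤ k
    j≤k = +-cancelˡ-≤ x₁ j k (≤-trans (+-monoˡ-≤ j h) (≤-reflexive (trans xj (sym x₁+k))))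

  -- The `2k + 1` sites from `x₁` to `r + k` carry at least the value at `x₁`, by unimodality and
  -- symmetry about `r`, and share a mass of at most twice the decay factor. So that value is at
  -- most 2 / r of it.
  spread : ∀ t → r * (G ^ t * K M t r x₁) ≤ 2 * (4 * g) ^ t
  spread t = begin
    r * (G ^ t * K M t r x₁) ≤⟨ *-monoˡ-≤ (G ^ t * K M t r x₁) r≤2k+1 ⟩
    suc (2 * k) * (G ^ t * K M t r x₁) ≡⟨ l₁ (suc (2 * k)) (G ^ t) (K M t r x₁) ⟩
    G ^ t * (suc (2 * k) * K M t r x₁) ≤⟨ *-monoʳ-≤ (G ^ t) (sum-window M x₁ (suc (2 * k)) (K M t r x₁) (K M t r) fits each) ⟩
    G ^ t * sum {M} (K M t r ∘ toℕ) ≡⟨ cong (G ^ t *_) (K-mass t (≤-trans (s≤s z≤n) r≥3) r<M) ⟩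
    G ^ t * evol M t (one M) r ≤⟨ survival-upper t r (<⇒≤ r<M) ⟩
    2 * (4 * g) ^ t ∎
    where
    open ≤-Reasoning
    l₁ : ∀ a b c → a * (b * c) ≡ b * (a * c)
    l₁ = solve-∀
    fits : x₁ + suc (2 * k) ≤ M
    fits = ≤-trans (≤-reflexive (trans (l x₁ k) (cong suc (cong (_+ k) x₁+k)))) (≤-trans (≤-reflexive (sym (+-suc r k))) (≤-trans (+-monoʳ-≤ r suck≤r) (≤-reflexive (sym (double r)))))
      where
      l : ∀ x k → x + suc (2 * k) ≡ suc (x + k + k)
      l = solve-∀
      suck≤r : suc k ≤ r
      suck≤r = ⌊n/2⌋<n′ r
        where
        ⌊n/2⌋<n′ : ∀ r → {{NonZero r}} → suc ⌊ r /2⌋ ≤ r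
        ⌊n/2⌋<n′ (suc r) = ⌊n/2⌋<n r
    each : ∀ i → i < suc (2 * k) → K M t r x₁ ≤ K M t r (x₁ + i)
    each i (s≤s i≤2k) with ≤-total i k
    ... | inj₁ i≤k = centre-monotone t (x₁ + i) (k ∸ i) (trans (+-assoc x₁ i (k ∸ i)) (trans (cong (x₁ +_) (m+[n∸m]≡n i≤k)) x₁+k)) (m≤m+n x₁ i)
    ... | inj₂ k≤i = ≤-trans (centre-monotone t (x₁ + i′) (i ∸ k) eq₁ (m≤m+n x₁ i′))
        (≤-reflexive (centre-symmetric t (x₁ + i′) (x₁ + i) eq₂))
      where
      i′ : ℕ
      i′ = 2 * k ∸ i
      eq₁ : x₁ + i′ + (i ∸ k) ≡ r
      eq₁ = +-cancelʳ-≡ k (x₁ + i′ + (i ∸ k)) r (trans (l x₁ i′ (i ∸ k) k) (trans (cong (λ z → x₁ + (i′ + z)) (m∸n+n≡m k≤i))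
        (trans (cong (x₁ +_) (m∸n+n≡m i≤2k)) (trans (l′ x₁ k) (cong (_+ k) x₁+k)))))
        where
        l : ∀ a b c d → a + b + c + d ≡ a + (b + (c + d))
        l = solve-∀
        l′ : ∀ x k → x + 2 * k ≡ x + k + k
        l′ = solve-∀
      eq₂ : x₁ + i′ + (x₁ + i) ≡ M
      eq₂ = trans (l x₁ i′ i) (trans (cong (2 * x₁ +_) (m∸n+n≡m i≤2k)) (trans (sym (*-distribˡ-+ 2 x₁ k)) (cong (2 *_) x₁+k)))
        where
        l : ∀ a b c → a + b + (a + c) ≡ 2 * a + (b + c)
        l = solve-∀

  -- At `x₁` the kernel is at most 2 / r by `spread` while `e` is at least r²/2; comparison on
  -- [0,x₁], away from the source at `r`, extends the ratio 4 / r³ to the left end.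
  first-layer : ∀ t x → x ≤ x₁ → r * r * r * (G ^ t * K M t r x) ≤ (4 * g) ^ t * (4 * e M x)
  first-layer = layer (r * r * r) 4 r x₁ x₁<r (≤-trans (<⇒≤ x₁<r) (<⇒≤ r<M)) edge
    where
    open ≤-Reasoning
    k>0 : 0 < k
    k>0 = ⌊n/2⌋-mono {2} {r} (≤-trans (n≤1+n 2) r≥3)
    x₁<r : x₁ < r
    x₁<r = ∸-monoʳ-< k>0 k≤r
    r²≤ : r * r ≤ 2 * e M x₁
    r²≤ = begin
      r * r ≡⟨ cong (r *_) (sym x₁+k) ⟩
      r * (x₁ + k) ≤⟨ *-monoʳ-≤ r (+-monoʳ-≤ x₁ (m+n≤o⇒m≤o∸n k (≤-trans (≤-reflexive (sym (double k))) 2k≤r))) ⟩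
      r * (x₁ + x₁) ≡⟨ l r x₁ ⟩
      2 * (x₁ * r) ≤⟨ *-monoʳ-≤ 2 (*-monoʳ-≤ x₁ (m+n≤o⇒m≤o∸n r (≤-trans (+-monoʳ-≤ r (m∸n≤m r k)) (≤-reflexive (sym (double r)))))) ⟩
      2 * (x₁ * (M ∸ x₁)) ∎
      where
      l : ∀ r x → r * (x + x) ≡ 2 * (x * r)
      l = solve-∀
    edge : ∀ t → r * r * r * (G ^ t * K M t r x₁) ≤ (4 * g) ^ t * (4 * e M x₁)
    edge t = begin
      r * r * r * (G ^ t * K M t r x₁) ≡⟨ *-assoc (r * r) r (G ^ t * K M t r x₁) ⟩
      r * r * (r * (G ^ t * K M t r x₁)) ≤⟨ *-mono-≤ r²≤ (spread t) ⟩
      2 * e M x₁ * (2 * (4 * g) ^ t) ≡⟨ l (e M x₁) ((4 * g) ^ t) ⟩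
      (4 * g) ^ t * (4 * e M x₁) ∎
      where
      l : ∀ x p → 2 * x * (2 * p) ≡ p * (4 * x)
      l = solve-∀

  -- The source is now next to the right end. Symmetry and reflection make the value at `r` equal to
  -- that of the walk from `r` at `j`, where `first-layer` gives 4 · 4r / r³ = 16 / r². Comparison
  -- on [0,r], with e(r) = r², yields the ratio 16 / r⁴.
  second-layer : ∀ j b → 0 < j → j ≤ 2 → b + j ≡ M → ∀ t x → x ≤ r → r * r * (r * r) * (G ^ t * K M t b x) ≤ (4 * g) ^ t * (16 * e M x)
  second-layer j b j>0 j≤2 bj = layer (r * r * (r * r)) 16 b r r<b (<⇒≤ r<M) edge
    where
    open ≤-Reasoning
    r<b : r < b
    r<b = +-cancelʳ-< j r b (≤-trans (s≤s (+-monoʳ-≤ r j≤2)) (≤-trans (≤-reflexive (sym (+-suc r 2))) (≤-trans (+-monoʳ-≤ r r≥3) (≤-reflexive (trans (sym (double r)) (sym bj))))))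
    b<M : b < M
    b<M = ≤-trans (m<m+n b j>0) (≤-reflexive bj)
    r>0 : 0 < r
    r>0 = ≤-trans (s≤s z≤n) r≥3
    j≤x₁ : j ≤ x₁
    j≤x₁ = ≤-trans j≤2 (+-cancelʳ-≤ k 2 x₁ (≤-trans 2+k≤r (≤-reflexive (sym x₁+k))))
      where
      2+k≤r : 2 + k ≤ r
      2+k≤r = ≤-trans (+-monoˡ-≤ k (⌊n/2⌋-mono {4} {r} r≥4)) (≤-trans (≤-reflexive (sym (double k))) 2k≤r)
    at-r : ∀ t → K M t b r ≡ K M t r j
    at-r t = trans (K-sym t (<-trans r>0 r<b) b<M r>0 r<M) (centre-symmetric t b j bj)
    ej : e M j ≤ 4 * r
    ej = begin
      j * (M ∸ j) ≤⟨ *-mono-≤ j≤2 (m∸n≤m M j) ⟩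
      2 * M ≡⟨ sym (*-assoc 2 2 r) ⟩
      4 * r ∎
    edge : ∀ t → r * r * (r * r) * (G ^ t * K M t b r) ≤ (4 * g) ^ t * (16 * e M r)
    edge t = begin
      r * r * (r * r) * (G ^ t * K M t b r) ≡⟨ cong (λ z → r * r * (r * r) * (G ^ t * z)) (at-r t) ⟩
      r * r * (r * r) * (G ^ t * K M t r j) ≡⟨ l r (G ^ t * K M t r j) ⟩
      r * (r * r * r * (G ^ t * K M t r j)) ≤⟨ *-monoʳ-≤ r (first-layer t j j≤x₁) ⟩
      r * ((4 * g) ^ t * (4 * e M j)) ≤⟨ *-monoʳ-≤ r (*-monoʳ-≤ ((4 * g) ^ t) (*-monoʳ-≤ 4 ej)) ⟩
      r * ((4 * g) ^ t * (4 * (4 * r))) ≡⟨ l₂ r ((4 * g) ^ t) ⟩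
      (4 * g) ^ t * (16 * (r * r)) ≡⟨ cong (λ z → (4 * g) ^ t * (16 * (r * z))) (sym (trans (cong (_∸ r) (double r)) (m+n∸n≡m r r))) ⟩
      (4 * g) ^ t * (16 * e M r) ∎
      where
      l : ∀ r x → r * r * (r * r) * x ≡ r * (r * r * r * x)
      l = solve-∀
      l₂ : ∀ r p → r * (p * (4 * (4 * r))) ≡ p * (16 * (r * r))
      l₂ = solve-∀

  -- For a ≤ 3 one has e(a) ≤ 3 · 2r, and 16 · 6 = 96. Each endpoint near the boundary has gained a
  -- factor 1 / r over the 1 / r of a spread-out walk.
  K-upper : ∀ j b a → 0 < j → j ≤ 2 → b + j ≡ M → a ≤ 3 → ∀ t → r * r * r * (G ^ t * K M t b a) ≤ (4 * g) ^ t * 96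
  K-upper j b a j>0 j≤2 bj a≤3 t = *-cancelˡ-≤ r (begin
    r * (r * r * r * (G ^ t * K M t b a)) ≡⟨ l r (G ^ t * K M t b a) ⟩
    r * r * (r * r) * (G ^ t * K M t b a) ≤⟨ second-layer j b j>0 j≤2 bj t a (≤-trans a≤3 r≥3) ⟩
    (4 * g) ^ t * (16 * e M a) ≤⟨ *-monoʳ-≤ ((4 * g) ^ t) (*-monoʳ-≤ 16 (*-mono-≤ a≤3 (m∸n≤m M a))) ⟩
    (4 * g) ^ t * (16 * (3 * (2 * r))) ≡⟨ l₂ r ((4 * g) ^ t) ⟩
    r * ((4 * g) ^ t * 96) ∎)
    where
    open ≤-Reasoning
    l : ∀ r x → r * (r * r * r * x) ≡ r * r * (r * r) * x
    l = solve-∀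
    l₂ : ∀ r p → p * (16 * (3 * (2 * r))) ≡ r * (p * 96)
    l₂ = solve-∀

-- Sums over words: a word of length m in the letters Fin d increments the clocks ts.

incr : ∀ {d} → Fin d → Vec ℕ d → Vec ℕ d
incr zero (t ∷ ts) = suc t ∷ ts
incr (suc i) (t ∷ ts) = t ∷ incr i ts

total : ∀ {d} → Vec ℕ d → ℕ
total [] = 0
total (t ∷ ts) = t + total ts

total-incr : ∀ {d} (i : Fin d) ts → total (incr i ts) ≡ suc (total ts)
total-incr zero (t ∷ ts) = refl
total-incr (suc i) (t ∷ ts) = trans (cong (t +_) (total-incr i ts)) (+-suc t (total ts))

words : ∀ {d} → ℕ → Vec ℕ d → (Vec ℕ d → ℕ) → ℕ
words zero ts F = F ts
words (suc m) ts F = sum (λ i → words m (incr i ts) F)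

words-mono : ∀ {d} m (ts : Vec ℕ d) {F F′ : Vec ℕ d → ℕ} → (∀ s → total s ≡ m + total ts → F s ≤ F′ s) → words m ts F ≤ words m ts F′
words-mono zero ts h = h ts refl
words-mono (suc m) ts h = sum-mono (λ i → words-mono m (incr i ts) (λ s k → h s (trans k (trans (cong (m +_) (total-incr i ts)) (+-suc m (total ts))))))

words-+ : ∀ {d} m (ts : Vec ℕ d) F F′ → words m ts (λ s → F s + F′ s) ≡ words m ts F + words m ts F′
words-+ zero ts F F′ = refl
words-+ (suc m) ts F F′ = trans (sum-cong-≗ (λ i → words-+ m (incr i ts) F F′)) (∑-distrib-+ (λ i → words m (incr i ts) F) (λ i → words m (incr i ts) F′))

words-* : ∀ {d} m (ts : Vec ℕ d) c F → words m ts (λ s → c * F s) ≡ c * words m ts F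
words-* zero ts c F = refl
words-* (suc m) ts c F = trans (sum-cong-≗ (λ i → words-* m (incr i ts) c F)) (sym (*-distribˡ-sum c (λ i → words m (incr i ts) F)))

words-const : ∀ {d} m (ts : Vec ℕ d) c → words m ts (λ _ → c) ≡ d ^ m * c
words-const zero ts c = sym (+-identityʳ c)
words-const {d} (suc m) ts c = trans (sum-cong-≗ (λ i → words-const m (incr i ts) c)) (trans (sum-const d (d ^ m * c)) (sym (*-assoc d (d ^ m) c)))

words-sum : ∀ {d e} m (ts : Vec ℕ d) (F : Fin e → Vec ℕ d → ℕ) → words m ts (λ s → sum (λ i → F i s)) ≡ sum (λ i → words m ts (F i))
words-sum zero ts F = refl
words-sum {d} {e} (suc m) ts F = trans (sum-cong-≗ (λ j → words-sum m (incr j ts) F)) (∑-comm {d} {e} (λ j i → words m (incr j ts) (F i)))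

-- 2 to the number of letters other than i: an exponential moment detecting words with few letters i.
weight : ∀ {d} → Fin d → Vec ℕ d → ℕ
weight zero (t ∷ ts) = 2 ^ total ts
weight (suc i) (t ∷ ts) = 2 ^ t * weight i ts

weight-incr : ∀ {d} i (ts : Vec ℕ d) → sum (λ j → weight i (incr j ts)) + weight i ts ≡ 2 * d * weight i ts
weight-incr {suc d} zero (t ∷ ts) = begin
  2 ^ total ts + sum (λ j → 2 ^ total (incr j ts)) + 2 ^ total ts
    ≡⟨ cong (λ z → 2 ^ total ts + z + 2 ^ total ts) (trans (sum-cong-≗ (λ j → cong (2 ^_) (total-incr j ts))) (sum-const d (2 * 2 ^ total ts))) ⟩
  2 ^ total ts + d * (2 * 2 ^ total ts) + 2 ^ total ts ≡⟨ l d (2 ^ total ts) ⟩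
  2 * suc d * 2 ^ total ts ∎
  where
  open ≡-Reasoning
  l : ∀ d x → x + d * (2 * x) + x ≡ 2 * suc d * x
  l = solve-∀
weight-incr {suc d} (suc i) (t ∷ ts) = begin
  2 * 2 ^ t * weight i ts + sum (λ j → 2 ^ t * weight i (incr j ts)) + 2 ^ t * weight i ts
    ≡⟨ cong (λ z → 2 * 2 ^ t * weight i ts + z + 2 ^ t * weight i ts) (sym (*-distribˡ-sum (2 ^ t) (λ j → weight i (incr j ts)))) ⟩
  2 * 2 ^ t * weight i ts + 2 ^ t * S + 2 ^ t * weight i ts ≡⟨ l₁ (2 ^ t) (weight i ts) S ⟩
  2 * (2 ^ t * weight i ts) + 2 ^ t * (S + weight i ts) ≡⟨ cong (λ z → 2 * (2 ^ t * weight i ts) + 2 ^ t * z) (weight-incr i ts) ⟩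
  2 * (2 ^ t * weight i ts) + 2 ^ t * (2 * d * weight i ts) ≡⟨ l₂ (2 ^ t) d (weight i ts) ⟩
  2 * suc d * (2 ^ t * weight i ts) ∎
  where
  open ≡-Reasoning
  S : ℕ
  S = sum (λ j → weight i (incr j ts))
  l₁ : ∀ p x s → 2 * p * x + p * s + p * x ≡ 2 * (p * x) + p * (s + x)
  l₁ = solve-∀
  l₂ : ∀ p d x → 2 * (p * x) + p * (2 * d * x) ≡ 2 * suc d * (p * x)
  l₂ = solve-∀

-- Appending a letter multiplies the weight by 1 for the letter `i` and by 2 for each of the others,
-- so summing over the letters multiplies it by 2d - 1 = `k`.
words-weight : ∀ {d} k → 2 * d ≡ suc k → ∀ m i (ts : Vec ℕ d) → words m ts (weight i) ≡ k ^ m * weight i ts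
words-weight k hk zero i ts = sym (+-identityʳ _)
words-weight {d} k hk (suc m) i ts = begin
  sum (λ j → words m (incr j ts) (weight i)) ≡⟨ sum-cong-≗ (λ j → words-weight k hk m i (incr j ts)) ⟩
  sum (λ j → k ^ m * weight i (incr j ts)) ≡⟨ sym (*-distribˡ-sum (k ^ m) (λ j → weight i (incr j ts))) ⟩
  k ^ m * sum (λ j → weight i (incr j ts))
    ≡⟨ cong (k ^ m *_) (+-cancelʳ-≡ (weight i ts) _ _ (trans (weight-incr i ts) (trans (cong (_* weight i ts) hk) (+-comm (weight i ts) (k * weight i ts))))) ⟩
  k ^ m * (k * weight i ts) ≡⟨ l k (k ^ m) (weight i ts) ⟩
  k * k ^ m * weight i ts ∎
  where
  open ≡-Reasoning
  l : ∀ k p x → p * (k * x) ≡ k * p * x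
  l = solve-∀

weight-lookup : ∀ {d} i (ts : Vec ℕ d) → 2 ^ lookup ts i * weight i ts ≡ 2 ^ total ts
weight-lookup zero (t ∷ ts) = sym (^-distribˡ-+-* 2 t (total ts))
weight-lookup (suc i) (t ∷ ts) = begin
  2 ^ lookup ts i * (2 ^ t * weight i ts) ≡⟨ l (2 ^ lookup ts i) (2 ^ t) (weight i ts) ⟩
  2 ^ t * (2 ^ lookup ts i * weight i ts) ≡⟨ cong (2 ^ t *_) (weight-lookup i ts) ⟩
  2 ^ t * 2 ^ total ts ≡⟨ sym (^-distribˡ-+-* 2 t (total ts)) ⟩
  2 ^ (t + total ts) ∎
  where
  open ≡-Reasoning
  l : ∀ a b c → a * (b * c) ≡ b * (a * c)
  l = solve-∀

zeros : ∀ d → Vec ℕ d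
zeros d = replicate d 0

total-zeros : ∀ d → total (zeros d) ≡ 0
total-zeros zero = refl
total-zeros (suc d) = total-zeros d

weight-zeros : ∀ {d} (i : Fin d) → weight i (zeros d) ≡ 1
weight-zeros {suc d} zero = cong (2 ^_) (total-zeros d)
weight-zeros (suc i) = trans (+-identityʳ _) (weight-zeros i)

-- Indicator that every letter has occurred at least `τ` times; a number, so that it can be summed
-- over words.
large : ∀ {d} → ℕ → Vec ℕ d → ℕ
large τ [] = 1
large τ (t ∷ ts) with τ ≤? t
... | yes _ = large τ ts
... | no _ = 0

large-or-small : ∀ {d} τ (ts : Vec ℕ d) → large τ ts ≡ 1 ⊎ (∃ λ i → lookup ts i < τ)
large-or-small τ [] = inj₁ refl
large-or-small τ (t ∷ ts) with τ ≤? t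
... | no h = inj₂ (zero , ≰⇒> h)
... | yes _ with large-or-small τ ts
... | inj₁ h = inj₁ h
... | inj₂ (i , h) = inj₂ (suc i , h)

bernoulli : ∀ k c j → k ^ j * (k + c * j) ≤ k * (k + c) ^ j
bernoulli k c zero = ≤-reflexive (l k c)
  where
  l : ∀ k c → 1 * (k + c * 0) ≡ k * 1
  l = solve-∀
bernoulli k c (suc j) = begin
  k * k ^ j * (k + c * suc j) ≤⟨ m≤m+n _ (k ^ j * (c * c * j)) ⟩
  k * k ^ j * (k + c * suc j) + k ^ j * (c * c * j) ≡⟨ l₁ k c j (k ^ j) ⟩
  (k + c) * (k ^ j * (k + c * j)) ≤⟨ *-monoʳ-≤ (k + c) (bernoulli k c j) ⟩
  (k + c) * (k * (k + c) ^ j) ≡⟨ l₂ (k + c) k ((k + c) ^ j) ⟩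
  k * ((k + c) * (k + c) ^ j) ∎
  where
  open ≤-Reasoning
  l₁ : ∀ k c j p → k * p * (k + c * suc j) + p * (c * c * j) ≡ (k + c) * (p * (k + c * j))
  l₁ = solve-∀
  l₂ : ∀ a b p → a * (b * p) ≡ b * (a * p)
  l₂ = solve-∀

n<2^n : ∀ n → n < 2 ^ n
n<2^n zero = s≤s z≤n
n<2^n (suc n) = ≤-trans (+-mono-≤ (m^n>0 2 n) (n<2^n n)) (+-monoʳ-≤ (2 ^ n) (≤-reflexive (sym (+-identityʳ (2 ^ n)))))

doubling : ∀ k j → 0 < k → 2 ^ j * k ^ (k * j) ≤ suc k ^ (k * j)
doubling k j k>0 = begin
  2 ^ j * k ^ (k * j) ≡⟨ cong (2 ^ j *_) (sym (^-*-assoc k k j)) ⟩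
  2 ^ j * (k ^ k) ^ j ≡⟨ sym (^-distribʳ-* 2 (k ^ k) j) ⟩
  (2 * k ^ k) ^ j ≤⟨ ^-monoˡ-≤ j once ⟩
  (suc k ^ k) ^ j ≡⟨ ^-*-assoc (suc k) k j ⟩
  suc k ^ (k * j) ∎
  where
  open ≤-Reasoning
  once : 2 * k ^ k ≤ suc k ^ k
  once = *-cancelˡ-≤ k {{>-nonZero k>0}} (begin
    k * (2 * k ^ k) ≡⟨ l k (k ^ k) ⟩
    k ^ k * (k + 1 * k) ≤⟨ bernoulli k 1 k ⟩
    k * (k + 1) ^ k ≡⟨ cong (λ z → k * z ^ k) (+-comm k 1) ⟩
    k * suc k ^ k ∎)
    where
    l : ∀ k p → k * (2 * p) ≡ p * (k + 1 * k)
    l = solve-∀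

-- A Chernoff bound. A word with fewer than `τ` letters `i` has weight at least 2^(m-τ), while the
-- weights of all words for all `i` sum to d k^m. Hence at most 2^τ d k^m / 2^m words are bad, and
-- this is at most half of d^m.
words-large : ∀ {d} k → 2 * d ≡ suc k → 0 < k → ∀ τ m → k * (τ + suc d) ≤ m → d ^ m ≤ 2 * words m (zeros d) (large τ)
words-large {d} k hk k>0 τ m hm with m≤n⇒∃[o]m+o≡n hm
... | r , refl = *-cancelˡ-≤ (2 ^ m) {{m^n≢0 2 m}} (+-cancelʳ-≤ (2 ^ m * d ^ m) _ _ (begin
  2 ^ m * d ^ m + 2 ^ m * d ^ m ≡⟨ l₀ (2 ^ m) (d ^ m) ⟩
  2 * (d ^ m * 2 ^ m) ≡⟨ cong (2 *_) (sym (words-const m (zeros d) (2 ^ m))) ⟩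
  2 * words m (zeros d) (λ _ → 2 ^ m) ≤⟨ *-monoʳ-≤ 2 (words-mono m (zeros d) pointwise) ⟩
  2 * words m (zeros d) (λ s → 2 ^ m * large τ s + 2 ^ τ * sum (λ i → weight i s))
    ≡⟨ cong (2 *_) (trans (words-+ m (zeros d) (λ s → 2 ^ m * large τ s) (λ s → 2 ^ τ * sum (λ i → weight i s)))
        (cong₂ _+_ (words-* m (zeros d) (2 ^ m) (large τ)) (trans (words-* m (zeros d) (2 ^ τ) (λ s → sum (λ i → weight i s))) (cong (2 ^ τ *_) few)))) ⟩
  2 * (2 ^ m * words m (zeros d) (large τ) + 2 ^ τ * (d * k ^ m)) ≡⟨ l₁ (2 ^ m) (words m (zeros d) (large τ)) (2 ^ τ) d (k ^ m) ⟩
  2 ^ m * (2 * words m (zeros d) (large τ)) + 2 ^ τ * (2 * d) * k ^ m ≤⟨ +-monoʳ-≤ (2 ^ m * (2 * words m (zeros d) (large τ))) rare ⟩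
  2 ^ m * (2 * words m (zeros d) (large τ)) + 2 ^ m * d ^ m ∎))
  where
  open ≤-Reasoning
  j : ℕ
  j = τ + suc d
  l₀ : ∀ a b → a * b + a * b ≡ 2 * (b * a)
  l₀ = solve-∀
  l₁ : ∀ a b c d e → 2 * (a * b + c * (d * e)) ≡ a * (2 * b) + c * (2 * d) * e
  l₁ = solve-∀
  few : words m (zeros d) (λ s → sum (λ i → weight i s)) ≡ d * k ^ m
  few = trans (words-sum m (zeros d) weight) (trans (sum-cong-≗ (λ i → trans (words-weight k hk m i (zeros d)) (trans (cong (k ^ m *_) (weight-zeros i)) (*-identityʳ (k ^ m))))) (sum-const d (k ^ m)))
  pointwise : ∀ s → total s ≡ m + total (zeros d) → 2 ^ m ≤ 2 ^ m * large τ s + 2 ^ τ * sum (λ i → weight i s)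
  pointwise s ht with large-or-small τ s
  ... | inj₁ h = ≤-trans (≤-reflexive (sym (trans (cong (2 ^ m *_) h) (*-identityʳ (2 ^ m))))) (m≤m+n _ _)
  ... | inj₂ (i , h) = begin
    2 ^ m ≡⟨ cong (2 ^_) (sym (trans ht (trans (cong (m +_) (total-zeros d)) (+-identityʳ m)))) ⟩
    2 ^ total s ≡⟨ sym (weight-lookup i s) ⟩
    2 ^ lookup s i * weight i s ≤⟨ *-mono-≤ (^-monoʳ-≤ 2 (<⇒≤ h)) (term≤sum (λ i → weight i s) i) ⟩
    2 ^ τ * sum (λ i → weight i s) ≤⟨ m≤n+m _ _ ⟩
    2 ^ m * large τ s + 2 ^ τ * sum (λ i → weight i s) ∎
  -- 2d = k + 1, so the proportion to beat is (k / (k+1))^m. Every `k` letters halve it, and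
  -- `τ + suc d` halvings pay for 2^τ and for 2d ≤ 2^(d+1).
  rare : 2 ^ τ * (2 * d) * k ^ m ≤ 2 ^ m * d ^ m
  rare = begin
    2 ^ τ * (2 * d) * k ^ (k * j + r) ≡⟨ cong (2 ^ τ * (2 * d) *_) (^-distribˡ-+-* k (k * j) r) ⟩
    2 ^ τ * (2 * d) * (k ^ (k * j) * k ^ r) ≤⟨ *-monoˡ-≤ (k ^ (k * j) * k ^ r) (*-monoʳ-≤ (2 ^ τ) (*-monoʳ-≤ 2 (<⇒≤ (n<2^n d)))) ⟩
    2 ^ τ * 2 ^ suc d * (k ^ (k * j) * k ^ r) ≡⟨ cong (_* (k ^ (k * j) * k ^ r)) (sym (^-distribˡ-+-* 2 τ (suc d))) ⟩
    2 ^ j * (k ^ (k * j) * k ^ r) ≡⟨ sym (*-assoc (2 ^ j) (k ^ (k * j)) (k ^ r)) ⟩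
    2 ^ j * k ^ (k * j) * k ^ r ≤⟨ *-mono-≤ (doubling k j k>0) (^-monoˡ-≤ r (n≤1+n k)) ⟩
    suc k ^ (k * j) * suc k ^ r ≡⟨ sym (^-distribˡ-+-* (suc k) (k * j) r) ⟩
    suc k ^ m ≡⟨ cong (_^ m) (sym hk) ⟩
    (2 * d) ^ m ≡⟨ ^-distribʳ-* 2 d m ⟩
    2 ^ m * d ^ m ∎

-- Walks on the grid

kV : ∀ {d n} → Vertex d n → Vertex d n → Vec ℕ d → ℕ
kV [] [] [] = 1
kV {n = n} (v ∷ vs) (x ∷ xs) (t ∷ ts) = K (suc n) t (suc (toℕ v)) (suc (toℕ x)) * kV vs xs ts

-- The laziness 2d is shared out as 2 per coordinate; together with the two neighbours in that
-- coordinate it forms the one-dimensional stencil, which advances a single clock.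
kV-step : ∀ {d n} (v : Vertex d n) (ts : Vec ℕ d) x → nb (λ y → kV v y ts) x + 2 * d * kV v x ts ≡ sum (λ i → kV v x (incr i ts))
kV-step [] [] [] = refl
kV-step {suc d} {n} (v ∷ vs) (t ∷ ts) (x ∷ xs) = begin
  nb (λ y → kV (v ∷ vs) y (t ∷ ts)) (x ∷ xs) + 2 * suc d * (h (suc a) * R)
    ≡⟨ cong (_+ 2 * suc d * (h (suc a) * R)) (nb-∷ (λ y → kV (v ∷ vs) y (t ∷ ts)) x xs) ⟩
  sum {n} (λ y → near a (toℕ y) * (h (suc (toℕ y)) * R)) + nb (λ ys → h (suc a) * kV vs ys ts) xs + 2 * suc d * (h (suc a) * R)
    ≡⟨ cong₂ (λ p q → p + q + 2 * suc d * (h (suc a) * R)) horizontal (nb-* (h (suc a)) (λ ys → kV vs ys ts) xs) ⟩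
  (h a + h (2 + a)) * R + h (suc a) * nb (λ ys → kV vs ys ts) xs + 2 * suc d * (h (suc a) * R)
    ≡⟨ l d (h a) (h (suc a)) (h (2 + a)) R (nb (λ ys → kV vs ys ts) xs) ⟩
  (h a + 2 * h (suc a) + h (2 + a)) * R + h (suc a) * (nb (λ ys → kV vs ys ts) xs + 2 * d * R)
    ≡⟨ cong₂ (λ p q → p * R + h (suc a) * q) (sym (mask-in (stencil h) (s≤s (toℕ<n x)))) (kV-step vs ts xs) ⟩
  T (suc n) h (suc a) * R + h (suc a) * sum (λ i → kV vs xs (incr i ts))
    ≡⟨ cong (T (suc n) h (suc a) * R +_) (*-distribˡ-sum (h (suc a)) (λ i → kV vs xs (incr i ts))) ⟩
  T (suc n) h (suc a) * R + sum (λ i → h (suc a) * kV vs xs (incr i ts)) ∎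
  where
  open ≡-Reasoning
  h : ℕ → ℕ
  h = K (suc n) t (suc (toℕ v))
  a R : ℕ
  a = toℕ x
  R = kV vs xs ts
  vanish : Vanish (suc n) h
  vanish = K-vanish t (s≤s z≤n) (s≤s (toℕ<n v))
  horizontal : sum {n} (λ y → near a (toℕ y) * (h (suc (toℕ y)) * R)) ≡ (h a + h (2 + a)) * R
  horizontal = trans (sum-cong-≗ {n} (λ y → sym (*-assoc (near a (toℕ y)) (h (suc (toℕ y))) R)))
    (trans (sym (*-distribʳ-sum {n} R (λ y → near a (toℕ y) * h (suc (toℕ y)))))
      (cong (_* R) (sum-near x h (proj₁ vanish) (proj₂ vanish (suc n) ≤-refl))))
  l : ∀ d a b c R S → (a + c) * R + b * S + 2 * suc d * (b * R) ≡ (a + 2 * b + c) * R + b * (S + 2 * d * R)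
  l = solve-∀

kV-zeros : ∀ {d n} (v x : Vertex d n) → kV v x (zeros d) ≡ eqV v x
kV-zeros [] [] = refl
kV-zeros (v ∷ vs) (x ∷ xs) = cong (δ (toℕ v) (toℕ x) *_) (kV-zeros vs xs)

-- By `words-step` this is the kernel of (nb + 2d)^m, the lazy walk of weight 4d per step.
walks : ∀ {d n} → ℕ → Vertex d n → Vertex d n → ℕ
walks {d} m v x = words m (zeros d) (kV v x)

words-step : ∀ {d n} m (ts : Vec ℕ d) (v : Vertex d n) x →
  nb (λ y → words m ts (kV v y)) x + 2 * d * words m ts (kV v x) ≡ words (suc m) ts (kV v x)
words-step zero ts v x = kV-step v ts x
words-step {d} (suc m) ts v x = begin
  nb (λ y → sum (λ i → words m (incr i ts) (kV v y))) x + 2 * d * sum (λ i → words m (incr i ts) (kV v x))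
    ≡⟨ cong₂ _+_ (nb-sum (λ i y → words m (incr i ts) (kV v y)) x) (*-distribˡ-sum (2 * d) (λ i → words m (incr i ts) (kV v x))) ⟩
  sum (λ i → nb (λ y → words m (incr i ts) (kV v y)) x) + sum (λ i → 2 * d * words m (incr i ts) (kV v x))
    ≡⟨ sym (∑-distrib-+ (λ i → nb (λ y → words m (incr i ts) (kV v y)) x) (λ i → 2 * d * words m (incr i ts) (kV v x))) ⟩
  sum (λ i → nb (λ y → words m (incr i ts) (kV v y)) x + 2 * d * words m (incr i ts) (kV v x))
    ≡⟨ sum-cong-≗ (λ i → words-step m (incr i ts) v x) ⟩
  sum (λ i → words (suc m) (incr i ts) (kV v x)) ∎
  where open ≡-Reasoning

-- The Green function truncated at time M, scaled by (4d)^M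
green : ∀ {d n} → ℕ → Vertex d n → Vertex d n → ℕ
green zero v x = 0
green {d} (suc m) v x = 4 * d * green m v x + walks m v x

-- A geometric series: 2d - nb = 4d - (nb + 2d), and `nb` + 2d turns the walks of length m into
-- those of length m + 1. Only the ends of the series survive, placed on opposite sides to avoid
-- subtraction.
green-laplacian : ∀ {d n} M (v x : Vertex d n) →
  nb (green M v) x + (4 * d) ^ M * eqV v x ≡ 2 * d * green M v x + walks M v x
green-laplacian {d} zero v x = begin
  nb (λ _ → 0) x + 1 * eqV v x ≡⟨ cong (_+ 1 * eqV v x) (∑V-zero (λ y → *-zeroʳ (adjV x y))) ⟩
  1 * eqV v x ≡⟨ +-identityʳ (eqV v x) ⟩
  eqV v x ≡⟨ sym (kV-zeros v x) ⟩
  kV v x (zeros d) ≡⟨ cong (_+ kV v x (zeros d)) (sym (*-zeroʳ (2 * d))) ⟩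
  2 * d * 0 + kV v x (zeros d) ∎
  where open ≡-Reasoning
green-laplacian {d} (suc M) v x = begin
  nb (λ y → 4 * d * green M v y + walks M v y) x + 4 * d * (4 * d) ^ M * eqV v x
    ≡⟨ cong (_+ 4 * d * (4 * d) ^ M * eqV v x) (trans (nb-+ (λ y → 4 * d * green M v y) (walks M v) x) (cong (_+ nb (walks M v) x) (nb-* (4 * d) (green M v) x))) ⟩
  4 * d * nb (green M v) x + nb (walks M v) x + 4 * d * (4 * d) ^ M * eqV v x
    ≡⟨ l₁ (4 * d) (nb (green M v) x) (nb (walks M v) x) ((4 * d) ^ M) (eqV v x) ⟩
  4 * d * (nb (green M v) x + (4 * d) ^ M * eqV v x) + nb (walks M v) x
    ≡⟨ cong (λ z → 4 * d * z + nb (walks M v) x) (green-laplacian M v x) ⟩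
  4 * d * (2 * d * green M v x + walks M v x) + nb (walks M v) x ≡⟨ l₂ d (green M v x) (walks M v x) (nb (walks M v) x) ⟩
  2 * d * (4 * d * green M v x + walks M v x) + (nb (walks M v) x + 2 * d * walks M v x)
    ≡⟨ cong (2 * d * (4 * d * green M v x + walks M v x) +_) (words-step M (zeros d) v x) ⟩
  2 * d * (4 * d * green M v x + walks M v x) + walks (suc M) v x ∎
  where
  open ≡-Reasoning
  l₁ : ∀ c a b p q → c * a + b + c * p * q ≡ c * (a + p * q) + b
  l₁ = solve-∀
  l₂ : ∀ d g u s → 4 * d * (2 * d * g + u) + s ≡ 2 * d * (4 * d * g + u) + (s + 2 * d * u)
  l₂ = solve-∀

⟨_,_⟩ : ∀ {d n} → (Vertex d n → ℕ) → (Vertex d n → ℕ) → ℕ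
⟨ f , g ⟩ = ∑V (λ x → f x * g x)

-- Pairing a toppling balance with the Green function isolates the odometer at v.
green-identity : ∀ {d n} M (v : Vertex d n) (σ τ u : Vertex d n → ℕ) →
  (∀ x → σ x + nb u x ≡ τ x + 2 * d * u x) →
  ⟨ green M v , σ ⟩ + ⟨ u , walks M v ⟩ ≡ ⟨ green M v , τ ⟩ + (4 * d) ^ M * u v
green-identity {d} M v σ τ u bal = +-cancelʳ-≡ (X + Y) _ _ (begin
  ⟨ g , σ ⟩ + Z + (X + Y) ≡⟨ l₁ ⟨ g , σ ⟩ Z X Y ⟩
  (⟨ g , σ ⟩ + X) + (Y + Z) ≡⟨ cong₂ _+_ eq₁ (sym eq₂) ⟩
  (⟨ g , τ ⟩ + Y) + (X + c) ≡⟨ l₂ ⟨ g , τ ⟩ Y X c ⟩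
  ⟨ g , τ ⟩ + c + (X + Y) ∎)
  where
  open ≡-Reasoning
  g : Vertex _ _ → ℕ
  g = green M v
  X Y Z c : ℕ
  X = ⟨ u , nb g ⟩
  Y = 2 * d * ⟨ u , g ⟩
  Z = ⟨ u , walks M v ⟩
  c = (4 * d) ^ M * u v
  l₁ : ∀ s z x y → s + z + (x + y) ≡ (s + x) + (y + z)
  l₁ = solve-∀
  l₂ : ∀ s y x c → (s + y) + (x + c) ≡ s + c + (x + y)
  l₂ = solve-∀
  l₃ : ∀ a b c → a * (b * c) ≡ b * (c * a)
  l₃ = solve-∀
  eq₁ : ⟨ g , σ ⟩ + X ≡ ⟨ g , τ ⟩ + Y
  eq₁ = begin
    ⟨ g , σ ⟩ + X ≡⟨ cong (⟨ g , σ ⟩ +_) (nb-selfAdjoint u g) ⟩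
    ⟨ g , σ ⟩ + ⟨ g , nb u ⟩ ≡⟨ sym (∑V-+ (λ x → g x * σ x) (λ x → g x * nb u x)) ⟩
    ∑V (λ x → g x * σ x + g x * nb u x) ≡⟨ ∑V-cong (λ x → trans (sym (*-distribˡ-+ (g x) (σ x) (nb u x))) (trans (cong (g x *_) (bal x))
       (trans (*-distribˡ-+ (g x) (τ x) (2 * d * u x)) (cong (g x * τ x +_) (l₃ (g x) (2 * d) (u x)))))) ⟩
    ∑V (λ x → g x * τ x + 2 * d * (u x * g x)) ≡⟨ ∑V-+ (λ x → g x * τ x) (λ x → 2 * d * (u x * g x)) ⟩
    ⟨ g , τ ⟩ + ∑V (λ x → 2 * d * (u x * g x)) ≡⟨ cong (⟨ g , τ ⟩ +_) (∑V-* (2 * d) (λ x → u x * g x)) ⟩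
    ⟨ g , τ ⟩ + Y ∎
  l₄ : ∀ u p q → u * (p * q) ≡ p * (q * u)
  l₄ = solve-∀
  eq₂ : X + c ≡ Y + Z
  eq₂ = begin
    X + c ≡⟨ cong (X +_) (sym (trans (∑V-cong (λ x → l₄ (u x) ((4 * d) ^ M) (eqV v x)))
             (trans (∑V-* ((4 * d) ^ M) (λ x → eqV v x * u x)) (cong ((4 * d) ^ M *_) (∑V-eqV v u))))) ⟩
    X + ∑V (λ x → u x * ((4 * d) ^ M * eqV v x)) ≡⟨ sym (∑V-+ (λ x → u x * nb g x) (λ x → u x * ((4 * d) ^ M * eqV v x))) ⟩
    ∑V (λ x → u x * nb g x + u x * ((4 * d) ^ M * eqV v x))
      ≡⟨ ∑V-cong (λ x → trans (sym (*-distribˡ-+ (u x) (nb g x) ((4 * d) ^ M * eqV v x))) (trans (cong (u x *_) (green-laplacian M v x))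
          (trans (*-distribˡ-+ (u x) (2 * d * g x) (walks M v x)) (cong (_+ u x * walks M v x) (l₅ (u x) (2 * d) (g x)))))) ⟩
    ∑V (λ x → 2 * d * (u x * g x) + u x * walks M v x) ≡⟨ ∑V-+ (λ x → 2 * d * (u x * g x)) (λ x → u x * walks M v x) ⟩
    ∑V (λ x → 2 * d * (u x * g x)) + Z ≡⟨ cong (_+ Z) (∑V-* (2 * d) (λ x → u x * g x)) ⟩
    Y + Z ∎
    where
    l₅ : ∀ u c g → u * (c * g) ≡ c * (u * g)
    l₅ = solve-∀

-- Lower bound for the Green function

distV : ∀ {d n} → Vertex d n → ℕ
distV [] = 1
distV {n = n} (v ∷ vs) = dist (suc n) (suc (toℕ v)) * distV vs

dist>0 : ∀ {n} (v : Fin n) → 0 < dist (suc n) (suc (toℕ v))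
dist>0 v = ⊓-glb (s≤s z≤n) (m<n⇒0<n∸m (toℕ<n v))

distV>0 : ∀ {d n} (v : Vertex d n) → 0 < distV v
distV>0 [] = s≤s z≤n
distV>0 (v ∷ vs) = *-mono-≤ (dist>0 v) (distV>0 vs)

-- Bernoulli's inequality for 1 − c/(w+c), without subtraction.
bernoulli′ : ∀ w c j → (w + c) ^ j * (w + c) ≤ (w + c) * w ^ j + c * j * (w + c) ^ j
bernoulli′ w c zero = ≤-reflexive (l w c)
  where
  l : ∀ w c → 1 * (w + c) ≡ (w + c) * 1 + c * 0 * 1
  l = solve-∀
bernoulli′ w c (suc j) = begin
  Q * Q ^ j * Q ≡⟨ l₁ w c (Q ^ j) ⟩
  w * (Q ^ j * Q) + c * (Q * Q ^ j) ≤⟨ +-monoˡ-≤ (c * (Q * Q ^ j)) (*-monoʳ-≤ w (bernoulli′ w c j)) ⟩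
  w * (Q * w ^ j + c * j * Q ^ j) + c * (Q * Q ^ j) ≤⟨ m≤m+n _ (c * (c * j * Q ^ j)) ⟩
  w * (Q * w ^ j + c * j * Q ^ j) + c * (Q * Q ^ j) + c * (c * j * Q ^ j) ≡⟨ l₂ w c j (w ^ j) (Q ^ j) ⟩
  Q * (w * w ^ j) + c * suc j * (Q * Q ^ j) ∎
  where
  open ≤-Reasoning
  Q : ℕ
  Q = w + c
  l₁ : ∀ w c x → (w + c) * x * (w + c) ≡ w * (x * (w + c)) + c * ((w + c) * x)
  l₁ = solve-∀
  l₂ : ∀ w c j y x → w * ((w + c) * y + c * j * x) + c * ((w + c) * x) + c * (c * j * x) ≡ (w + c) * (w * y) + c * suc j * ((w + c) * x)
  l₂ = solve-∀

-- A block of `L` ≤ (w + 5) / 10 steps costs at most a factor 2, since (1 - 5/(w+5))^L ≥ 1 -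
-- 5L/(w+5) ≥ 1/2, and `m` steps fit into `κ` blocks.
bounded-loss : ∀ w L κ m → 0 < w → 10 * L ≤ w + 5 → m ≤ L * κ → (w + 5) ^ m ≤ 2 ^ κ * w ^ m
bounded-loss w L κ m w>0 hL hm = *-cancelʳ-≤ ((w + 5) ^ m) (2 ^ κ * w ^ m) (w ^ r) {{m^n≢0 w r {{>-nonZero w>0}}}} (begin
  (w + 5) ^ m * w ^ r ≤⟨ *-monoʳ-≤ ((w + 5) ^ m) (^-monoˡ-≤ r (m≤m+n w 5)) ⟩
  (w + 5) ^ m * (w + 5) ^ r ≡⟨ sym (^-distribˡ-+-* (w + 5) m r) ⟩
  (w + 5) ^ (m + r) ≡⟨ cong ((w + 5) ^_) (m+[n∸m]≡n hm) ⟩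
  (w + 5) ^ (L * κ) ≡⟨ sym (^-*-assoc (w + 5) L κ) ⟩
  ((w + 5) ^ L) ^ κ ≤⟨ ^-monoˡ-≤ κ once ⟩
  (2 * w ^ L) ^ κ ≡⟨ ^-distribʳ-* 2 (w ^ L) κ ⟩
  2 ^ κ * (w ^ L) ^ κ ≡⟨ cong (2 ^ κ *_) (^-*-assoc w L κ) ⟩
  2 ^ κ * w ^ (L * κ) ≡⟨ cong (λ z → 2 ^ κ * w ^ z) (sym (m+[n∸m]≡n hm)) ⟩
  2 ^ κ * w ^ (m + r) ≡⟨ cong (2 ^ κ *_) (^-distribˡ-+-* w m r) ⟩
  2 ^ κ * (w ^ m * w ^ r) ≡⟨ sym (*-assoc (2 ^ κ) (w ^ m) (w ^ r)) ⟩
  2 ^ κ * w ^ m * w ^ r ∎)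
  where
  open ≤-Reasoning
  r : ℕ
  r = L * κ ∸ m
  Q : ℕ
  Q = w + 5
  once : Q ^ L ≤ 2 * w ^ L
  once = *-cancelˡ-≤ Q {{>-nonZero (≤-trans w>0 (m≤m+n w 5))}} (+-cancelʳ-≤ (Q * Q ^ L) (Q * Q ^ L) (Q * (2 * w ^ L)) (begin
    Q * Q ^ L + Q * Q ^ L ≡⟨ l₁ Q (Q ^ L) ⟩
    2 * (Q ^ L * Q) ≤⟨ *-monoʳ-≤ 2 (bernoulli′ w 5 L) ⟩
    2 * (Q * w ^ L + 5 * L * Q ^ L) ≡⟨ l₂ Q (w ^ L) L (Q ^ L) ⟩
    Q * (2 * w ^ L) + 10 * L * Q ^ L ≤⟨ +-monoʳ-≤ (Q * (2 * w ^ L)) (*-monoˡ-≤ (Q ^ L) hL) ⟩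
    Q * (2 * w ^ L) + Q * Q ^ L ∎))
    where
    l₁ : ∀ q x → q * x + q * x ≡ 2 * (x * q)
    l₁ = solve-∀
    l₂ : ∀ q y l x → 2 * (q * y + 5 * l * x) ≡ q * (2 * y) + 10 * l * x
    l₂ = solve-∀

module GreenLower (n w C L : ℕ)
    (K-lower : ∀ (t a b : ℕ) → 0 < a → a < suc n → 0 < b → b < suc n → 6 * (w + 5) ≤ t →
      (4 * w) ^ t * (dist (suc n) a * dist (suc n) b) ≤ (w + 5) ^ t * (C * K (suc n) t a b))
    (w>0 : 0 < w) (10L≤ : 10 * L ≤ w + 5) (≤20L : w + 5 ≤ 20 * L) where

  P : ℕ
  P = w + 5

  -- The one-dimensional bounds multiply once every clock has reached 6P; for other words the
  -- indicator makes the left side 0. The distances of `x` to the boundary are estimated by 1, those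
  -- of `v` are kept.
  kV-lower : ∀ {d} (v x : Vertex d n) ts → (4 * w) ^ total ts * (distV v * large (6 * P) ts) ≤ P ^ total ts * (C ^ d * kV v x ts)
  kV-lower [] [] [] = ≤-refl
  kV-lower {suc d} (v ∷ vs) (x ∷ xs) (t ∷ ts) with 6 * P ≤? t
  ... | no _ = ≤-trans (≤-reflexive (trans (cong ((4 * w) ^ total (t ∷ ts) *_) (*-zeroʳ (distV (v ∷ vs)))) (*-zeroʳ ((4 * w) ^ total (t ∷ ts))))) z≤n
  ... | yes h = begin
    (4 * w) ^ (t + total ts) * (dv * distV vs * large (6 * P) ts) ≡⟨ cong (_* (dv * distV vs * large (6 * P) ts)) (^-distribˡ-+-* (4 * w) t (total ts)) ⟩
    (4 * w) ^ t * (4 * w) ^ total ts * (dv * distV vs * large (6 * P) ts) ≡⟨ l₁ ((4 * w) ^ t) ((4 * w) ^ total ts) dv (distV vs) (large (6 * P) ts) ⟩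
    (4 * w) ^ t * (dv * 1) * ((4 * w) ^ total ts * (distV vs * large (6 * P) ts))
      ≤⟨ *-mono-≤ (≤-trans (*-monoʳ-≤ ((4 * w) ^ t) (*-monoʳ-≤ dv (dist>0 x)))
           (K-lower t (suc (toℕ v)) (suc (toℕ x)) (s≤s z≤n) (s≤s (toℕ<n v)) (s≤s z≤n) (s≤s (toℕ<n x)) h))
         (kV-lower vs xs ts) ⟩
    P ^ t * (C * k₁) * (P ^ total ts * (C ^ d * kV vs xs ts)) ≡⟨ l₂ (P ^ t) (P ^ total ts) C k₁ (C ^ d) (kV vs xs ts) ⟩
    P ^ t * P ^ total ts * (C * C ^ d * (k₁ * kV vs xs ts)) ≡⟨ cong (_* (C * C ^ d * (k₁ * kV vs xs ts))) (sym (^-distribˡ-+-* P t (total ts))) ⟩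
    P ^ (t + total ts) * (C * C ^ d * (k₁ * kV vs xs ts)) ∎
    where
    open ≤-Reasoning
    dv k₁ : ℕ
    dv = dist (suc n) (suc (toℕ v))
    k₁ = K (suc n) t (suc (toℕ v)) (suc (toℕ x))
    l₁ : ∀ a b c d e → a * b * (c * d * e) ≡ a * (c * 1) * (b * (d * e))
    l₁ = solve-∀
    l₂ : ∀ a b c k e f → a * (c * k) * (b * (e * f)) ≡ a * b * (c * e * (k * f))
    l₂ = solve-∀

  module _ {d k : ℕ} (hk : 2 * d ≡ suc k) (k>0 : 0 < k) where

    -- `m₀` is the word length at which `words-large` applies with threshold 6P. Up to length 2 m₀ ≤
    -- 2k(7 + d)P ≤ 40k(7 + d)L there are at most `κ` blocks of `L` steps, so decay costs no more
    -- than 2^κ.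
    m₀ κ C′ : ℕ
    m₀ = k * (6 * P + suc d)
    κ = k * (7 + d) * 40
    C′ = 2 ^ suc κ * C ^ d

    walks-lower : ∀ m → m₀ ≤ m → m ≤ m₀ + m₀ → ∀ (v x : Vertex d n) → (4 * d) ^ m * distV v ≤ C′ * walks m v x
    walks-lower m m₀≤m m≤ v x = *-cancelˡ-≤ (w ^ m) {{m^n≢0 w m {{>-nonZero w>0}}}} (begin
      w ^ m * ((4 * d) ^ m * distV v) ≡⟨ cong (λ z → w ^ m * (z * distV v)) (^-distribʳ-* 4 d m) ⟩
      w ^ m * (4 ^ m * d ^ m * distV v) ≡⟨ l₁ (w ^ m) (4 ^ m) (d ^ m) (distV v) ⟩
      4 ^ m * w ^ m * distV v * d ^ m ≤⟨ *-monoʳ-≤ (4 ^ m * w ^ m * distV v) (words-large k hk k>0 (6 * P) m m₀≤m) ⟩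
      4 ^ m * w ^ m * distV v * (2 * words m (zeros d) (large (6 * P))) ≡⟨ cong (λ z → z * distV v * (2 * words m (zeros d) (large (6 * P)))) (sym (^-distribʳ-* 4 w m)) ⟩
      (4 * w) ^ m * distV v * (2 * words m (zeros d) (large (6 * P))) ≡⟨ l₂ ((4 * w) ^ m * distV v) (words m (zeros d) (large (6 * P))) ⟩
      2 * ((4 * w) ^ m * distV v * words m (zeros d) (large (6 * P))) ≡⟨ cong (2 *_) (sym (words-* m (zeros d) ((4 * w) ^ m * distV v) (large (6 * P)))) ⟩
      2 * words m (zeros d) (λ s → (4 * w) ^ m * distV v * large (6 * P) s) ≤⟨ *-monoʳ-≤ 2 (words-mono m (zeros d) each) ⟩
      2 * words m (zeros d) (λ s → P ^ m * C ^ d * kV v x s) ≡⟨ cong (2 *_) (words-* m (zeros d) (P ^ m * C ^ d) (kV v x)) ⟩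
      2 * (P ^ m * C ^ d * walks m v x) ≤⟨ *-monoʳ-≤ 2 (*-monoˡ-≤ (walks m v x) (*-monoˡ-≤ (C ^ d) loss)) ⟩
      2 * (2 ^ κ * w ^ m * C ^ d * walks m v x) ≡⟨ l₃ (2 ^ κ) (w ^ m) (C ^ d) (walks m v x) ⟩
      w ^ m * (C′ * walks m v x) ∎)
      where
      open ≤-Reasoning
      l₁ : ∀ a b c d → a * (b * c * d) ≡ b * a * d * c
      l₁ = solve-∀
      l₂ : ∀ a b → a * (2 * b) ≡ 2 * (a * b)
      l₂ = solve-∀
      l₃ : ∀ a b c d → 2 * (a * b * c * d) ≡ b * (2 * a * c * d)
      l₃ = solve-∀
      each : ∀ s → total s ≡ m + total (zeros d) → (4 * w) ^ m * distV v * large (6 * P) s ≤ P ^ m * C ^ d * kV v x s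
      each s hs = subst (λ z → (4 * w) ^ z * distV v * large (6 * P) s ≤ P ^ z * C ^ d * kV v x s) (trans hs (trans (cong (m +_) (total-zeros d)) (+-identityʳ m)))
        (≤-trans (≤-reflexive (*-assoc ((4 * w) ^ total s) (distV v) (large (6 * P) s))) (≤-trans (kV-lower v x s) (≤-reflexive (sym (*-assoc (P ^ total s) (C ^ d) (kV v x s))))))
      loss : P ^ m ≤ 2 ^ κ * w ^ m
      loss = bounded-loss w L κ m w>0 10L≤ (begin
        m ≤⟨ m≤ ⟩
        m₀ + m₀ ≤⟨ +-mono-≤ half half ⟩
        k * ((7 + d) * P) + k * ((7 + d) * P) ≡⟨ l₄ k (7 + d) P ⟩
        k * (7 + d) * 2 * P ≤⟨ *-monoʳ-≤ (k * (7 + d) * 2) ≤20L ⟩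
        k * (7 + d) * 2 * (20 * L) ≡⟨ l₅ (k * (7 + d)) L ⟩
        L * κ ∎)
        where
        half : m₀ ≤ k * ((7 + d) * P)
        half = *-monoʳ-≤ k (≤-trans (+-monoʳ-≤ (6 * P) (m≤m*n (suc d) P {{>-nonZero (≤-trans w>0 (m≤m+n w 5))}})) (≤-reflexive (l P d)))
          where
          l : ∀ p d → 6 * p + suc d * p ≡ (7 + d) * p
          l = solve-∀
        l₄ : ∀ k e p → k * (e * p) + k * (e * p) ≡ k * e * 2 * p
        l₄ = solve-∀
        l₅ : ∀ a l → a * 2 * (20 * l) ≡ l * (a * 40)
        l₅ = solve-∀

    -- Only times from `m₀` to 2 m₀ are used: late enough for all clocks, early enough for bounded
    -- decay. There are `m₀` ≥ P of them, and they supply the factor N² that lowers the exponent 3d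
    -- to 3d - 2.
    green-lower′ : ∀ (v x : Vertex d n) j → j ≤ m₀ → j * ((4 * d) ^ (m₀ + j) * distV v) ≤ 4 * d * (C′ * green (m₀ + j) v x)
    green-lower′ v x zero h = z≤n
    green-lower′ v x (suc j) h rewrite +-suc m₀ j = begin
      suc j * (4 * d * D * distV v) ≡⟨ l₁ j (4 * d) D (distV v) ⟩
      4 * d * (j * (D * distV v)) + 4 * d * (D * distV v)
        ≤⟨ +-mono-≤ (*-monoʳ-≤ (4 * d) (green-lower′ v x j (<⇒≤ h))) (*-monoʳ-≤ (4 * d) (walks-lower (m₀ + j) (m≤m+n m₀ j) (+-monoʳ-≤ m₀ (<⇒≤ h)) v x)) ⟩
      4 * d * (4 * d * (C′ * green (m₀ + j) v x)) + 4 * d * (C′ * walks (m₀ + j) v x) ≡⟨ l₂ (4 * d) C′ (green (m₀ + j) v x) (walks (m₀ + j) v x) ⟩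
      4 * d * (C′ * (4 * d * green (m₀ + j) v x + walks (m₀ + j) v x)) ∎
      where
      open ≤-Reasoning
      D : ℕ
      D = (4 * d) ^ (m₀ + j)
      l₁ : ∀ j c p e → suc j * (c * p * e) ≡ c * (j * (p * e)) + c * (p * e)
      l₁ = solve-∀
      l₂ : ∀ c k g u → c * (c * (k * g)) + c * (k * u) ≡ c * (k * (c * g + u))
      l₂ = solve-∀

    P≤m₀ : P ≤ m₀
    P≤m₀ = ≤-trans (≤-trans (m≤m+n P (5 * P + suc d)) (≤-reflexive (l P d))) (m≤n*m (6 * P + suc d) k {{>-nonZero k>0}})
      where
      l : ∀ p d → p + (5 * p + suc d) ≡ 6 * p + suc d
      l = solve-∀

    green-lower : ∀ (v x : Vertex d n) → P * ((4 * d) ^ (m₀ + m₀) * distV v) ≤ 4 * d * (C′ * green (m₀ + m₀) v x)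
    green-lower v x = ≤-trans (*-monoˡ-≤ ((4 * d) ^ (m₀ + m₀) * distV v) P≤m₀) (green-lower′ v x m₀ ≤-refl)

-- Upper bounds for the Green function and for the surviving walks

module GreenUpper (n r G g j : ℕ) (r≥4 : 4 ≤ r) (hG : G ≡ 9 * (2 * r * (2 * r))) (hg : G ≡ g + 2)
    (0<j : 0 < j) (j≤2 : j ≤ 2) (hj : n + j ≡ 2 * r) where

  open Upper r G g r≥4 hG hg using (K≤2; K-upper)

  N≤2r : suc n ≤ 2 * r
  N≤2r = ≤-trans (≤-trans (≤-reflexive (+-comm 1 n)) (+-monoʳ-≤ n 0<j)) (≤-reflexive hj)

  pos<2r : (a : Fin n) → suc (toℕ a) < 2 * r
  pos<2r a = ≤-trans (s≤s (toℕ<n a)) N≤2r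

  R : ℕ
  R = r * r * r

  -- Coordinates up to 2 are positions up to 3, and the opposite corner has all its positions at n =
  -- 2r - j. After enlarging the interval to [0,2r], `K-upper` applies in each coordinate, with the
  -- roles of the two ends exchanged by symmetry.
  kV-corner : ∀ {d} {v x : Vertex d n} → All (λ a → toℕ a ≤ 2) v → All (λ b → suc (toℕ b) ≡ n) x → ∀ ts →
    R ^ d * (G ^ total ts * kV v x ts) ≤ (4 * g) ^ total ts * 96 ^ d
  kV-corner [] [] [] = ≤-refl
  kV-corner {suc d} {v ∷ vs} {x ∷ xs} (pv ∷ pvs) (px ∷ pxs) (t ∷ ts) = begin
    R * R ^ d * (G ^ (t + total ts) * (K (suc n) t a b * kV vs xs ts)) ≡⟨ cong (λ z → R * R ^ d * (z * (K (suc n) t a b * kV vs xs ts))) (^-distribˡ-+-* G t (total ts)) ⟩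
    R * R ^ d * (G ^ t * G ^ total ts * (K (suc n) t a b * kV vs xs ts)) ≡⟨ l R (R ^ d) (G ^ t) (G ^ total ts) (K (suc n) t a b) (kV vs xs ts) ⟩
    R * (G ^ t * K (suc n) t a b) * (R ^ d * (G ^ total ts * kV vs xs ts)) ≤⟨ *-mono-≤ one-dim (kV-corner pvs pxs ts) ⟩
    (4 * g) ^ t * 96 * ((4 * g) ^ total ts * 96 ^ d) ≡⟨ l₂ ((4 * g) ^ t) 96 ((4 * g) ^ total ts) (96 ^ d) ⟩
    (4 * g) ^ t * (4 * g) ^ total ts * (96 * 96 ^ d) ≡⟨ cong (_* (96 * 96 ^ d)) (sym (^-distribˡ-+-* (4 * g) t (total ts))) ⟩
    (4 * g) ^ (t + total ts) * (96 * 96 ^ d) ∎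
    where
    open ≤-Reasoning
    a b : ℕ
    a = suc (toℕ v)
    b = suc (toℕ x)
    l : ∀ r s x y k f → r * s * (x * y * (k * f)) ≡ r * (x * k) * (s * (y * f))
    l = solve-∀
    l₂ : ∀ a b c d → a * b * (c * d) ≡ a * c * (b * d)
    l₂ = solve-∀
    one-dim : R * (G ^ t * K (suc n) t a b) ≤ (4 * g) ^ t * 96
    one-dim = ≤-trans (*-monoʳ-≤ R (*-monoʳ-≤ (G ^ t) (≤-trans (K-shift 0 t {a} N≤2r b)
        (≤-reflexive (K-sym t (s≤s z≤n) (pos<2r v) (s≤s z≤n) (pos<2r x))))))
      (K-upper j b a 0<j j≤2 (trans (cong (_+ j) px) hj) (s≤s pv) t)

  kV-bounded : ∀ {d} (v x : Vertex d n) ts → G ^ total ts * kV v x ts ≤ 2 ^ d * (4 * g) ^ total ts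
  kV-bounded [] [] [] = ≤-refl
  kV-bounded {suc d} (v ∷ vs) (x ∷ xs) (t ∷ ts) = begin
    G ^ (t + total ts) * (K (suc n) t a b * kV vs xs ts) ≡⟨ cong (_* (K (suc n) t a b * kV vs xs ts)) (^-distribˡ-+-* G t (total ts)) ⟩
    G ^ t * G ^ total ts * (K (suc n) t a b * kV vs xs ts) ≡⟨ l (G ^ t) (G ^ total ts) (K (suc n) t a b) (kV vs xs ts) ⟩
    G ^ t * K (suc n) t a b * (G ^ total ts * kV vs xs ts) ≤⟨ *-mono-≤ one-dim (kV-bounded vs xs ts) ⟩
    2 * (4 * g) ^ t * (2 ^ d * (4 * g) ^ total ts) ≡⟨ l 2 ((4 * g) ^ t) (2 ^ d) ((4 * g) ^ total ts) ⟩
    2 * 2 ^ d * ((4 * g) ^ t * (4 * g) ^ total ts) ≡⟨ cong (2 * 2 ^ d *_) (sym (^-distribˡ-+-* (4 * g) t (total ts))) ⟩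
    2 * 2 ^ d * (4 * g) ^ (t + total ts) ∎
    where
    open ≤-Reasoning
    a b : ℕ
    a = suc (toℕ v)
    b = suc (toℕ x)
    l : ∀ a b c d → a * b * (c * d) ≡ a * c * (b * d)
    l = solve-∀
    one-dim : G ^ t * K (suc n) t a b ≤ 2 * (4 * g) ^ t
    one-dim = ≤-trans (*-monoʳ-≤ (G ^ t) (K-shift 0 t {a} N≤2r b)) (K≤2 t a b (s≤s z≤n) (pos<2r v) (<⇒≤ (pos<2r x)))

  walks-bound : ∀ {d} (v x : Vertex d n) X Y → (∀ ts → X * (G ^ total ts * kV v x ts) ≤ (4 * g) ^ total ts * Y) →
    ∀ m → X * (G ^ m * walks m v x) ≤ (4 * d) ^ m * (g ^ m * Y)
  walks-bound {d} v x X Y h m = begin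
    X * (G ^ m * walks m v x) ≡⟨ sym (*-assoc X (G ^ m) (walks m v x)) ⟩
    X * G ^ m * walks m v x ≡⟨ sym (words-* m (zeros d) (X * G ^ m) (kV v x)) ⟩
    words m (zeros d) (λ s → X * G ^ m * kV v x s) ≤⟨ words-mono m (zeros d) each ⟩
    words m (zeros d) (λ _ → (4 * g) ^ m * Y) ≡⟨ words-const m (zeros d) ((4 * g) ^ m * Y) ⟩
    d ^ m * ((4 * g) ^ m * Y) ≡⟨ cong (λ z → d ^ m * (z * Y)) (^-distribʳ-* 4 g m) ⟩
    d ^ m * (4 ^ m * g ^ m * Y) ≡⟨ l (d ^ m) (4 ^ m) (g ^ m) Y ⟩
    4 ^ m * d ^ m * (g ^ m * Y) ≡⟨ cong (_* (g ^ m * Y)) (sym (^-distribʳ-* 4 d m)) ⟩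
    (4 * d) ^ m * (g ^ m * Y) ∎
    where
    open ≤-Reasoning
    l : ∀ a b c d → a * (b * c * d) ≡ b * a * (c * d)
    l = solve-∀
    each : ∀ s → total s ≡ m + total (zeros d) → X * G ^ m * kV v x s ≤ (4 * g) ^ m * Y
    each s hs = subst (λ z → X * G ^ z * kV v x s ≤ (4 * g) ^ z * Y) (trans hs (trans (cong (m +_) (total-zeros d)) (+-identityʳ m)))
      (≤-trans (≤-reflexive (*-assoc X (G ^ total s) (kV v x s))) (h s))

  -- Σ (g/G)^m ≤ G/2
  green-upper′ : ∀ {d} (v x : Vertex d n) X Y → (∀ m → X * (G ^ m * walks m v x) ≤ (4 * d) ^ m * (g ^ m * Y)) →
    ∀ M → X * (8 * d) * (G ^ M * green M v x) + Y * G * ((4 * d) ^ M * g ^ M) ≤ Y * G * ((4 * d) ^ M * G ^ M)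
  green-upper′ {d} v x X Y h zero = ≤-reflexive (cong (_+ Y * G * 1) (*-zeroʳ (X * (8 * d))))
  green-upper′ {d} v x X Y h (suc M) = begin
    X * (8 * d) * (G * G ^ M * (4 * d * gr + wk)) + Y * G * (4 * d * (4 * d) ^ M * (g * g ^ M))
      ≡⟨ l₁ X d G (G ^ M) gr wk (Y * G * (4 * d * (4 * d) ^ M * (g * g ^ M))) ⟩
    4 * d * G * (X * (8 * d) * (G ^ M * gr)) + 8 * d * G * (X * (G ^ M * wk)) + Y * G * (4 * d * (4 * d) ^ M * (g * g ^ M))
      ≤⟨ +-monoˡ-≤ _ (+-monoʳ-≤ (4 * d * G * (X * (8 * d) * (G ^ M * gr))) (*-monoʳ-≤ (8 * d * G) (h M))) ⟩
    4 * d * G * (X * (8 * d) * (G ^ M * gr)) + 8 * d * G * ((4 * d) ^ M * (g ^ M * Y)) + Y * G * (4 * d * (4 * d) ^ M * (g * g ^ M))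
      ≡⟨ l₂ (4 * d * G * (X * (8 * d) * (G ^ M * gr))) d G ((4 * d) ^ M) (g ^ M) Y g ⟩
    4 * d * G * (X * (8 * d) * (G ^ M * gr)) + 4 * d * (Y * G * ((4 * d) ^ M * g ^ M)) * (g + 2)
      ≡⟨ cong (λ z → 4 * d * G * (X * (8 * d) * (G ^ M * gr)) + 4 * d * (Y * G * ((4 * d) ^ M * g ^ M)) * z) (sym hg) ⟩
    4 * d * G * (X * (8 * d) * (G ^ M * gr)) + 4 * d * (Y * G * ((4 * d) ^ M * g ^ M)) * G
      ≡⟨ l₃ (4 * d) G (X * (8 * d) * (G ^ M * gr)) (Y * G * ((4 * d) ^ M * g ^ M)) ⟩
    4 * d * G * (X * (8 * d) * (G ^ M * gr) + Y * G * ((4 * d) ^ M * g ^ M)) ≤⟨ *-monoʳ-≤ (4 * d * G) (green-upper′ v x X Y h M) ⟩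
    4 * d * G * (Y * G * ((4 * d) ^ M * G ^ M)) ≡⟨ l₄ (4 * d) G Y ((4 * d) ^ M) (G ^ M) ⟩
    Y * G * (4 * d * (4 * d) ^ M * (G * G ^ M)) ∎
    where
    open ≤-Reasoning
    gr wk : ℕ
    gr = green M v x
    wk = walks M v x
    l₁ : ∀ x d g p r w s → x * (8 * d) * (g * p * (4 * d * r + w)) + s ≡ 4 * d * g * (x * (8 * d) * (p * r)) + 8 * d * g * (x * (p * w)) + s
    l₁ = solve-∀
    l₂ : ∀ a d g p q y h → a + 8 * d * g * (p * (q * y)) + y * g * (4 * d * p * (h * q)) ≡ a + 4 * d * (y * g * (p * q)) * (h + 2)
    l₂ = solve-∀
    l₃ : ∀ c g a b → c * g * a + c * b * g ≡ c * g * (a + b)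
    l₃ = solve-∀
    l₄ : ∀ c g y p q → c * g * (y * g * (p * q)) ≡ y * g * (c * p * (g * q))
    l₄ = solve-∀

  G≢0 : NonZero G
  G≢0 = subst NonZero (trans (+-comm 2 g) (sym hg)) _

  green-corner : ∀ {d} {v x : Vertex d n} → All (λ a → toℕ a ≤ 2) v → All (λ b → suc (toℕ b) ≡ n) x → ∀ M →
    R ^ d * (8 * d) * green M v x ≤ 96 ^ d * G * (4 * d) ^ M
  green-corner {d} {v} {x} pv px M = *-cancelˡ-≤ (G ^ M) {{m^n≢0 G M {{G≢0}}}} (begin
    G ^ M * (R ^ d * (8 * d) * green M v x) ≡⟨ l₁ (G ^ M) (R ^ d * (8 * d)) (green M v x) ⟩
    R ^ d * (8 * d) * (G ^ M * green M v x) ≤⟨ m≤m+n _ _ ⟩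
    R ^ d * (8 * d) * (G ^ M * green M v x) + 96 ^ d * G * ((4 * d) ^ M * g ^ M)
      ≤⟨ green-upper′ v x (R ^ d) (96 ^ d) (walks-bound v x (R ^ d) (96 ^ d) (kV-corner pv px)) M ⟩
    96 ^ d * G * ((4 * d) ^ M * G ^ M) ≡⟨ l₂ (96 ^ d * G) ((4 * d) ^ M) (G ^ M) ⟩
    G ^ M * (96 ^ d * G * (4 * d) ^ M) ∎)
    where
    open ≤-Reasoning
    l₁ : ∀ a b c → a * (b * c) ≡ b * (a * c)
    l₁ = solve-∀
    l₂ : ∀ a b c → a * (b * c) ≡ c * (a * b)
    l₂ = solve-∀

  g>0 : 0 < g
  g>0 = +-cancelʳ-< 2 0 g (≤-trans (s≤s (s≤s (s≤s z≤n))) (≤-trans (*-mono-≤ {3} {9} {1} (s≤s (s≤s (s≤s z≤n))) (*-mono-≤ {1} {2 * r} {1} 2r>0 2r>0)) (≤-reflexive (trans (sym hG) hg))))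
    where
    2r>0 : 1 ≤ 2 * r
    2r>0 = ≤-trans (s≤s z≤n) (≤-trans r≥4 (m≤m+n r _))

  -- The walk decays like (g/G)^M with G = g + 2, and Bernoulli makes (1 + 2/g)^(g S′) exceed `S′`.
  -- With `S` taken from an odometer, this disposes of the error of the truncated Green function.
  walks-vanish : ∀ {d} → 0 < d → (v : Vertex d n) → ∀ S → ∃ λ M → ∀ x → S * walks M v x < (4 * d) ^ M
  walks-vanish {d} d>0 v S = M , go
    where
    open ≤-Reasoning
    S′ M : ℕ
    S′ = S * 2 ^ d
    M = g * S′
    grow : suc S′ * g ^ M ≤ G ^ M
    grow = *-cancelˡ-≤ g {{>-nonZero g>0}} (begin
      g * (suc S′ * g ^ M) ≤⟨ m≤m+n _ (g * S′ * g ^ M) ⟩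
      g * (suc S′ * g ^ M) + g * S′ * g ^ M ≡⟨ l g S′ (g ^ M) ⟩
      g ^ M * (g + 2 * (g * S′)) ≤⟨ bernoulli g 2 M ⟩
      g * (g + 2) ^ M ≡⟨ cong (λ z → g * z ^ M) (sym hg) ⟩
      g * G ^ M ∎)
      where
      l : ∀ g s p → g * (suc s * p) + g * s * p ≡ p * (g + 2 * (g * s))
      l = solve-∀
    go : ∀ x → S * walks M v x < (4 * d) ^ M
    go x = *-cancelˡ-< (G ^ M) _ _ (begin-strict
      G ^ M * (S * walks M v x) ≡⟨ l₁ (G ^ M) S (walks M v x) ⟩
      S * (1 * (G ^ M * walks M v x)) ≤⟨ *-monoʳ-≤ S (walks-bound v x 1 (2 ^ d) (λ ts → ≤-trans (≤-reflexive (+-identityʳ _)) (≤-trans (kV-bounded v x ts) (≤-reflexive (*-comm (2 ^ d) _)))) M) ⟩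
      S * ((4 * d) ^ M * (g ^ M * 2 ^ d)) ≡⟨ l₂ S ((4 * d) ^ M) (g ^ M) (2 ^ d) ⟩
      (4 * d) ^ M * (S * 2 ^ d * g ^ M) <⟨ *-monoʳ-< ((4 * d) ^ M) {{m^n≢0 (4 * d) M {{m*n≢0 4 d {{_}} {{>-nonZero d>0}}}}}} (*-monoˡ-< (g ^ M) {{m^n≢0 g M {{>-nonZero g>0}}}} (n<1+n S′)) ⟩
      (4 * d) ^ M * (suc S′ * g ^ M) ≤⟨ *-monoʳ-≤ ((4 * d) ^ M) grow ⟩
      (4 * d) ^ M * G ^ M ≡⟨ *-comm ((4 * d) ^ M) (G ^ M) ⟩
      G ^ M * (4 * d) ^ M ∎)
      where
      l₁ : ∀ a b c → a * (b * c) ≡ b * (1 * (a * c))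
      l₁ = solve-∀
      l₂ : ∀ a b c d → a * (b * (c * d)) ≡ b * (a * d * c)
      l₂ = solve-∀

-- Exit time near a two-dimensional corner

cap : ℕ → ℕ → ℕ
cap M s = s ⊓ M

-- The parabola s (2M − s), continued by its maximum beyond s = M.
par : ℕ → ℕ → ℕ
par M s = cap M s * (2 * M ∸ cap M s)

data Position (M : ℕ) : ℕ → Set where
  below : ∀ p q → M ≡ 2 + p + q → Position M (suc p)
  at    : ∀ p → M ≡ suc p → Position M (suc p)
  above : ∀ p → M ≤ p → Position M (suc p)

position : ∀ M p → Position M (suc p)
position M p with M ≤? p
... | yes h = above p h
... | no h with m≤n⇒m<n∨m≡n (≰⇒> h)
... | inj₂ e = at p (sym e)
... | inj₁ l with m≤n⇒∃[o]m+o≡n l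
... | q , e = below p q (sym e)

cap-low : ∀ {M s} → s ≤ M → cap M s ≡ s
cap-low = m≤n⇒m⊓n≡m

cap-high : ∀ {M s} → M ≤ s → cap M s ≡ M
cap-high = m≥n⇒m⊓n≡n

par-low : ∀ {M} s r → s ≤ M → 2 * M ≡ s + r → par M s ≡ s * r
par-low {M} s r h k rewrite cap-low h | k = cong (s *_) (m+n∸m≡n s r)

par-high : ∀ {M s} → M ≤ s → par M s ≡ M * M
par-high {M} h rewrite cap-high h = cong (M *_) (trans (cong (_∸ M) (double M)) (m+n∸m≡n M M))

concave-by : ∀ {x y z} a b c k → x ≡ a → y ≡ b → z ≡ c → a + c + k ≤ 2 * b → x + z + k ≤ 2 * y
concave-by a b c k refl refl refl h = h

cap-concave : ∀ M p → cap M p + cap M (2 + p) ≤ 2 * cap M (suc p)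
cap-concave M p = ≤-trans (m≤m+n _ 0) go
  where
  go : cap M p + cap M (2 + p) + 0 ≤ 2 * cap M (suc p)
  go with position M p
  ... | above .p h = concave-by M M M 0 (cap-high h) (cap-high (m≤n⇒m≤1+n h)) (cap-high (m≤n⇒m≤1+n (m≤n⇒m≤1+n h)))
    (≤-reflexive (trans (+-identityʳ (M + M)) (sym (double M))))
  ... | at .p h = concave-by p (suc p) (suc p) 0 (cap-low (≤-trans (n≤1+n p) (≤-reflexive (sym h)))) (cap-low (≤-reflexive (sym h))) (trans (cap-high (≤-trans (≤-reflexive h) (n≤1+n _))) h)
    (≤-trans (n≤1+n _) (≤-reflexive (l p)))
    where
    l : ∀ p → suc (p + suc p + 0) ≡ 2 * suc p
    l = solve-∀
  ... | below .p q h = concave-by p (suc p) (2 + p) 0 (cap-low (≤-trans (m≤n⇒m≤1+n (n≤1+n p)) 2+p≤)) (cap-low (≤-trans (n≤1+n _) 2+p≤)) (cap-low 2+p≤)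
    (≤-reflexive (l p))
    where
    2+p≤ : 2 + p ≤ M
    2+p≤ = ≤-trans (m≤m+n (2 + p) q) (≤-reflexive (sym h))
    l : ∀ p → p + suc (suc p) + 0 ≡ 2 * suc p
    l = solve-∀

twice-suc : ∀ p → 2 * suc p ≡ p + (2 + p)
twice-suc = solve-∀

twice₀ : ∀ p q → 2 * (2 + p + q) ≡ p + (4 + p + 2 * q)
twice₀ = solve-∀

twice₁ : ∀ p q → 2 * (2 + p + q) ≡ suc p + (3 + p + 2 * q)
twice₁ = solve-∀

twice₂ : ∀ p q → 2 * (2 + p + q) ≡ 2 + p + (2 + p + 2 * q)
twice₂ = solve-∀

par-concave′ : ∀ M p → suc p ≤ M → par M p + par M (2 + p) + 1 ≤ 2 * par M (suc p)
par-concave′ M p sp≤M with position M p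
... | above .p h = ⊥-elim (<⇒≱ sp≤M h)
... | at .p h = concave-by (p * (2 + p)) (M * M) (M * M) 1
    (par-low p (2 + p) (<⇒≤ sp≤M) (trans (cong (2 *_) h) (twice-suc p))) (par-high (≤-reflexive h)) (par-high (≤-trans (≤-reflexive h) (n≤1+n _)))
    (subst (λ m → p * (2 + p) + m * m + 1 ≤ 2 * (m * m)) (sym h) (≤-reflexive (l p)))
  where
  l : ∀ p → p * (2 + p) + suc p * suc p + 1 ≡ 2 * (suc p * suc p)
  l = solve-∀
... | below .p q h = concave-by (p * (4 + p + 2 * q)) (suc p * (3 + p + 2 * q)) ((2 + p) * (2 + p + 2 * q)) 1
    (par-low p (4 + p + 2 * q) (<⇒≤ sp≤M) (trans (cong (2 *_) h) (twice₀ p q))) (par-low (suc p) (3 + p + 2 * q) sp≤M (trans (cong (2 *_) h) (twice₁ p q)))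
    (par-low (2 + p) (2 + p + 2 * q) (≤-trans (m≤m+n (2 + p) q) (≤-reflexive (sym h))) (trans (cong (2 *_) h) (twice₂ p q)))
    (≤-trans (n≤1+n _) (≤-reflexive (l p q)))
  where
  l : ∀ p q → suc (p * (4 + p + 2 * q) + (2 + p) * (2 + p + 2 * q) + 1) ≡ 2 * (suc p * (3 + p + 2 * q))
  l = solve-∀

par-concave : ∀ M p → par M p + par M (2 + p) ≤ 2 * par M (suc p)
par-concave M p with suc p ≤? M
... | yes h = ≤-trans (m≤m+n _ 1) (par-concave′ M p h)
... | no h = ≤-trans (m≤m+n _ 0) (concave-by (M * M) (M * M) (M * M) 0 (par-high M≤p) (par-high (m≤n⇒m≤1+n M≤p)) (par-high (m≤n⇒m≤1+n (m≤n⇒m≤1+n M≤p)))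
    (≤-reflexive (trans (+-identityʳ (M * M + M * M)) (sym (double (M * M))))))
  where
  M≤p : M ≤ p
  M≤p = ≤-pred (≰⇒> h)

cap-mono : ∀ M s → cap M s ≤ cap M (suc s)
cap-mono M s = ⊓-monoˡ-≤ M (n≤1+n s)

par-mono : ∀ M s → par M s ≤ par M (suc s)
par-mono M p with position M p
... | above .p h = ≤-reflexive (trans (par-high h) (sym (par-high (m≤n⇒m≤1+n h))))
... | at .p h = subst₂ _≤_ (sym (par-low p (2 + p) (≤-trans (n≤1+n p) (≤-reflexive (sym h))) (trans (cong (2 *_) h) (twice-suc p)))) (sym (par-high (≤-reflexive h)))
    (subst (λ m → p * (2 + p) ≤ m * m) (sym h) (≤-trans (n≤1+n _) (≤-reflexive (l p))))
  where
  l : ∀ p → suc (p * (2 + p)) ≡ suc p * suc p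
  l = solve-∀
... | below .p q h = subst₂ _≤_ (sym (par-low p (4 + p + 2 * q) (≤-trans (m≤n⇒m≤1+n (n≤1+n p)) 2+p≤) (trans (cong (2 *_) h) (twice₀ p q))))
    (sym (par-low (suc p) (3 + p + 2 * q) (≤-trans (n≤1+n _) 2+p≤) (trans (cong (2 *_) h) (twice₁ p q))))
    (≤-trans (m≤m+n _ (3 + 2 * q)) (≤-reflexive (l p q)))
  where
  2+p≤ : 2 + p ≤ M
  2+p≤ = ≤-trans (m≤m+n (2 + p) q) (≤-reflexive (sym h))
  l : ∀ p q → p * (4 + p + 2 * q) + (3 + 2 * q) ≡ suc p * (3 + p + 2 * q)
  l = solve-∀

-- A dyadic superposition with −Δ ≥ 2^κ / 2 on the quarter plane up to scale 2^κ, and of size s t 2^κ κ.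
term : ℕ → ℕ → ℕ → ℕ
term M s t = par M s * cap M t + cap M s * par M t

exitS : ℕ → ℕ → ℕ → ℕ
exitS zero s t = term 1 s t
exitS (suc k) s t = 2 * exitS k s t + term (2 ^ suc k) s t

four : (ℕ → ℕ → ℕ) → ℕ → ℕ → ℕ
four S p r = S p (suc r) + S (2 + p) (suc r) + (S (suc p) r + S (suc p) (2 + r))

term-four : ∀ M p r → four (term M) p r ≡
  (par M p + par M (2 + p)) * cap M (suc r) + (cap M p + cap M (2 + p)) * par M (suc r)
  + (par M (suc p) * (cap M r + cap M (2 + r)) + cap M (suc p) * (par M r + par M (2 + r)))
term-four M p r = l (par M p) (par M (suc p)) (par M (2 + p)) (cap M p) (cap M (suc p)) (cap M (2 + p))
    (par M r) (par M (suc r)) (par M (2 + r)) (cap M r) (cap M (suc r)) (cap M (2 + r))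
  where
  l : ∀ a b c d e f a′ b′ c′ d′ e′ f′ → a * e′ + d * b′ + (c * e′ + f * b′) + (b * d′ + e * a′ + (b * f′ + e * c′))
    ≡ (a + c) * e′ + (d + f) * b′ + (b * (d′ + f′) + e * (a′ + c′))
  l = solve-∀

term-superharmonic : ∀ M p r → four (term M) p r ≤ 4 * term M (suc p) (suc r)
term-superharmonic M p r = begin
  four (term M) p r ≡⟨ term-four M p r ⟩
  (par M p + par M (2 + p)) * E′ + (cap M p + cap M (2 + p)) * B′ + (B * (cap M r + cap M (2 + r)) + E * (par M r + par M (2 + r)))
    ≤⟨ +-mono-≤ (+-mono-≤ (*-monoˡ-≤ E′ (par-concave M p)) (*-monoˡ-≤ B′ (cap-concave M p)))
         (+-mono-≤ (*-monoʳ-≤ B (cap-concave M r)) (*-monoʳ-≤ E (par-concave M r))) ⟩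
  2 * B * E′ + 2 * E * B′ + (B * (2 * E′) + E * (2 * B′)) ≡⟨ l B E B′ E′ ⟩
  4 * term M (suc p) (suc r) ∎
  where
  open ≤-Reasoning
  B E B′ E′ : ℕ
  B = par M (suc p)
  E = cap M (suc p)
  B′ = par M (suc r)
  E′ = cap M (suc r)
  l : ∀ b e b′ e′ → 2 * b * e′ + 2 * e * b′ + (b * (2 * e′) + e * (2 * b′)) ≡ 4 * (b * e′ + e * b′)
  l = solve-∀

-- Up to `M` the second difference of `par` is at most -1, and it is multiplied by the `cap` of the
-- other coordinate. The two products together contribute the sum of the coordinates.
term-strict : ∀ M p r → suc p ≤ M → suc r ≤ M → four (term M) p r + (suc p + suc r) ≤ 4 * term M (suc p) (suc r)
term-strict M p r hp hr = begin
  four (term M) p r + (suc p + suc r) ≡⟨ cong₂ (λ x y → four (term M) p r + (x + y)) (sym (cap-low hp)) (sym (cap-low hr)) ⟩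
  four (term M) p r + (E + E′) ≡⟨ cong (_+ (E + E′)) (term-four M p r) ⟩
  a * E′ + c * B′ + (B * c′ + E * a′) + (E + E′) ≡⟨ l₁ a E′ c B′ B c′ E a′ ⟩
  (a + 1) * E′ + c * B′ + (B * c′ + E * (a′ + 1))
    ≤⟨ +-mono-≤ (+-mono-≤ (*-monoˡ-≤ E′ (par-concave′ M p hp)) (*-monoˡ-≤ B′ (cap-concave M p)))
         (+-mono-≤ (*-monoʳ-≤ B (cap-concave M r)) (*-monoʳ-≤ E (par-concave′ M r hr))) ⟩
  2 * B * E′ + 2 * E * B′ + (B * (2 * E′) + E * (2 * B′)) ≡⟨ l B E B′ E′ ⟩
  4 * term M (suc p) (suc r) ∎
  where
  open ≤-Reasoning
  B E B′ E′ a c a′ c′ : ℕ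
  B = par M (suc p)
  E = cap M (suc p)
  B′ = par M (suc r)
  E′ = cap M (suc r)
  a = par M p + par M (2 + p)
  c = cap M p + cap M (2 + p)
  a′ = par M r + par M (2 + r)
  c′ = cap M r + cap M (2 + r)
  l : ∀ b e b′ e′ → 2 * b * e′ + 2 * e * b′ + (b * (2 * e′) + e * (2 * b′)) ≡ 4 * (b * e′ + e * b′)
  l = solve-∀
  l₁ : ∀ a e′ c b′ b c′ e a′ → a * e′ + c * b′ + (b * c′ + e * a′) + (e + e′) ≡ (a + 1) * e′ + c * b′ + (b * c′ + e * (a′ + 1))
  l₁ = solve-∀

four-suc : ∀ k p r → four (exitS (suc k)) p r ≡ 2 * four (exitS k) p r + four (term (2 ^ suc k)) p r
four-suc k p r = l (S p (suc r)) (S (2 + p) (suc r)) (S (suc p) r) (S (suc p) (2 + r)) (X p (suc r)) (X (2 + p) (suc r)) (X (suc p) r) (X (suc p) (2 + r))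
  where
  S X : ℕ → ℕ → ℕ
  S = exitS k
  X = term (2 ^ suc k)
  l : ∀ a b c d x y z w → 2 * a + x + (2 * b + y) + (2 * c + z + (2 * d + w)) ≡ 2 * (a + b + (c + d)) + (x + y + (z + w))
  l = solve-∀

exitS-superharmonic : ∀ k p r → four (exitS k) p r ≤ 4 * exitS k (suc p) (suc r)
exitS-superharmonic zero p r = term-superharmonic 1 p r
exitS-superharmonic (suc k) p r = begin
  four (exitS (suc k)) p r ≡⟨ four-suc k p r ⟩
  2 * four (exitS k) p r + four (term (2 ^ suc k)) p r ≤⟨ +-mono-≤ (*-monoʳ-≤ 2 (exitS-superharmonic k p r)) (term-superharmonic (2 ^ suc k) p r) ⟩
  2 * (4 * S) + 4 * X ≡⟨ l S X ⟩
  4 * (2 * S + X) ∎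
  where
  open ≤-Reasoning
  S X : ℕ
  S = exitS k (suc p) (suc r)
  X = term (2 ^ suc k) (suc p) (suc r)
  l : ∀ s x → 2 * (4 * s) + 4 * x ≡ 4 * (2 * s + x)
  l = solve-∀

-- Once the coordinates sum to at least 2^k, the deficit of the largest term suffices; from the
-- smaller scales only superharmonicity is needed.
top-scale : ∀ k p r → suc p ≤ 2 ^ suc k → suc r ≤ 2 ^ suc k → 2 ^ k ≤ suc p + suc r →
  2 * four (exitS (suc k)) p r + 2 ^ suc k ≤ 8 * exitS (suc k) (suc p) (suc r)
top-scale k p r hp hr h = begin
  2 * four (exitS (suc k)) p r + 2 ^ suc k ≡⟨ cong (λ z → 2 * z + 2 ^ suc k) (four-suc k p r) ⟩
  2 * (2 * four (exitS k) p r + F) + 2 * 2 ^ k ≤⟨ +-mono-≤ (*-monoʳ-≤ 2 (+-monoˡ-≤ F (*-monoʳ-≤ 2 (exitS-superharmonic k p r)))) (*-monoʳ-≤ 2 h) ⟩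
  2 * (2 * (4 * S) + F) + 2 * (suc p + suc r) ≡⟨ l₁ S F (suc p + suc r) ⟩
  16 * S + 2 * (F + (suc p + suc r)) ≤⟨ +-monoʳ-≤ (16 * S) (*-monoʳ-≤ 2 (term-strict (2 ^ suc k) p r hp hr)) ⟩
  16 * S + 2 * (4 * X) ≡⟨ l₂ S X ⟩
  8 * (2 * S + X) ∎
  where
  open ≤-Reasoning
  F S X : ℕ
  F = four (term (2 ^ suc k)) p r
  S = exitS k (suc p) (suc r)
  X = term (2 ^ suc k) (suc p) (suc r)
  l₁ : ∀ s f c → 2 * (2 * (4 * s) + f) + 2 * c ≡ 16 * s + 2 * (f + c)
  l₁ = solve-∀
  l₂ : ∀ s x → 16 * s + 2 * (4 * x) ≡ 8 * (2 * s + x)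
  l₂ = solve-∀

-- If both coordinates are at most 2^k, the deficit at scale `k` is doubled by the coefficient 2 in
-- `exitS`; otherwise the new term provides it.
exitS-strict : ∀ k p r → suc p ≤ 2 ^ k → suc r ≤ 2 ^ k → 2 * four (exitS k) p r + 2 ^ k ≤ 8 * exitS k (suc p) (suc r)
exitS-strict zero p r hp hr = begin
  2 * four (term 1) p r + 1 ≤⟨ +-monoʳ-≤ (2 * four (term 1) p r) (≤-trans (s≤s z≤n) (m≤m+n (2 * (suc p + suc r)) 0)) ⟩
  2 * four (term 1) p r + (2 * (suc p + suc r) + 0) ≡⟨ l (four (term 1) p r) (suc p + suc r) ⟩
  2 * (four (term 1) p r + (suc p + suc r)) ≤⟨ *-monoʳ-≤ 2 (term-strict 1 p r hp hr) ⟩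
  2 * (4 * term 1 (suc p) (suc r)) ≡⟨ sym (*-assoc 2 4 (term 1 (suc p) (suc r))) ⟩
  8 * term 1 (suc p) (suc r) ∎
  where
  open ≤-Reasoning
  l : ∀ a b → 2 * a + (2 * b + 0) ≡ 2 * (a + b)
  l = solve-∀
exitS-strict (suc k) p r hp hr with suc p ≤? 2 ^ k | suc r ≤? 2 ^ k
... | yes hp′ | yes hr′ = begin
  2 * four (exitS (suc k)) p r + 2 ^ suc k ≡⟨ cong (λ z → 2 * z + 2 ^ suc k) (four-suc k p r) ⟩
  2 * (2 * four (exitS k) p r + four (term (2 ^ suc k)) p r) + 2 * 2 ^ k ≡⟨ l₁ (four (exitS k) p r) (four (term (2 ^ suc k)) p r) (2 ^ k) ⟩
  2 * (2 * four (exitS k) p r + 2 ^ k) + 2 * four (term (2 ^ suc k)) p r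
    ≤⟨ +-mono-≤ (*-monoʳ-≤ 2 (exitS-strict k p r hp′ hr′)) (*-monoʳ-≤ 2 (term-superharmonic (2 ^ suc k) p r)) ⟩
  2 * (8 * S) + 2 * (4 * X) ≡⟨ l₂ S X ⟩
  8 * (2 * S + X) ∎
  where
  open ≤-Reasoning
  S X : ℕ
  S = exitS k (suc p) (suc r)
  X = term (2 ^ suc k) (suc p) (suc r)
  l₁ : ∀ a b c → 2 * (2 * a + b) + 2 * c ≡ 2 * (2 * a + c) + 2 * b
  l₁ = solve-∀
  l₂ : ∀ s x → 2 * (8 * s) + 2 * (4 * x) ≡ 8 * (2 * s + x)
  l₂ = solve-∀
... | no h | _ = top-scale k p r hp hr (≤-trans (<⇒≤ (≰⇒> h)) (m≤m+n (suc p) (suc r)))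
... | yes _ | no h = top-scale k p r hp hr (≤-trans (<⇒≤ (≰⇒> h)) (m≤n+m (suc r) (suc p)))

par≤ : ∀ M s → par M s ≤ 2 * M * s
par≤ M s = ≤-trans (*-mono-≤ (m⊓n≤m s M) (m∸n≤m (2 * M) (cap M s))) (≤-reflexive (*-comm s (2 * M)))

-- `exitS k` is the sum of 2^(k-i) `term` (2^i), and `term M` is at most 4M s t. So each of the k +
-- 1 scales contributes at most 4 · 2^k s t, and with 2^k of the order of the side length their
-- number is the logarithm.
exitS≤ : ∀ k s t → exitS k s t ≤ 2 ^ k * (4 * suc k * (s * t))
exitS≤ k s t = go k
  where
  open ≤-Reasoning
  term≤ : ∀ M → term M s t ≤ M * (4 * (s * t))
  term≤ M = ≤-trans (+-mono-≤ (*-mono-≤ (par≤ M s) (m⊓n≤m t M)) (*-mono-≤ (m⊓n≤m s M) (par≤ M t))) (≤-reflexive (l M s t))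
    where
    l : ∀ m s t → 2 * m * s * t + s * (2 * m * t) ≡ m * (4 * (s * t))
    l = solve-∀
  go : ∀ k → exitS k s t ≤ 2 ^ k * (4 * suc k * (s * t))
  go zero = term≤ 1
  go (suc k) = begin
    2 * exitS k s t + term (2 ^ suc k) s t ≤⟨ +-mono-≤ (*-monoʳ-≤ 2 (go k)) (term≤ (2 ^ suc k)) ⟩
    2 * (2 ^ k * (4 * suc k * (s * t))) + 2 * 2 ^ k * (4 * (s * t)) ≡⟨ l (2 ^ k) k (s * t) ⟩
    2 * 2 ^ k * (4 * suc (suc k) * (s * t)) ∎
    where
    l : ∀ p k x → 2 * (p * (4 * suc k * x)) + 2 * p * (4 * x) ≡ 2 * p * (4 * suc (suc k) * x)
    l = solve-∀

exitS-monoˡ : ∀ k s t → exitS k s t ≤ exitS k (suc s) t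
exitS-monoˡ zero s t = +-mono-≤ (*-monoˡ-≤ (cap 1 t) (par-mono 1 s)) (*-monoˡ-≤ (par 1 t) (cap-mono 1 s))
exitS-monoˡ (suc k) s t = +-mono-≤ (*-monoʳ-≤ 2 (exitS-monoˡ k s t)) (+-mono-≤ (*-monoˡ-≤ (cap M t) (par-mono M s)) (*-monoˡ-≤ (par M t) (cap-mono M s)))
  where M = 2 ^ suc k

exitS-sym : ∀ k s t → exitS k s t ≡ exitS k t s
exitS-sym zero s t = l (par 1 s) (cap 1 t) (cap 1 s) (par 1 t)
  where
  l : ∀ a b c d → a * b + c * d ≡ d * c + b * a
  l = solve-∀
exitS-sym (suc k) s t = cong₂ (λ x y → 2 * x + y) (exitS-sym k s t) (l (par M s) (cap M t) (cap M s) (par M t))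
  where
  M = 2 ^ suc k
  l : ∀ a b c d → a * b + c * d ≡ d * c + b * a
  l = solve-∀

exitS-0 : ∀ k t → exitS k 0 t ≡ 0
exitS-0 zero t = refl
exitS-0 (suc k) t = trans (+-identityʳ _) (cong (2 *_) (exitS-0 k t))

steps-mono : ∀ {f : ℕ → ℕ} → (∀ s → f s ≤ f (suc s)) → ∀ {s t} → s ≤ t → f s ≤ f t
steps-mono {f} h {s} s≤t with m≤n⇒∃[o]m+o≡n s≤t
... | w , refl = increasing {f} (λ x _ → h x) s w ≤-refl

-- If a site has distance p + 1 to the boundary, its neighbours have distances at most p and at most
-- p + 2, the second falling short beyond the midpoint. A monotone `f` therefore turns
-- superharmonicity on the half line into superharmonicity on the interval.
dist-concave : ∀ {n} (f : ℕ → ℕ) → f 0 ≡ 0 → (∀ s → f s ≤ f (suc s)) → (x : Fin n) → ∃ λ p →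
  dist (suc n) (suc (toℕ x)) ≡ suc p × nb1 (λ y → f (dist (suc n) (suc (toℕ y)))) x ≤ f p + f (2 + p)
dist-concave {n} f f0 up x with m≤n⇒∃[o]m+o≡n (toℕ<n x)
... | q , e = go (≤-total a q)
  where
  a : ℕ
  a = toℕ x
  h : ℕ → ℕ
  h y = f (dist (suc n) y)
  sub₀ : suc n ∸ a ≡ 2 + q
  sub₀ = trans (cong (λ z → suc z ∸ a) (sym e)) (inner-sub a q)
  sub₁ : suc n ∸ suc a ≡ suc q
  sub₁ = trans (cong (_∸ a) (sym e)) (trans (cong (_∸ a) (sym (+-suc a q))) (m+n∸m≡n a (suc q)))
  sub₂ : suc n ∸ (2 + a) ≡ q
  sub₂ = trans (cong (_∸ suc a) (sym e)) (m+n∸m≡n a q)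
  nb≡ : nb1 (λ y → h (suc (toℕ y))) x ≡ f (a ⊓ (2 + q)) + f ((2 + a) ⊓ q)
  nb≡ = trans (sum-near x h f0 (trans (cong (λ z → f (suc n ⊓ z)) (n∸n≡0 n)) f0))
    (cong₂ _+_ (cong (λ z → f (a ⊓ z)) sub₀) (cong (λ z → f ((2 + a) ⊓ z)) sub₂))
  go : a ≤ q ⊎ q ≤ a → ∃ λ p → dist (suc n) (suc a) ≡ suc p × nb1 (λ y → h (suc (toℕ y))) x ≤ f p + f (2 + p)
  go (inj₁ k) = a , trans (cong (suc a ⊓_) sub₁) (cong suc (m≤n⇒m⊓n≡m k)) ,
    ≤-trans (≤-reflexive nb≡) (+-mono-≤ (steps-mono {f} up (m⊓n≤m a (2 + q))) (steps-mono {f} up (m⊓n≤m (2 + a) q)))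
  go (inj₂ k) = q , trans (cong (suc a ⊓_) sub₁) (cong suc (m≥n⇒m⊓n≡n k)) ,
    ≤-trans (≤-reflexive nb≡) (≤-trans (+-mono-≤ (steps-mono {f} up (m⊓n≤n a (2 + q))) (steps-mono {f} up (m⊓n≤n (2 + a) q))) (≤-reflexive (+-comm (f (2 + q)) (f q))))

nb-const : ∀ {d n} c (x : Vertex d n) → nb (λ _ → c) x ≤ 2 * d * c
nb-const c [] = z≤n
nb-const {suc d} {n} c (x ∷ xs) = begin
  nb (λ _ → c) (x ∷ xs) ≡⟨ nb-∷ (λ _ → c) x xs ⟩
  nb1 (λ _ → c) x + nb (λ _ → c) xs ≤⟨ +-mono-≤ horizontal (nb-const c xs) ⟩
  c + c + 2 * d * c ≡⟨ l d c ⟩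
  2 * suc d * c ∎
  where
  open ≤-Reasoning
  l : ∀ d c → c + c + 2 * d * c ≡ 2 * suc d * c
  l = solve-∀
  h : ℕ → ℕ
  h = mask (suc n) (λ _ → c)
  h≤ : ∀ y → h y ≤ c
  h≤ zero = z≤n
  h≤ (suc y) with suc y <? suc n
  ... | yes _ = ≤-refl
  ... | no _ = z≤n
  horizontal : nb1 (λ _ → c) x ≤ c + c
  horizontal = begin
    nb1 (λ _ → c) x ≡⟨ sum-cong-≗ {n} (λ y → cong (near (toℕ x) (toℕ y) *_) (sym (mask-in {suc n} (λ _ → c) (s≤s (toℕ<n y))))) ⟩
    nb1 (λ y → h (suc (toℕ y))) x ≡⟨ sum-near x h refl (mask-out {suc n} (λ _ → c) ≤-refl) ⟩
    h (toℕ x) + h (2 + toℕ x) ≤⟨ +-mono-≤ (h≤ (toℕ x)) (h≤ (2 + toℕ x)) ⟩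
    c + c ∎

-- Two coordinates are enough: in the others the function is constant, and by `nb-const` a constant
-- is superharmonic.
exitV : ∀ {d n} → ℕ → Vertex (2 + d) n → ℕ
exitV {n = n} k (x ∷ y ∷ zs) = exitS k (dist (suc n) (suc (toℕ x))) (dist (suc n) (suc (toℕ y)))

exitV-strict : ∀ {d n} k → suc n ≤ 2 ^ k → (v : Vertex (2 + d) n) → 2 * nb (exitV k) v + 2 ^ k ≤ 2 * (2 * (2 + d)) * exitV k v
exitV-strict {d} {n} k hk (x ∷ y ∷ zs) with dist-concave (λ s → exitS k s (dist (suc n) (suc (toℕ y)))) (exitS-0 k _) (λ s → exitS-monoˡ k s _) x
  | dist-concave (exitS k (dist (suc n) (suc (toℕ x)))) (trans (exitS-sym k _ 0) (exitS-0 k _)) (λ t → subst₂ _≤_ (exitS-sym k t _) (exitS-sym k (suc t) _) (exitS-monoˡ k t _)) y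
... | p , ep , bp | r , er , br = begin
  2 * nb (exitV k) (x ∷ y ∷ zs) + 2 ^ k ≡⟨ cong (λ z → 2 * z + 2 ^ k) (trans (nb-∷ (exitV k) x (y ∷ zs)) (cong (A +_) (nb-∷ (λ ws → exitV k (x ∷ ws)) y zs))) ⟩
  2 * (A + (B + nb (λ _ → exitV k (x ∷ y ∷ zs)) zs)) + 2 ^ k
    ≤⟨ +-monoˡ-≤ (2 ^ k) (*-monoʳ-≤ 2 (+-mono-≤ bp (+-mono-≤ br (nb-const (exitV k (x ∷ y ∷ zs)) zs)))) ⟩
  2 * (exitS k p dy + exitS k (2 + p) dy + (exitS k dx r + exitS k dx (2 + r) + 2 * d * exitS k dx dy)) + 2 ^ k
    ≡⟨ cong₂ (λ s t → 2 * (exitS k p t + exitS k (2 + p) t + (exitS k s r + exitS k s (2 + r) + 2 * d * exitS k s t)) + 2 ^ k) ep er ⟩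
  2 * (exitS k p (suc r) + exitS k (2 + p) (suc r) + (exitS k (suc p) r + exitS k (suc p) (2 + r) + 2 * d * S)) + 2 ^ k
    ≡⟨ l₁ (exitS k p (suc r) + exitS k (2 + p) (suc r)) (exitS k (suc p) r + exitS k (suc p) (2 + r)) d S (2 ^ k) ⟩
  2 * four (exitS k) p r + 2 ^ k + 4 * d * S ≤⟨ +-monoˡ-≤ (4 * d * S) (exitS-strict k p r (small x ep) (small y er)) ⟩
  8 * S + 4 * d * S ≡⟨ l₂ d S ⟩
  2 * (2 * (2 + d)) * S ≡⟨ cong₂ (λ s t → 2 * (2 * (2 + d)) * exitS k s t) (sym ep) (sym er) ⟩
  2 * (2 * (2 + d)) * exitV k (x ∷ y ∷ zs) ∎
  where
  open ≤-Reasoning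
  dx dy S A B : ℕ
  dx = dist (suc n) (suc (toℕ x))
  dy = dist (suc n) (suc (toℕ y))
  S = exitS k (suc p) (suc r)
  A = nb1 (λ x′ → exitV k (x′ ∷ y ∷ zs)) x
  B = nb1 (λ y′ → exitV k (x ∷ y′ ∷ zs)) y
  l₁ : ∀ a b d s c → 2 * (a + (b + 2 * d * s)) + c ≡ 2 * (a + b) + c + 4 * d * s
  l₁ = solve-∀
  l₂ : ∀ d s → 8 * s + 4 * d * s ≡ 2 * (2 * (2 + d)) * s
  l₂ = solve-∀
  small : ∀ (x : Fin n) {p} → dist (suc n) (suc (toℕ x)) ≡ suc p → suc p ≤ 2 ^ k
  small x h = ≤-trans (≤-reflexive (sym h)) (≤-trans (m⊓n≤m (suc (toℕ x)) _) (≤-trans (m≤n⇒m≤1+n (toℕ<n x)) hk))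

exitV≤ : ∀ {d n} k (v : Vertex (2 + d) n) → exitV k v ≤ 2 ^ k * (4 * suc k * distV v)
exitV≤ {n = n} k (x ∷ y ∷ zs) = ≤-trans (exitS≤ k s t) (*-monoʳ-≤ (2 ^ k) (*-monoʳ-≤ (4 * suc k)
  (*-monoʳ-≤ s (m≤m*n t (distV zs) {{>-nonZero (distV>0 zs)}}))))
  where
  s t : ℕ
  s = dist (suc n) (suc (toℕ x))
  t = dist (suc n) (suc (toℕ y))

-- `exitV` has deficit at least 2^k / 2 everywhere. Self-adjointness moves 2D - nb from it onto
-- `green`, where what is left is at most (4D)^M times the value of `exitV` at `v`.
green-mass : ∀ {d n} k → suc n ≤ 2 ^ k → ∀ M (v : Vertex (2 + d) n) →
  ∑V (green M v) ≤ (4 * (2 + d)) ^ M * (8 * suc k * distV v)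
green-mass {d} {n} k hk M v = *-cancelˡ-≤ (2 ^ k) {{m^n≢0 2 k}} (+-cancelˡ-≤ (2 * ⟨ S , nb g ⟩) _ _ (begin
  2 * ⟨ S , nb g ⟩ + 2 ^ k * ∑V g ≡⟨ cong₂ _+_ (cong (2 *_) (nb-selfAdjoint S g)) (sym (∑V-* (2 ^ k) g)) ⟩
  2 * ⟨ g , nb S ⟩ + ∑V (λ x → 2 ^ k * g x) ≡⟨ cong (_+ ∑V (λ x → 2 ^ k * g x)) (sym (∑V-* 2 (λ x → g x * nb S x))) ⟩
  ∑V (λ x → 2 * (g x * nb S x)) + ∑V (λ x → 2 ^ k * g x) ≡⟨ sym (∑V-+ (λ x → 2 * (g x * nb S x)) (λ x → 2 ^ k * g x)) ⟩
  ∑V (λ x → 2 * (g x * nb S x) + 2 ^ k * g x) ≤⟨ ∑V-mono (λ x → ≤-trans (≤-reflexive (l₁ (g x) (nb S x) (2 ^ k)))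
      (≤-trans (*-monoʳ-≤ (g x) (exitV-strict k hk x)) (≤-trans (≤-reflexive (l₂ (g x) D (S x))) (*-monoʳ-≤ 2 (*-monoʳ-≤ (S x) (subharmonic x)))))) ⟩
  ∑V (λ x → 2 * (S x * (nb g x + (4 * D) ^ M * eqV v x))) ≡⟨ ∑V-* 2 (λ x → S x * (nb g x + (4 * D) ^ M * eqV v x)) ⟩
  2 * ∑V (λ x → S x * (nb g x + (4 * D) ^ M * eqV v x)) ≡⟨ cong (2 *_) (trans (∑V-cong (λ x → l₃ (S x) (nb g x) ((4 * D) ^ M) (eqV v x)))
      (trans (∑V-+ (λ x → S x * nb g x) (λ x → (4 * D) ^ M * (eqV v x * S x))) (cong (⟨ S , nb g ⟩ +_) (trans (∑V-* ((4 * D) ^ M) (λ x → eqV v x * S x)) (cong ((4 * D) ^ M *_) (∑V-eqV v S)))))) ⟩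
  2 * (⟨ S , nb g ⟩ + (4 * D) ^ M * S v) ≤⟨ *-monoʳ-≤ 2 (+-monoʳ-≤ ⟨ S , nb g ⟩ (*-monoʳ-≤ ((4 * D) ^ M) (exitV≤ k v))) ⟩
  2 * (⟨ S , nb g ⟩ + (4 * D) ^ M * (2 ^ k * (4 * suc k * distV v))) ≡⟨ l₄ ⟨ S , nb g ⟩ ((4 * D) ^ M) (2 ^ k) (suc k) (distV v) ⟩
  2 * ⟨ S , nb g ⟩ + 2 ^ k * ((4 * D) ^ M * (8 * suc k * distV v)) ∎))
  where
  open ≤-Reasoning
  D : ℕ
  D = 2 + d
  g S : Vertex (2 + d) n → ℕ
  g = green M v
  S = exitV k
  l₁ : ∀ g b c → 2 * (g * b) + c * g ≡ g * (2 * b + c)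
  l₁ = solve-∀
  l₂ : ∀ g d s → g * (2 * (2 * d) * s) ≡ 2 * (s * (2 * d * g))
  l₂ = solve-∀
  l₃ : ∀ s b p q → s * (b + p * q) ≡ s * b + p * (q * s)
  l₃ = solve-∀
  l₄ : ∀ a p q k e → 2 * (a + p * (q * (4 * k * e))) ≡ 2 * a + q * (p * (8 * k * e))
  l₄ = solve-∀
  subharmonic : ∀ x → 2 * D * g x ≤ nb g x + (4 * D) ^ M * eqV v x
  subharmonic x = ≤-trans (m≤m+n _ (walks M v x)) (≤-reflexive (sym (green-laplacian M v x)))

-- Exhaustive search, and the matrices against equality and adjacency

Searchable : Set → Set₁
Searchable A = {P : A → Set} → (∀ a → Dec (P a)) → Dec (∃ P)

search-Vec : ∀ {A} → Searchable A → ∀ k → Searchable (Vec A k)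
search-Vec s zero P? = map′ ([] ,_) (λ { ([] , p) → p }) (P? [])
search-Vec s (suc k) P? = map′ (λ { (a , as , p) → a ∷ as , p }) (λ { (a ∷ as , p) → a , as , p })
  (s (λ a → search-Vec s k (λ as → P? (a ∷ as))))

search-Vertex : ∀ {d n} → Searchable (Vertex d n)
search-Vertex {d} = search-Vec any? d

all-or-counterexample : ∀ {A} → Searchable A → {P : A → Set} → (∀ a → Dec (P a)) → (∀ a → P a) ⊎ (∃ λ a → ¬ P a)
all-or-counterexample s P? with s (λ a → ¬? (P? a))
... | yes h = inj₂ h
... | no h = inj₁ (λ a → decidable-stable (P? a) (λ q → h (a , q)))

eqV-refl : ∀ {d n} (v : Vertex d n) → eqV v v ≡ 1
eqV-refl [] = refl
eqV-refl (x ∷ xs) = cong₂ _*_ (δ-refl (toℕ x)) (eqV-refl xs)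

eqV-≢ : ∀ {d n} {v w : Vertex d n} → w ≢ v → eqV v w ≡ 0
eqV-≢ {v = []} {[]} h = ⊥-elim (h refl)
eqV-≢ {v = x ∷ xs} {y ∷ ys} h with toℕ x ≟ toℕ y
... | no k = cong (_* eqV xs ys) (δ-≢ (toℕ x) (toℕ y) k)
... | yes k = trans (cong (δ (toℕ x) (toℕ y) *_) (eqV-≢ {v = xs} {ys} (λ { refl → h (cong (_∷ xs) (sym (toℕ-injective k))) }))) (*-zeroʳ (δ (toℕ x) (toℕ y)))

_≟V_ : ∀ {d n} (v w : Vertex d n) → Dec (v ≡ w)
_≟V_ = ≡-dec Data.Fin._≟_

eqV≤1 : ∀ {d n} (v w : Vertex d n) → eqV v w ≤ 1
eqV≤1 [] [] = ≤-refl
eqV≤1 (x ∷ xs) (y ∷ ys) = *-mono-≤ (δ≤1 (toℕ x) (toℕ y)) (eqV≤1 xs ys)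

lookup-ext : ∀ {A : Set} {k} (xs ys : Vec A k) → (∀ j → lookup xs j ≡ lookup ys j) → xs ≡ ys
lookup-ext [] [] h = refl
lookup-ext (x ∷ xs) (y ∷ ys) h = cong₂ _∷_ (h zero) (lookup-ext xs ys (h ∘ suc))

eqV-split : ∀ {d n} (E : Config d n) {v} → 0 < E v → ∀ x → eqV v x + (E x ∸ eqV v x) ≡ E x
eqV-split E {v} p x with x ≟V v
... | yes refl = m+[n∸m]≡n (≤-trans (eqV≤1 x x) p)
... | no k = m+[n∸m]≡n (≤-trans (≤-reflexive (eqV-≢ k)) z≤n)

Near : ℕ → ℕ → Set
Near a b = a ≡ suc b ⊎ b ≡ suc a

near-cases : ∀ a b → (near a b ≡ 1 × Near a b) ⊎ (near a b ≡ 0 × ¬ Near a b)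
near-cases a b with a ≟ suc b | b ≟ suc a
... | yes refl | _ = inj₁ (cong₂ _+_ (δ-refl (suc b)) (δ-≢ (2 + b) b (λ k → <⇒≢ (≤-trans (n<1+n b) (n≤1+n (suc b))) (sym k))) , inj₁ refl)
... | no p | yes refl = inj₁ (cong₂ _+_ (δ-≢ a (2 + a) p) (δ-refl (suc a)) , inj₂ refl)
... | no p | no q = inj₂ (cong₂ _+_ (δ-≢ a (suc b) p) (δ-≢ (suc a) b (q ∘ sym)) , λ { (inj₁ k) → p k ; (inj₂ k) → q k })

adj-cases : ∀ {d n} (v w : Vertex d n) → (adjV v w ≡ 1 × Adj v w) ⊎ (adjV v w ≡ 0 × ¬ Adj v w)
adj-cases [] [] = inj₂ (refl , λ { (() , _) })
adj-cases (x ∷ xs) (y ∷ ys) with x Data.Fin.≟ y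
adj-cases (x ∷ xs) (.x ∷ ys) | yes refl with near-cases (toℕ x) (toℕ x)
... | inj₁ (_ , inj₁ k) = ⊥-elim (<⇒≢ (n<1+n (toℕ x)) k)
... | inj₁ (_ , inj₂ k) = ⊥-elim (<⇒≢ (n<1+n (toℕ x)) k)
... | inj₂ (e , ¬near) with adj-cases xs ys
... | inj₁ (f , i , adj , same) = inj₁ (trans (cong₂ (λ a b → a * eqV xs ys + b * adjV xs ys) e (δ-refl (toℕ x))) (trans (+-identityʳ _) f) ,
    suc i , adj , λ { zero _ → refl ; (suc j) h → same j (h ∘ cong suc) })
... | inj₂ (f , ¬adj) = inj₂ (trans (cong₂ (λ a b → a * eqV xs ys + b * adjV xs ys) e (δ-refl (toℕ x))) (trans (+-identityʳ _) f) ,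
    λ { (zero , adj , _) → ¬near adj ; (suc i , adj , same) → ¬adj (i , adj , λ j h → same (suc j) (λ { refl → h refl })) })
adj-cases (x ∷ xs) (y ∷ ys) | no x≢y with near-cases (toℕ x) (toℕ y) | xs ≟V ys
... | inj₂ (e , ¬near) | _ = inj₂ (cong₂ (λ a b → a * eqV xs ys + b * adjV xs ys) e (δ-≢ (toℕ x) (toℕ y) (x≢y ∘ toℕ-injective)) ,
    λ { (zero , adj , _) → ¬near adj ; (suc i , _ , same) → x≢y (same zero (λ ())) })
... | inj₁ (e , nr) | yes refl = inj₁ (trans (cong₂ (λ a b → a * eqV xs xs + b * adjV xs xs) e (δ-≢ (toℕ x) (toℕ y) (x≢y ∘ toℕ-injective))) (trans (+-identityʳ _) (trans (+-identityʳ _) (eqV-refl xs))) ,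
    zero , nr , λ { zero h → ⊥-elim (h refl) ; (suc j) _ → refl })
... | inj₁ (e , nr) | no xs≢ys = inj₂ (trans (cong₂ (λ a b → a * eqV xs ys + b * adjV xs ys) e (δ-≢ (toℕ x) (toℕ y) (x≢y ∘ toℕ-injective))) (trans (+-identityʳ _) (trans (+-identityʳ _) (eqV-≢ (xs≢ys ∘ sym)))) ,
    λ { (zero , _ , same) → xs≢ys (lookup-ext xs ys (λ j → same (suc j) (λ ()))) ; (suc i , _ , same) → x≢y (same zero (λ ())) })

adj-yes : ∀ {d n} (v w : Vertex d n) → Adj v w → adjV v w ≡ 1
adj-yes v w h with adj-cases v w
... | inj₁ (e , _) = e
... | inj₂ (_ , q) = ⊥-elim (q h)

adj-no : ∀ {d n} (v w : Vertex d n) → ¬ Adj v w → adjV v w ≡ 0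
adj-no v w h with adj-cases v w
... | inj₁ (_ , q) = ⊥-elim (h q)
... | inj₂ (e , _) = e

adj-irrefl : ∀ {d n} (v : Vertex d n) → adjV v v ≡ 0
adj-irrefl v = adj-no v v (λ { (i , inj₁ k , _) → <⇒≢ (n<1+n _) k ; (i , inj₂ k , _) → <⇒≢ (n<1+n _) k })

-- Odometers

Balance : ∀ {d n} → Config d n → Config d n → Config d n → Set
Balance {d} σ τ u = ∀ x → σ x + nb u x ≡ τ x + 2 * d * u x

topple-balance : ∀ {d n} {σ σ′ : Config d n} {v} → Topple σ v σ′ → ∀ x → σ x + adjV v x ≡ σ′ x + 2 * d * eqV v x
topple-balance {d} {n} {σ} {σ′} {v} (_ , e , other) x with x ≟V v
... | yes refl = trans (cong (σ x +_) (adj-irrefl x)) (trans (+-identityʳ _) (trans (sym e) (cong (σ′ x +_) (sym (trans (cong (2 * d *_) (eqV-refl x)) (*-identityʳ (2 * d)))))))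
... | no h with adj-cases v x
... | inj₁ (k , adj) = trans (cong (σ x +_) k) (trans (+-comm (σ x) 1) (trans (sym (proj₁ (other x h) adj))
       (sym (trans (cong (λ z → σ′ x + 2 * d * z) (eqV-≢ h)) (trans (cong (σ′ x +_) (*-zeroʳ (2 * d))) (+-identityʳ _))))))
... | inj₂ (k , ¬adj) = trans (cong (σ x +_) k) (trans (+-identityʳ _) (trans (sym (proj₂ (other x h) ¬adj))
       (sym (trans (cong (λ z → σ′ x + 2 * d * z) (eqV-≢ h)) (trans (cong (σ′ x +_) (*-zeroʳ (2 * d))) (+-identityʳ _))))))

odometer : ∀ {d n} {σ τ : Config d n} → Topples σ τ → Config d n
odometer (stop _) x = 0
odometer (fire v _ r) x = eqV v x + odometer r x

nb-zero : ∀ {d n} (x : Vertex d n) → nb (λ _ → 0) x ≡ 0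
nb-zero x = ∑V-zero (λ y → *-zeroʳ (adjV x y))

nb-fire : ∀ {d n} (v : Vertex d n) u x → nb (λ y → eqV v y + u y) x ≡ adjV v x + nb u x
nb-fire v u x = trans (nb-+ (eqV v) u x) (cong (_+ nb u x) (nb-eqV v x))

balance : ∀ {d n} {σ τ : Config d n} (r : Topples σ τ) → Balance σ τ (odometer r)
balance {d} (stop h) x = cong₂ _+_ (h x) (trans (nb-zero x) (sym (*-zeroʳ (2 * d))))
balance {d} {σ = σ} {τ} (fire {σ' = σ′} v t r) x = begin
  σ x + nb (λ y → eqV v y + odometer r y) x ≡⟨ cong (σ x +_) (nb-fire v (odometer r) x) ⟩
  σ x + (adjV v x + nb (odometer r) x) ≡⟨ sym (+-assoc (σ x) (adjV v x) (nb (odometer r) x)) ⟩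
  σ x + adjV v x + nb (odometer r) x ≡⟨ cong (_+ nb (odometer r) x) (topple-balance t x) ⟩
  σ′ x + 2 * d * eqV v x + nb (odometer r) x ≡⟨ l (σ′ x) (2 * d * eqV v x) (nb (odometer r) x) ⟩
  σ′ x + nb (odometer r) x + 2 * d * eqV v x ≡⟨ cong (_+ 2 * d * eqV v x) (balance r x) ⟩
  τ x + 2 * d * odometer r x + 2 * d * eqV v x ≡⟨ l₂ (τ x) (2 * d) (odometer r x) (eqV v x) ⟩
  τ x + 2 * d * (eqV v x + odometer r x) ∎
  where
  open ≡-Reasoning
  l : ∀ a b c → a + b + c ≡ a + c + b
  l = solve-∀
  l₂ : ∀ a c u e → a + c * u + c * e ≡ a + c * (e + u)
  l₂ = solve-∀

-- The least action principle. A legal firing at `v` forces `w v > 0`, as otherwise `v` would end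
-- with at least `σ v ≥ 2 * d` grains. With that firing removed, `w` balances the rest of the run.
least-action : ∀ {d n} {σ ρ τ : Config d n} (r : Topples σ ρ) w → Balance σ τ w → Stable τ → ∀ x → odometer r x ≤ w x
least-action (stop _) w bal st x = z≤n
least-action {d} {n} {σ} {ρ} {τ} (fire {σ' = σ′} v t r) w bal st x = ≤-trans (+-monoʳ-≤ (eqV v x) (least-action r w′ bal′ st x)) (≤-reflexive (split x))
  where
  open ≡-Reasoning
  wv>0 : 0 < w v
  wv>0 = n≢0⇒n>0 (λ h → <⇒≱ (st v) (≤-trans (proj₁ t) (≤-trans (m≤m+n (σ v) (nb w v))
    (≤-reflexive (trans (bal v) (trans (cong (λ z → τ v + 2 * d * z) h) (trans (cong (τ v +_) (*-zeroʳ (2 * d))) (+-identityʳ _))))))))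
  w′ : Config d n
  w′ y = w y ∸ eqV v y
  split : ∀ y → eqV v y + w′ y ≡ w y
  split = eqV-split w wv>0
  bal′ : Balance σ′ τ w′
  bal′ y = +-cancelʳ-≡ (2 * d * eqV v y) (σ′ y + nb w′ y) (τ y + 2 * d * w′ y) (begin
    σ′ y + nb w′ y + 2 * d * eqV v y ≡⟨ l (σ′ y) (nb w′ y) (2 * d * eqV v y) ⟩
    σ′ y + 2 * d * eqV v y + nb w′ y ≡⟨ cong (_+ nb w′ y) (sym (topple-balance t y)) ⟩
    σ y + adjV v y + nb w′ y ≡⟨ +-assoc (σ y) (adjV v y) (nb w′ y) ⟩
    σ y + (adjV v y + nb w′ y) ≡⟨ cong (σ y +_) (sym (nb-fire v w′ y)) ⟩
    σ y + nb (λ z → eqV v z + w′ z) y ≡⟨ cong (σ y +_) (nb-cong split y) ⟩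
    σ y + nb w y ≡⟨ bal y ⟩
    τ y + 2 * d * w y ≡⟨ cong (λ z → τ y + 2 * d * z) (sym (split y)) ⟩
    τ y + 2 * d * (eqV v y + w′ y) ≡⟨ l₂ (τ y) (2 * d) (w′ y) (eqV v y) ⟩
    τ y + 2 * d * w′ y + 2 * d * eqV v y ∎)
    where
    l : ∀ a b c → a + b + c ≡ a + c + b
    l = solve-∀
    l₂ : ∀ a c u e → a + c * (e + u) ≡ a + c * u + c * e
    l₂ = solve-∀

balance-unique : ∀ {d n} {σ ρ τ : Config d n} {u w} → Balance σ ρ u → Balance σ τ w → (∀ x → u x ≡ w x) → ρ ≗c τ
balance-unique {d} {σ = σ} {ρ} {τ} {u} {w} bu bw h x = +-cancelʳ-≡ (2 * d * u x) (ρ x) (τ x)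
  (trans (sym (bu x)) (trans (cong (σ x +_) (nb-cong h x)) (trans (bw x) (cong (λ z → τ x + 2 * d * z) (sym (h x))))))

stabilization-unique : ∀ {d n} {σ ρ τ : Config d n} → Stabilizes σ ρ → Stabilizes σ τ → ρ ≗c τ
stabilization-unique {ρ = ρ} {τ} (r , sρ) (t , sτ) = balance-unique {ρ = ρ} {τ} (balance r) (balance t)
  (λ x → ≤-antisym (least-action r (odometer t) (balance t) sτ x) (least-action t (odometer r) (balance r) sρ x))

topple : ∀ {d n} → Vertex d n → Config d n → Config d n
topple {d} v σ x = σ x + adjV v x ∸ 2 * d * eqV v x

topple-legal : ∀ {d n} (v : Vertex d n) σ → 2 * d ≤ σ v → Topple σ v (topple v σ)
topple-legal {d} v σ h = h ,
  trans (cong (_+ 2 * d) (cong₂ _∸_ (trans (cong (σ v +_) (adj-irrefl v)) (+-identityʳ (σ v))) (trans (cong (2 * d *_) (eqV-refl v)) (*-identityʳ (2 * d))))) (m∸n+n≡m h) ,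
  λ w w≢v → (λ adj → trans (cong₂ _∸_ (cong (σ w +_) (adj-yes v w adj)) (none w≢v)) (+-comm (σ w) 1)) ,
            (λ ¬adj → trans (cong₂ _∸_ (cong (σ w +_) (adj-no v w ¬adj)) (none w≢v)) (+-identityʳ (σ w)))
  where
  none : ∀ {w} → w ≢ v → 2 * d * eqV v w ≡ 0
  none w≢v = trans (cong (2 * d *_) (eqV-≢ w≢v)) (*-zeroʳ (2 * d))

Topples-trans : ∀ {d n} {σ ρ τ : Config d n} → Topples σ ρ → Topples ρ τ → Topples σ τ
Topples-congˡ : ∀ {d n} {σ σ′ τ : Config d n} → σ ≗c σ′ → Topples σ τ → Topples σ′ τ
Topples-congˡ h (stop k) = stop (λ x → trans (sym (h x)) (k x))
Topples-congˡ {d} h (fire v (p , q , o) r) = fire v (≤-trans p (≤-reflexive (h v)) , trans q (h v) ,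
  λ w w≢v → (λ a → trans (proj₁ (o w w≢v) a) (cong suc (h w))) , (λ a → trans (proj₂ (o w w≢v) a) (h w))) r

Topples-trans (stop h) r = Topples-congˡ (λ x → sym (h x)) r
Topples-trans (fire v t r) s = fire v t (Topples-trans r s)

-- Extra grains never make a toppling illegal. Together with `stabilization-unique` this allows
-- stabilizing after each grain or only once at the end.
Topples-+ : ∀ {d n} {σ τ : Config d n} (E : Config d n) → Topples σ τ → Topples (λ x → σ x + E x) (λ x → τ x + E x)
Topples-+ E (stop h) = stop (λ x → cong (_+ E x) (h x))
Topples-+ {d} {σ = σ} E (fire {σ' = σ′} v (p , q , o) r) = fire v (≤-trans p (m≤m+n _ _) ,
  trans (l (σ′ v) (E v) (2 * d)) (cong (_+ E v) q) ,
  λ w w≢v → (λ a → cong (_+ E w) (proj₁ (o w w≢v) a)) , (λ a → cong (_+ E w) (proj₂ (o w w≢v) a))) (Topples-+ E r)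
  where
  l : ∀ a b c → a + b + c ≡ a + c + b
  l = solve-∀

-- Grains still to be received: late uw tw tv is 1 iff w toppled and its stamp is not before that of v.
late : ℕ → ℕ → ℕ → ℕ
late zero tw tv = 0
late (suc _) tw tv with tw <? tv
... | yes _ = 0
... | no _ = 1

late≤ : ∀ uw tw tv → late uw tw tv ≤ uw
late≤ zero tw tv = z≤n
late≤ (suc uw) tw tv with tw <? tv
... | yes _ = z≤n
... | no _ = s≤s z≤n

late-pos : ∀ {a b} tw tv → (0 < a → 0 < b) → late a tw tv ≤ late b tw tv
late-pos {zero} tw tv h = z≤n
late-pos {suc a} {zero} tw tv h = ⊥-elim (<⇒≱ (h (s≤s z≤n)) z≤n)
late-pos {suc a} {suc b} tw tv h = ≤-refl

late-suc : ∀ a tw tv → late a (suc tw) (suc tv) ≤ late a tw tv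
late-suc zero tw tv = z≤n
late-suc (suc a) tw tv with suc tw <? suc tv | tw <? tv
... | yes _ | _ = z≤n
... | no p | yes q = ⊥-elim (p (s≤s q))
... | no _ | no _ = ≤-refl

late-zero : ∀ a tv → late a 0 (suc tv) ≡ 0
late-zero zero tv = refl
late-zero (suc a) tv with 0 <? suc tv
... | yes _ = refl
... | no h = ⊥-elim (h (s≤s z≤n))

Stamped : ∀ {d n} → Config d n → Config d n → Config d n → Set
Stamped τ u ts = ∀ v → 0 < u v → nb (λ w → late (u w) (ts w) (ts v)) v ≤ τ v

-- The stamps order the vertices by the time of their last toppling; after it, v keeps what later vertices send.
stamps : ∀ {d n} {σ τ : Config d n} (r : Topples σ τ) → ∃ (Stamped τ (odometer r))
stamps (stop _) = (λ _ → 0) , λ v ()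
stamps {d} {n} {σ} {τ} (fire {σ' = σ′} v t r) with stamps r
... | ts′ , st with odometer r v in ov
... | suc _ = ts′ , λ x ux → ≤-trans (nb-mono (λ w → late-pos (ts′ w) (ts′ x) (older w)) x) (st x (older x ux))
  where
  older : ∀ w → 0 < eqV v w + odometer r w → 0 < odometer r w
  older w h with w ≟V v
  ... | yes refl = ≤-trans (s≤s z≤n) (≤-reflexive (sym ov))
  ... | no k = ≤-trans h (≤-reflexive (cong (_+ odometer r w) (eqV-≢ k)))
-- `v` does not fire again, so this is its last toppling and earlier than the last toppling of every
-- vertex that fires later. It gets the stamp 0 and all others move up by one; the grains it
-- receives from now on, `nb u′`, stay.
... | zero = ts , stamped
  where
  open ≤-Reasoning
  u u′ ts : Config d n
  u = odometer (fire {σ' = σ′} v t r)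
  u′ = odometer r
  ts w = (1 ∸ eqV v w) * suc (ts′ w)
  ts-v : ts v ≡ 0
  ts-v = cong (λ z → (1 ∸ z) * suc (ts′ v)) (eqV-refl v)
  ts-≢ : ∀ {w} → w ≢ v → ts w ≡ suc (ts′ w)
  ts-≢ {w} h = trans (cong (λ z → (1 ∸ z) * suc (ts′ w)) (eqV-≢ h)) (+-identityʳ _)
  u-≢ : ∀ {w} → w ≢ v → u w ≡ u′ w
  u-≢ {w} h = cong (_+ u′ w) (eqV-≢ h)
  stamped : Stamped τ u ts
  stamped x ux with x ≟V v
  ... | yes refl = begin
    nb (λ w → late (u w) (ts w) (ts x)) x ≤⟨ ∑V-mono each ⟩
    nb u′ x ≤⟨ m≤n+m (nb u′ x) (σ′ x) ⟩
    σ′ x + nb u′ x ≡⟨ balance r x ⟩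
    τ x + 2 * d * u′ x ≡⟨ trans (cong (λ z → τ x + 2 * d * z) ov) (trans (cong (τ x +_) (*-zeroʳ (2 * d))) (+-identityʳ _)) ⟩
    τ x ∎
    where
    each : ∀ w → adjV x w * late (u w) (ts w) (ts x) ≤ adjV x w * u′ w
    each w with w ≟V x
    ... | yes refl = ≤-reflexive (trans (cong (_* late (u w) (ts w) (ts w)) (adj-irrefl w)) (sym (cong (_* u′ w) (adj-irrefl w))))
    ... | no k = *-monoʳ-≤ (adjV x w) (≤-trans (late≤ (u w) (ts w) (ts x)) (≤-reflexive (u-≢ k)))
  ... | no h = ≤-trans (nb-mono each x) (st x (subst (0 <_) (u-≢ h) ux))
    where
    each : ∀ w → late (u w) (ts w) (ts x) ≤ late (u′ w) (ts′ w) (ts′ x)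
    each w with w ≟V v
    ... | yes refl = ≤-trans (≤-reflexive (trans (cong₂ (late (u w)) ts-v (ts-≢ h)) (late-zero (u w) (ts′ x)))) z≤n
    ... | no k = ≤-trans (≤-reflexive (trans (cong (λ z → late z (ts w) (ts x)) (u-≢ k)) (cong₂ (late (u′ w)) (ts-≢ k) (ts-≢ h)))) (late-suc (u′ w) (ts′ w) (ts′ x))

-- The boundary degrees: toppling every vertex once undoes adding sinkDegree.
sinkDegree : ∀ {d n} → Config d n
sinkDegree {d} x = 2 * d ∸ nb (λ _ → 1) x

sinkDegree-nb : ∀ {d n} (x : Vertex d n) → sinkDegree x + nb (λ _ → 1) x ≡ 2 * d
sinkDegree-nb {d} x = m∸n+n≡m (≤-trans (nb-const 1 x) (≤-reflexive (*-identityʳ (2 * d))))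

-- Dhar's burning test. Toppling every vertex once balances `sinkDegree`, so least action allows at
-- most one toppling each. Conversely, follow the stamps: if `x` did not fire, its neighbours with
-- earlier stamps fired by induction and the others are accounted for in `τ x` by `Stamped`, so `x`
-- would end with 2d grains.
burning : ∀ {d n} {σ τ ρ : Config d n} (r : Topples σ τ) → Stable τ → (∀ x → 0 < odometer r x) →
  Stabilizes (λ x → τ x + sinkDegree x) ρ → ρ ≗c τ
burning {d} {n} {σ} {τ} {ρ} r sτ pos (b , sρ) = balance-unique {ρ = ρ} {τ} (balance b) unit
    (λ x → ≤-antisym (least-action b (λ _ → 1) unit sτ x) (burnt (ts x) x refl (<-wellFounded (ts x))))
  where
  open ≤-Reasoning
  β : Config d n
  β = sinkDegree
  unit : Balance (λ x → τ x + β x) τ (λ _ → 1)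
  unit x = trans (+-assoc (τ x) (β x) (nb (λ _ → 1) x)) (cong (τ x +_) (trans (sinkDegree-nb x) (sym (*-identityʳ (2 * d)))))
  ts : Config d n
  ts = proj₁ (stamps r)
  burnt : ∀ t x → ts x ≡ t → Acc _<_ t → 0 < odometer b x
  burnt t x refl (acc rec) = n≢0⇒n>0 (λ h → <⇒≱ (sρ x) (begin
    2 * d ≡⟨ sym (sinkDegree-nb x) ⟩
    β x + nb (λ _ → 1) x ≤⟨ +-monoʳ-≤ (β x) (nb-mono each x) ⟩
    β x + nb (λ w → late (odometer r w) (ts w) (ts x) + odometer b w) x ≡⟨ cong (β x +_) (nb-+ (λ w → late (odometer r w) (ts w) (ts x)) (odometer b) x) ⟩
    β x + (nb (λ w → late (odometer r w) (ts w) (ts x)) x + nb (odometer b) x) ≤⟨ +-monoʳ-≤ (β x) (+-monoˡ-≤ (nb (odometer b) x) (proj₂ (stamps r) x (pos x))) ⟩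
    β x + (τ x + nb (odometer b) x) ≡⟨ l (β x) (τ x) (nb (odometer b) x) ⟩
    τ x + β x + nb (odometer b) x ≡⟨ balance b x ⟩
    ρ x + 2 * d * odometer b x ≡⟨ trans (cong (λ z → ρ x + 2 * d * z) h) (trans (cong (ρ x +_) (*-zeroʳ (2 * d))) (+-identityʳ _)) ⟩
    ρ x ∎))
    where
    l : ∀ a b c → a + (b + c) ≡ b + a + c
    l = solve-∀
    each : ∀ w → 1 ≤ late (odometer r w) (ts w) (ts x) + odometer b w
    each w with odometer r w | pos w
    ... | suc _ | _ with ts w <? ts x
    ... | yes h = burnt (ts w) w refl (rec h)
    ... | no _ = s≤s z≤n

-- Adding grains

count : ∀ {d n k} → Vec (Vertex d n) k → Config d n
count [] x = 0
count (w ∷ ws) x = eqV w x + count ws x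

∑V-eqV-1 : ∀ {d n} (v : Vertex d n) → ∑V (eqV v) ≡ 1
∑V-eqV-1 v = trans (∑V-cong (λ w → sym (*-identityʳ (eqV v w)))) (∑V-eqV v (λ _ → 1))

∑V-count : ∀ {d n k} (ws : Vec (Vertex d n) k) → ∑V (count ws) ≡ k
∑V-count {d} {n} [] = ∑V-zero {d} {n} (λ _ → refl)
∑V-count (w ∷ ws) = trans (∑V-+ (eqV w) (count ws)) (cong₂ _+_ (∑V-eqV-1 w) (∑V-count ws))

add-grain : ∀ {d n} {v : Vertex d n} {σ σ′} → AddGrain v σ σ′ → ∀ x → σ′ x ≡ σ x + eqV v x
add-grain {v = v} {σ} (p , q) x with x ≟V v
... | yes refl = trans p (trans (+-comm 1 (σ x)) (cong (σ x +_) (sym (eqV-refl x))))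
... | no h = trans (q x h) (sym (trans (cong (σ x +_) (eqV-≢ h)) (+-identityʳ (σ x))))

steps-topples : ∀ {d n k} {σ τ : Config d n} → Steps k σ τ → ∃ λ (ws : Vec (Vertex d n) k) → Topples (λ x → σ x + count ws x) τ
steps-topples (done h) = [] , stop (λ x → trans (+-identityʳ _) (h x))
steps-topples {σ = σ} (next {ρ = ρ} (v , σ′ , add , (r , _)) rest) with steps-topples rest
... | ws , s = v ∷ ws , Topples-congˡ (λ x → trans (cong (_+ count ws x) (add-grain add x)) (+-assoc (σ x) (eqV v x) (count ws x)))
    (Topples-trans (Topples-+ (count ws) r) s)

Stable-cong : ∀ {d n} {σ τ : Config d n} → σ ≗c τ → Stable σ → Stable τ
Stable-cong h s x = subst (_< _) (h x) (s x)

steps-stable : ∀ {d n k} {σ τ : Config d n} → Stable σ → Steps k σ τ → Stable τ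
steps-stable s (done h) = Stable-cong h s
steps-stable s (next (_ , _ , _ , (_ , st)) rest) = steps-stable st rest

Steps-congʳ : ∀ {d n k} {σ τ τ′ : Config d n} → τ ≗c τ′ → Steps k σ τ → Steps k σ τ′
Steps-congʳ h (done k) = done (λ x → trans (k x) (h x))
Steps-congʳ h (next s r) = next s (Steps-congʳ h r)

Steps-congˡ : ∀ {d n k} {σ σ′ τ : Config d n} → σ ≗c σ′ → Steps k σ τ → Steps k σ′ τ
Steps-congˡ h (done k) = done (λ x → trans (sym (h x)) (k x))
Steps-congˡ h (next (v , σ₁ , (p , q) , st) r) = next (v , σ₁ , (trans p (cong suc (h v)) , λ w k → trans (q w k) (h w)) , st) r

Recurrent-cong : ∀ {d n} {τ τ′ : Config d n} → τ ≗c τ′ → Recurrent τ → Recurrent τ′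
Recurrent-cong h (s , k , st) = Stable-cong h s , k , Steps-congˡ h (Steps-congʳ h st)

realize : ∀ {d n} k (E : Config d n) → ∑V E ≡ k → ∃ λ (ws : Vec (Vertex d n) k) → ∀ x → count ws x ≡ E x
realize zero E h = [] , λ x → sym (n≤0⇒n≡0 (≤-trans (term≤∑V E x) (≤-reflexive h)))
realize {d} {n} (suc k) E h with search-Vertex {d} {n} (λ v → 0 <? E v)
... | no none = ⊥-elim (1+n≢0 (trans (sym h) (∑V-zero (λ v → n≤0⇒n≡0 (≮⇒≥ (λ p → none (v , p)))))))
... | yes (v , p) with realize k (λ x → E x ∸ eqV v x) (suc-injective (trans (cong (_+ ∑V (λ x → E x ∸ eqV v x)) (sym (∑V-eqV-1 v)))
        (trans (sym (∑V-+ (eqV v) (λ x → E x ∸ eqV v x))) (trans (∑V-cong (eqV-split E p)) h))))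
... | ws , hw = v ∷ ws , λ x → trans (cong (eqV v x +_) (hw x)) (eqV-split E p x)

bounded-max : ∀ {P : ℕ → Set} → (∀ k → Dec (P k)) → ∀ B → (∀ k → P k → k ≤ B) → ∀ k₀ → P k₀ →
  ∃ λ t → P t × (∀ k → P k → k ≤ t)
bounded-max P? zero b k₀ p = k₀ , p , λ k q → ≤-trans (b k q) z≤n
bounded-max P? (suc B) b k₀ p with P? (suc B)
... | yes h = suc B , h , b
... | no h = bounded-max P? B (λ k q → ≤-pred (≤∧≢⇒< (b k q) (λ { refl → h q }))) k₀ p

-- Termination, recurrence and transience

-- Q is a strict supersolution; it makes stabilization terminate.
module Sandpile {d n : ℕ} (Q : Config d n) (Q-strict : ∀ (v : Vertex d n) → nb Q v < 2 * d * Q v) (v₀ : Vertex d n)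
    (green>0 : ∀ (v : Vertex d n) → ∃ λ (M : ℕ) → ∀ (x : Vertex d n) → 0 < green M v x) where

  topple-decreases : ∀ v σ → 2 * d ≤ σ v → ⟨ topple v σ , Q ⟩ < ⟨ σ , Q ⟩
  topple-decreases v σ h = +-cancelʳ-< (2 * d * Q v) ⟨ topple v σ , Q ⟩ ⟨ σ , Q ⟩ (begin-strict
    ⟨ topple v σ , Q ⟩ + 2 * d * Q v ≡⟨ cong (⟨ topple v σ , Q ⟩ +_) (sym (trans (∑V-* (2 * d) (λ x → eqV v x * Q x)) (cong (2 * d *_) (∑V-eqV v Q)))) ⟩
    ⟨ topple v σ , Q ⟩ + ∑V (λ x → 2 * d * (eqV v x * Q x)) ≡⟨ sym (∑V-+ (λ x → topple v σ x * Q x) (λ x → 2 * d * (eqV v x * Q x))) ⟩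
    ∑V (λ x → topple v σ x * Q x + 2 * d * (eqV v x * Q x)) ≡⟨ ∑V-cong (λ x → trans (l (topple v σ x) (Q x) (2 * d) (eqV v x))
        (trans (cong (_* Q x) (sym (topple-balance (topple-legal v σ h) x))) (*-distribʳ-+ (Q x) (σ x) (adjV v x)))) ⟩
    ∑V (λ x → σ x * Q x + adjV v x * Q x) ≡⟨ ∑V-+ (λ x → σ x * Q x) (λ x → adjV v x * Q x) ⟩
    ⟨ σ , Q ⟩ + nb Q v <⟨ +-monoʳ-< ⟨ σ , Q ⟩ (Q-strict v) ⟩
    ⟨ σ , Q ⟩ + 2 * d * Q v ∎)
    where
    open ≤-Reasoning
    l : ∀ t q c e → t * q + c * (e * q) ≡ (t + c * e) * q
    l = solve-∀

  stabilize : ∀ σ → ∃ (Stabilizes σ)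
  stabilize σ = go σ (<-wellFounded ⟨ σ , Q ⟩)
    where
    go : ∀ σ → Acc _<_ ⟨ σ , Q ⟩ → ∃ (Stabilizes σ)
    go σ (acc rec) with search-Vertex (λ v → 2 * d ≤? σ v)
    ... | no h = σ , stop (λ _ → refl) , λ v → ≰⇒> (λ p → h (v , p))
    ... | yes (v , h) with go (topple v σ) (rec (topple-decreases v σ h))
    ... | τ , r , st = τ , fire v (topple-legal v σ h) r , st

  run : ∀ {k} (ws : Vec (Vertex d n) k) σ → Stable σ → ∃ λ ρ → Steps k σ ρ × Stabilizes (λ x → σ x + count ws x) ρ
  run [] σ st = σ , done (λ _ → refl) , stop (λ x → +-identityʳ (σ x)) , st
  run (w ∷ ws) σ st with stabilize (λ x → σ x + eqV w x)
  ... | ρ₁ , r₁ , st₁ with run ws ρ₁ st₁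
  ... | ρ , steps , r , stρ = ρ , next (w , (λ x → σ x + eqV w x) , (trans (cong (σ w +_) (eqV-refl w)) (+-comm (σ w) 1) ,
        λ x h → trans (cong (σ x +_) (eqV-≢ h)) (+-identityʳ (σ x))) , r₁ , st₁) steps ,
      Topples-trans (Topples-congˡ (λ x → +-assoc (σ x) (eqV w x) (count ws x)) (Topples-+ (count ws) r₁)) r , stρ

  -- `τ` on both sides cancels in the Green identity, so `u v = 0` would leave ⟨g,E⟩ ≤ 0, although
  -- `g` is positive everywhere.
  all-topple : ∀ {τ u E : Config d n} → Balance (λ x → τ x + E x) τ u → 0 < ∑V E → ∀ v → 0 < u v
  all-topple {τ} {u} {E} bal E>0 v with green>0 v
  ... | M , g>0 = n≢0⇒n>0 (λ h → <⇒≱ E>0 (+-cancelˡ-≤ ⟨ green M v , τ ⟩ (∑V E) 0 (begin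
    ⟨ green M v , τ ⟩ + ∑V E ≤⟨ +-monoʳ-≤ ⟨ green M v , τ ⟩ (∑V-mono (λ x → m≤n*m (E x) (green M v x) {{>-nonZero (g>0 x)}})) ⟩
    ⟨ green M v , τ ⟩ + ⟨ green M v , E ⟩ ≡⟨ sym (∑V-+ (λ x → green M v x * τ x) (λ x → green M v x * E x)) ⟩
    ∑V (λ x → green M v x * τ x + green M v x * E x) ≡⟨ ∑V-cong (λ x → sym (*-distribˡ-+ (green M v x) (τ x) (E x))) ⟩
    ⟨ green M v , (λ x → τ x + E x) ⟩ ≤⟨ m≤m+n _ _ ⟩
    ⟨ green M v , (λ x → τ x + E x) ⟩ + ⟨ u , walks M v ⟩ ≡⟨ green-identity M v (λ x → τ x + E x) τ u bal ⟩
    ⟨ green M v , τ ⟩ + (4 * d) ^ M * u v ≡⟨ cong (⟨ green M v , τ ⟩ +_) (trans (cong ((4 * d) ^ M *_) h) (*-zeroʳ ((4 * d) ^ M))) ⟩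
    ⟨ green M v , τ ⟩ + 0 ∎)))
    where open ≤-Reasoning

  -- Instead of exhibiting a boundary vertex: if no edge led to the sink, self-adjointness against
  -- the constant 1 would give Σ nb Q = Σ 2d Q, contrary to strictness.
  sinkDegree>0 : 0 < ∑V (sinkDegree {d} {n})
  sinkDegree>0 = n≢0⇒n>0 (λ h → <⇒≱ (begin-strict
    ∑V (λ x → 1 * nb Q x) <⟨ ≤-refl ⟩
    1 + ∑V (λ x → 1 * nb Q x) ≡⟨ +-comm 1 _ ⟩
    ∑V (λ x → 1 * nb Q x) + 1 ≡⟨ cong (∑V (λ x → 1 * nb Q x) +_) (sym (∑V-eqV-1 v₀)) ⟩
    ∑V (λ x → 1 * nb Q x) + ∑V (eqV v₀) ≡⟨ sym (∑V-+ (λ x → 1 * nb Q x) (eqV v₀)) ⟩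
    ∑V (λ x → 1 * nb Q x + eqV v₀ x) ≤⟨ ∑V-mono each ⟩
    ∑V (λ x → Q x * (2 * d)) ∎)
    (≤-reflexive (trans (∑V-cong (λ x → cong (Q x *_) (sym (full h x)))) (nb-selfAdjoint Q (λ _ → 1)))))
    where
    open ≤-Reasoning
    full : ∑V (sinkDegree {d} {n}) ≡ 0 → ∀ x → nb (λ _ → 1) x ≡ 2 * d
    full h x = trans (cong (_+ nb (λ _ → 1) x) (sym (n≤0⇒n≡0 (≤-trans (term≤∑V sinkDegree x) (≤-reflexive h))))) (sinkDegree-nb x)
    each : ∀ x → 1 * nb Q x + eqV v₀ x ≤ Q x * (2 * d)
    each x = ≤-trans (+-mono-≤ (≤-reflexive (+-identityʳ (nb Q x))) (eqV≤1 v₀ x)) (≤-trans (≤-reflexive (+-comm (nb Q x) 1))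
      (≤-trans (Q-strict x) (≤-reflexive (*-comm (2 * d) (Q x)))))

  burnt⇒recurrent : ∀ {τ ρ} → Stable τ → Stabilizes (λ x → τ x + sinkDegree x) ρ → ρ ≗c τ → Recurrent τ
  burnt⇒recurrent {τ} {ρ} st (b , sρ) h with ∑V (sinkDegree {d} {n}) in eq
  ... | zero = ⊥-elim (<⇒≢ sinkDegree>0 (sym eq))
  ... | suc k with realize (suc k) (sinkDegree {d} {n}) eq
  ... | ws , hws with run ws τ st
  ... | ρ′ , steps , s = st , k , Steps-congʳ (λ x → trans (stabilization-unique s (Topples-congˡ (λ y → cong (τ y +_) (sym (hws y))) b , sρ) x) (h x)) steps

  toppled⇒recurrent : ∀ {σ τ : Config d n} (r : Topples σ τ) → Stable τ → (∀ x → 0 < odometer r x) → Recurrent τ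
  toppled⇒recurrent {τ = τ} r st pos with stabilize (λ x → τ x + sinkDegree x)
  ... | ρ , b = burnt⇒recurrent st b (burning r st pos b)

  -- The burning test decides. A return of `τ` to itself uses at least one grain, so it topples
  -- every vertex and `burning` gives back `τ`. Decidability is what allows the maximum in
  -- `tcl-exists` to be found by search.
  recurrent? : ∀ τ → Stable τ → Dec (Recurrent τ)
  recurrent? τ st with stabilize (λ x → τ x + sinkDegree x)
  ... | ρ , b with all-or-counterexample search-Vertex (λ x → ρ x ≟ τ x)
  ... | inj₁ h = yes (burnt⇒recurrent st b h)
  ... | inj₂ (x , h) = no λ { (_ , k , steps) → h (go k (steps-topples steps) x) }
    where
    go : ∀ k → (∃ λ (ws : Vec (Vertex d n) (suc k)) → Topples (λ x → τ x + count ws x) τ) → ρ ≗c τ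
    go k (ws , r) = burning r st (all-topple {τ} (balance r) (≤-trans (s≤s z≤n) (≤-reflexive (sym (∑V-count ws))))) b

  -- The added grains may be stabilized all at once.
  Transient : ℕ → Set
  Transient k = ∃ λ (ws : Vec (Vertex d n) k) → ¬ Recurrent (proj₁ (stabilize (count ws)))

  transient? : ∀ k → Dec (Transient k)
  transient? k = search-Vec search-Vertex k (λ ws → ¬? (recurrent? _ (proj₂ (proj₂ (stabilize (count ws))))))

  module _ (d>0 : 0 < d) where

    empty-stable : Stable {d} {n} empty
    empty-stable _ = *-mono-≤ {1} {2} (s≤s z≤n) d>0

    steps⇒transient : ∀ k τ → Steps k empty τ → ¬ Recurrent τ → Transient k
    steps⇒transient k τ steps ¬rec with steps-topples steps
    ... | ws , r = ws , λ rec → ¬rec (Recurrent-cong (stabilization-unique (proj₂ (stabilize (count ws))) (r , steps-stable empty-stable steps)) rec)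

    transient⇒steps : ∀ k → Transient k → ∃ λ τ → Steps k empty τ × ¬ Recurrent τ
    transient⇒steps k (ws , ¬rec) with run ws empty empty-stable
    ... | ρ , steps , s = ρ , steps , λ rec → ¬rec (Recurrent-cong (stabilization-unique s (proj₂ (stabilize (count ws)))) rec)

    tcl-exists : ∀ B → (∀ k → Transient k → k ≤ B) → ∀ k₀ → Transient k₀ → ∃ λ t → IsTcl {d} {n} t × t ≤ B × k₀ ≤ t
    tcl-exists B b k₀ p with bounded-max transient? B b k₀ p
    ... | t , q , top = t , (transient⇒steps t q , λ k τ steps ¬rec → top k (steps⇒transient k τ steps ¬rec)) , b t q , top k₀ p

  untoppled : ∀ {σ τ : Config d n} (r : Topples σ τ) → Stable τ → ¬ Recurrent τ → ∃ λ v → odometer r v ≡ 0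
  untoppled r st ¬rec with all-or-counterexample search-Vertex (λ v → 0 <? odometer r v)
  ... | inj₁ h = ⊥-elim (¬rec (toppled⇒recurrent r st h))
  ... | inj₂ (v , h) = v , n≤0⇒n≡0 (≮⇒≥ h)

  -- Two adjacent empty sites form a forbidden subconfiguration.
  empty-pair⇒transient : ∀ {τ : Config d n} {v w} → Adj v w → Adj w v → τ v ≡ 0 → τ w ≡ 0 → ¬ Recurrent τ
  empty-pair⇒transient {τ} {v} {w} vw wv τv τw (st , k , steps) with steps-topples steps
  ... | ws , r = <-asym (before v w (adj-yes v w vw) τv) (before w v (adj-yes w v wv) τw)
    where
    u ts : Config d n
    u = odometer r
    ts = proj₁ (stamps r)
    pos : ∀ x → 0 < u x
    pos = all-topple {τ} (balance r) (≤-trans (s≤s z≤n) (≤-reflexive (sym (∑V-count ws))))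
    late-zero⇒< : ∀ {a} tw tv → 0 < a → late a tw tv ≡ 0 → tw < tv
    late-zero⇒< {suc a} tw tv _ h with tw <? tv
    ... | yes q = q
    late-zero⇒< {suc a} tw tv _ () | no _
    before : ∀ v w → adjV v w ≡ 1 → τ v ≡ 0 → ts w < ts v
    before v w e h = late-zero⇒< (ts w) (ts v) (pos w) (trans (sym (trans (cong (_* late (u w) (ts w) (ts v)) e) (+-identityʳ _)))
      (n≤0⇒n≡0 (≤-trans (term≤∑V (λ x → adjV v x * late (u x) (ts x) (ts v)) w) (≤-trans (proj₂ (stamps r) v (pos v)) (≤-reflexive h)))))

-- Choice of constants and conclusion

-- The constant `4 * d * C′` of `green-lower`, with the power of `N` split off from `C ^ d`.
greenConstant : ℕ → ℕ
greenConstant d = 4 * d * (2 ^ suc ((2 * d ∸ 1) * (7 + d) * 40) * 32000 ^ d)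

3d-2+2 : ∀ {d} → 2 ≤ d → 3 * d ∸ 2 + 2 ≡ 3 * d
3d-2+2 {d} h = m∸n+n≡m (≤-trans h (m≤m+n d _))

cube-power : ∀ N c d → 2 ≤ d → (N * (N * N) * c) ^ d ≡ N * N * (N ^ (3 * d ∸ 2) * c ^ d)
cube-power N c d h = begin
  (N * (N * N) * c) ^ d ≡⟨ ^-distribʳ-* (N * (N * N)) c d ⟩
  (N * (N * N)) ^ d * c ^ d ≡⟨ cong (λ z → z ^ d * c ^ d) (l N) ⟩
  (N ^ 3) ^ d * c ^ d ≡⟨ cong (_* c ^ d) (^-*-assoc N 3 d) ⟩
  N ^ (3 * d) * c ^ d ≡⟨ cong (λ z → N ^ z * c ^ d) (sym (3d-2+2 h)) ⟩
  N ^ (3 * d ∸ 2 + 2) * c ^ d ≡⟨ cong (_* c ^ d) (^-distribˡ-+-* N (3 * d ∸ 2) 2) ⟩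
  N ^ (3 * d ∸ 2) * (N * (N * 1)) * c ^ d ≡⟨ l₂ N (N ^ (3 * d ∸ 2)) (c ^ d) ⟩
  N * N * (N ^ (3 * d ∸ 2) * c ^ d) ∎
  where
  open ≡-Reasoning
  l : ∀ n → n * (n * n) ≡ n * (n * (n * 1))
  l = solve-∀
  l₂ : ∀ n a b → a * (n * (n * 1)) * b ≡ n * n * (a * b)
  l₂ = solve-∀

quotient-bounds : ∀ m k .{{_ : NonZero k}} → k * (m / k) ≤ m × m ≤ k * (m / k) + k
quotient-bounds m k = ≤-trans (≤-reflexive (*-comm k (m / k))) (m/n*n≤m m k) ,
  ≤-trans (≤-reflexive (trans (m≡m%n+[m/n]*n m k) (+-comm (m % k) _))) (+-mono-≤ (≤-reflexive (*-comm (m / k) k)) (<⇒≤ (m%n<n m k)))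

green-bound : ∀ d → 2 ≤ d → ∀ n → 160 ≤ n → ∃ λ M → ∀ (v x : Vertex d n) →
  (4 * d) ^ M * distV v ≤ greenConstant d * suc n ^ (3 * d ∸ 2) * green M v x
green-bound d 2≤d n n≥160 = go (suc n) refl (suc n * (suc n * suc n) * 32000) refl
  where
  go : ∀ N → N ≡ suc n → ∀ C → C ≡ N * (N * N) * 32000 → ∃ λ M → ∀ (v x : Vertex d n) → (4 * d) ^ M * distV v ≤ greenConstant d * N ^ (3 * d ∸ 2) * green M v x
  go N N≡ C C≡ = m + m , bound
    where
    open ≤-Reasoning
    q w L k : ℕ
    q = N / 20
    w = N * N ∸ 5
    L = (w + 5) / 10
    k = 2 * d ∸ 1
    N≥160 : 160 ≤ N
    N≥160 = ≤-trans n≥160 (≤-trans (n≤1+n n) (≤-reflexive (sym N≡)))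
    N²≥ : 160 ≤ N * N
    N²≥ = ≤-trans N≥160 (m≤m*n N N {{>-nonZero (≤-trans (s≤s z≤n) N≥160)}})
    hw : N * N ≡ w + 5
    hw = sym (m∸n+n≡m (≤-trans (m≤m+n 5 155) N²≥))
    w>0 : 0 < w
    w>0 = m<n⇒0<n∸m (≤-trans (m≤m+n 6 154) N²≥)
    P≥ : 160 ≤ w + 5
    P≥ = ≤-trans N²≥ (≤-reflexive hw)
    hk : 2 * d ≡ suc k
    hk = sym (m+[n∸m]≡n {1} {2 * d} (≤-trans (s≤s z≤n) (≤-trans 2≤d (m≤m+n d _))))
    k>0 : 0 < k
    k>0 = m<n⇒0<n∸m (≤-trans 2≤d (m≤m+n d _))
    lower₁ : ∀ t a b → 0 < a → a < N → 0 < b → b < N → 6 * (w + 5) ≤ t →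
      (4 * w) ^ t * (dist N a * dist N b) ≤ (w + 5) ^ t * (C * K N t a b)
    lower₁ = K-lower N w q C hw (/-monoˡ-≤ 20 N≥160) (proj₁ (quotient-bounds N 20)) (proj₂ (quotient-bounds N 20)) C≡
    ≤20L : w + 5 ≤ 20 * L
    ≤20L = ≤-trans (proj₂ (quotient-bounds (w + 5) 10)) (≤-trans (+-monoʳ-≤ (10 * L) (*-monoʳ-≤ 10 (/-monoˡ-≤ 10 (≤-trans (m≤m+n 10 150) P≥)))) (≤-reflexive (l L)))
      where
      l : ∀ x → 10 * x + 10 * x ≡ 20 * x
      l = solve-∀
    open GreenLower n w C L (subst (λ N → ∀ t a b → 0 < a → a < N → 0 < b → b < N → 6 * (w + 5) ≤ t →
        (4 * w) ^ t * (dist N a * dist N b) ≤ (w + 5) ^ t * (C * K N t a b)) N≡ lower₁)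
      w>0 (proj₁ (quotient-bounds (w + 5) 10)) ≤20L
    m : ℕ
    m = k * (6 * (w + 5) + suc d)
    bound : ∀ (v x : Vertex d n) → (4 * d) ^ (m + m) * distV v ≤ greenConstant d * N ^ (3 * d ∸ 2) * green (m + m) v x
    -- `C ^ d` is 32000^d N^(3d), whose factor N² = w + 5 cancels against the number of times
    -- collected by `green-lower`.
    bound v x = *-cancelˡ-≤ (w + 5) {{>-nonZero (≤-trans w>0 (m≤m+n w 5))}} (begin
      (w + 5) * ((4 * d) ^ (m + m) * distV v) ≤⟨ green-lower hk k>0 v x ⟩
      4 * d * (2 ^ suc κ′ * C ^ d * G) ≡⟨ cong (λ z → 4 * d * (2 ^ suc κ′ * z * G)) (trans (cong (_^ d) C≡) (trans (cube-power N 32000 d 2≤d) (cong (_* (Ne * 32000 ^ d)) hw))) ⟩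
      4 * d * (2 ^ suc κ′ * ((w + 5) * (Ne * 32000 ^ d)) * G) ≡⟨ l (4 * d) (2 ^ suc κ′) (w + 5) Ne (32000 ^ d) G ⟩
      (w + 5) * (greenConstant d * Ne * G) ∎)
      where
      κ′ Ne G : ℕ
      κ′ = k * (7 + d) * 40
      Ne = N ^ (3 * d ∸ 2)
      G = green (m + m) v x
      l : ∀ a b p n c g → a * (b * (p * (n * c)) * g) ≡ p * (a * (b * c) * n * g)
      l = solve-∀

green-mass′ : ∀ {d n} → 2 ≤ d → ∀ k → suc n ≤ 2 ^ k → ∀ M (v : Vertex d n) → ∑V (green M v) ≤ (4 * d) ^ M * (8 * suc k * distV v)
green-mass′ (s≤s (s≤s _)) = green-mass

supersolution-exists : ∀ d n → 2 ≤ d → ∃ λ (Q : Config d n) → ∀ v → nb Q v < 2 * d * Q v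
supersolution-exists (suc (suc d)) n (s≤s (s≤s _)) = exitV k , λ v → *-cancelˡ-< 2 _ _
  (<-≤-trans (m<m+n (2 * nb (exitV k) v) (m^n>0 2 k)) (≤-trans (exitV-strict k (<⇒≤ (n<2^n (suc n))) v) (≤-reflexive (*-assoc 2 (2 * (2 + d)) (exitV k v)))))
  where k = suc n

n<2^[1+log₂n] : ∀ n → n < 2 ^ suc ⌊log₂ n ⌋
n<2^[1+log₂n] n = ≰⇒> (λ h → <⇒≱ (n<1+n ⌊log₂ n ⌋) (≤-trans (≤-reflexive (sym (⌊log₂[2^n]⌋≡n (suc ⌊log₂ n ⌋)))) (⌊log₂⌋-mono-≤ h)))

count-replicate : ∀ {d n} k (x y : Vertex d n) → count (replicate k x) y ≡ k * eqV x y
count-replicate zero x y = refl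
count-replicate (suc k) x y = cong (eqV x y +_) (count-replicate k x y)

Small : ∀ {d n} → ℕ → Vertex d n → Set
Small k v = ∀ i → toℕ (lookup v i) ≤ k

small-adj : ∀ {d n k} {v w : Vertex d n} → Small k v → Adj v w → Small (suc k) w
small-adj {k = k} {v} {w} s (i , nr , same) j with j Data.Fin.≟ i
... | no h = ≤-trans (≤-reflexive (cong toℕ (sym (same j h)))) (m≤n⇒m≤1+n (s j))
... | yes refl = go nr
  where
  go : toℕ (lookup v j) ≡ suc (toℕ (lookup w j)) ⊎ toℕ (lookup w j) ≡ suc (toℕ (lookup v j)) → toℕ (lookup w j) ≤ suc k
  go (inj₁ h) = ≤-trans (n≤1+n _) (≤-trans (≤-reflexive (sym h)) (m≤n⇒m≤1+n (s j)))
  go (inj₂ h) = ≤-trans (≤-reflexive h) (s≤s (s j))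

adjacent-corner : ∀ d n → 2 ≤ d → 2 ≤ n → ∃₂ λ (v w : Vertex d n) → Adj v w × Adj w v × Small 1 v × Small 1 w
adjacent-corner (suc d) (suc (suc n)) h (s≤s (s≤s _)) = zero ∷ o , suc zero ∷ o ,
  (zero , inj₂ refl , λ { zero k → ⊥-elim (k refl) ; (suc j) _ → refl }) ,
  (zero , inj₁ refl , λ { zero k → ⊥-elim (k refl) ; (suc j) _ → refl }) ,
  (λ { zero → z≤n ; (suc j) → rest j }) , (λ { zero → ≤-refl ; (suc j) → rest j })
  where
  o : Vec (Fin (2 + n)) d
  o = replicate d zero
  rest : ∀ j → toℕ (lookup o j) ≤ 1
  rest j = ≤-trans (≤-reflexive (cong toℕ (lookup-replicate j zero))) z≤n

-- [0,n+1] is contained in an interval [0,2ρ] of even length whose rate is 1 − 2/G.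
record Radius (n : ℕ) : Set where
  constructor radius
  field
    ρ j G g : ℕ
    ρ≥4 : 4 ≤ ρ
    hG : G ≡ 9 * (2 * ρ * (2 * ρ))
    hg : G ≡ g + 2
    0<j : 0 < j
    j≤2 : j ≤ 2
    hj : n + j ≡ 2 * ρ

radius-exists : ∀ n → 160 ≤ n → Radius n
radius-exists n n≥160 = radius ρ (2 * ρ ∸ n) (9 * (2 * ρ * (2 * ρ))) (9 * (2 * ρ * (2 * ρ)) ∸ 2)
    (m≤n⇒m≤1+n (⌊n/2⌋-mono {8} {n} (≤-trans (m≤m+n 8 152) n≥160))) refl
    (sym (m∸n+n≡m (≤-trans (m≤m+n 2 7) (m≤m*n 9 (2 * ρ * (2 * ρ)) {{m*n≢0 (2 * ρ) (2 * ρ)}}))))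
    (m<n⇒0<n∸m n<2ρ)
    (m≤n+o⇒m∸n≤o (2 * ρ) n (≤-trans (≤-reflexive 2ρ≡) (≤-trans (s≤s (s≤s (proj₁ (half-bounds n)))) (≤-reflexive (+-comm 2 n)))))
    (m+[n∸m]≡n (<⇒≤ n<2ρ))
  where
  ρ : ℕ
  ρ = suc ⌊ n /2⌋
  2ρ≡ : 2 * ρ ≡ suc (suc (2 * ⌊ n /2⌋))
  2ρ≡ = l ⌊ n /2⌋
    where
    l : ∀ h → 2 * suc h ≡ suc (suc (2 * h))
    l = solve-∀
  n<2ρ : n < 2 * ρ
  n<2ρ = ≤-trans (s≤s (proj₂ (half-bounds n))) (≤-reflexive (sym 2ρ≡))

module Bounds (d n : ℕ) (2≤d : 2 ≤ d) (n≥160 : 160 ≤ n)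
    (Q : Config d n) (Q-strict : ∀ (v : Vertex d n) → nb Q v < 2 * d * Q v)
    (M γ′ : ℕ) (green-large : ∀ (v x : Vertex d n) → (4 * d) ^ M * distV v ≤ γ′ * suc n ^ (3 * d ∸ 2) * green M v x) where

  ε : ℕ
  ε = 3 * d ∸ 2

  d>0 : 0 < d
  d>0 = ≤-trans (s≤s z≤n) 2≤d

  4d^≢0 : ∀ M → NonZero ((4 * d) ^ M)
  4d^≢0 M = m^n≢0 (4 * d) M {{m*n≢0 4 d {{_}} {{>-nonZero d>0}}}}

  green>0 : ∀ (v x : Vertex d n) → 0 < green M v x
  green>0 v x = n≢0⇒n>0 (λ h → <⇒≱ (*-mono-≤ (>-nonZero⁻¹ ((4 * d) ^ M) {{4d^≢0 M}}) (distV>0 v))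
    (≤-trans (green-large v x) (≤-reflexive (trans (cong (γ′ * suc n ^ ε *_) h) (*-zeroʳ (γ′ * suc n ^ ε))))))

  n>0 : 0 < n
  n>0 = ≤-trans (s≤s z≤n) n≥160

  last : Fin n
  last = fromℕ< (≤-reflexive (suc-pred n {{>-nonZero n>0}}))

  far : Vertex d n
  far = replicate d last

  open Sandpile Q Q-strict far (λ v → M , green>0 v) public

  transient-upper : ∀ log → 0 < log → suc n ≤ 2 ^ (2 + log) → ∀ k → Transient k → k ≤ γ′ * 2 ^ ε * (d * 64) * (n ^ ε * log ^ (d + 2))
  transient-upper log log>0 N≤2^ k (ws , ¬rec) with stabilize (count ws)
  ... | τ , r , st with untoppled r st ¬rec
  ... | v , u0 = ≤-trans (*-cancelˡ-≤ (D * distV v) {{m*n≢0 D (distV v) {{4d^≢0 M}} {{>-nonZero (distV>0 v)}}}} main) final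
    where
    open ≤-Reasoning
    D c : ℕ
    D = (4 * d) ^ M
    c = γ′ * suc n ^ ε
    g : Config d n
    g = green M v
    paired : ⟨ g , count ws ⟩ ≤ ⟨ g , τ ⟩
    paired = ≤-trans (m≤m+n _ _) (≤-reflexive (trans (green-identity M v (count ws) τ (odometer r) (balance r))
      (trans (cong (λ z → ⟨ g , τ ⟩ + D * z) u0) (trans (cong (⟨ g , τ ⟩ +_) (*-zeroʳ D)) (+-identityʳ _)))))
    l₁ : ∀ a b c → a * b * c ≡ a * (b * c)
    l₁ = solve-∀
    l₂ : ∀ c d D k e → c * (2 * d * (D * (8 * k * e))) ≡ D * e * (c * (d * 16) * k)
    l₂ = solve-∀
    main : D * distV v * k ≤ D * distV v * (c * (d * 16) * (3 + log))
    main = begin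
      D * distV v * k ≡⟨ cong (D * distV v *_) (sym (∑V-count ws)) ⟩
      D * distV v * ∑V (count ws) ≡⟨ sym (∑V-* (D * distV v) (count ws)) ⟩
      ∑V (λ x → D * distV v * count ws x) ≤⟨ ∑V-mono (λ x → *-monoˡ-≤ (count ws x) (green-large v x)) ⟩
      ∑V (λ x → c * g x * count ws x) ≡⟨ ∑V-cong (λ x → l₁ c (g x) (count ws x)) ⟩
      ∑V (λ x → c * (g x * count ws x)) ≡⟨ ∑V-* c (λ x → g x * count ws x) ⟩
      c * ⟨ g , count ws ⟩ ≤⟨ *-monoʳ-≤ c paired ⟩
      c * ⟨ g , τ ⟩ ≤⟨ *-monoʳ-≤ c (∑V-mono (λ x → ≤-trans (*-monoʳ-≤ (g x) (<⇒≤ (st x))) (≤-reflexive (*-comm (g x) (2 * d))))) ⟩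
      c * ∑V (λ x → 2 * d * g x) ≡⟨ cong (c *_) (∑V-* (2 * d) g) ⟩
      c * (2 * d * ∑V g) ≤⟨ *-monoʳ-≤ c (*-monoʳ-≤ (2 * d) (green-mass′ 2≤d (2 + log) N≤2^ M v)) ⟩
      c * (2 * d * (D * (8 * (3 + log) * distV v))) ≡⟨ l₂ c d D (3 + log) (distV v) ⟩
      D * distV v * (c * (d * 16) * (3 + log)) ∎
    -- A single logarithm arises, from the scales of `exitS`; as `log ≥ 1` it is at most
    -- `log ^ (d + 2)`.
    logs : 3 + log ≤ log ^ (d + 2) * 4
    logs = begin
      3 + log ≤⟨ +-monoˡ-≤ log (*-monoʳ-≤ 3 log>0) ⟩
      3 * log + log ≡⟨ l log ⟩
      log ^ 1 * 4 ≤⟨ *-monoˡ-≤ 4 (^-monoʳ-≤ log {{>-nonZero log>0}} (≤-trans (s≤s z≤n) (m≤n+m 2 d))) ⟩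
      log ^ (d + 2) * 4 ∎
      where
      l : ∀ x → 3 * x + x ≡ x * 1 * 4
      l = solve-∀
    powers : suc n ^ ε ≤ 2 ^ ε * n ^ ε
    powers = ≤-trans (^-monoˡ-≤ ε (≤-trans (≤-reflexive (+-comm 1 n)) (≤-trans (+-monoʳ-≤ n n>0) (≤-reflexive (sym (double n)))))) (≤-reflexive (^-distribʳ-* 2 n ε))
    final : c * (d * 16) * (3 + log) ≤ γ′ * 2 ^ ε * (d * 64) * (n ^ ε * log ^ (d + 2))
    final = begin
      γ′ * suc n ^ ε * (d * 16) * (3 + log) ≤⟨ *-mono-≤ (*-monoˡ-≤ (d * 16) (*-monoʳ-≤ γ′ powers)) logs ⟩
      γ′ * (2 ^ ε * n ^ ε) * (d * 16) * (log ^ (d + 2) * 4) ≡⟨ l γ′ (2 ^ ε) (n ^ ε) d (log ^ (d + 2)) ⟩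
      γ′ * 2 ^ ε * (d * 64) * (n ^ ε * log ^ (d + 2)) ∎
      where
      l : ∀ g a b d p → g * (a * b) * (d * 16) * (p * 4) ≡ g * a * (d * 64) * (b * p)
      l = solve-∀

  module _ (ρ j G g : ℕ) (ρ≥4 : 4 ≤ ρ) (hG : G ≡ 9 * (2 * ρ * (2 * ρ))) (hg : G ≡ g + 2)
      (0<j : 0 < j) (j≤2 : j ≤ 2) (hj : n + j ≡ 2 * ρ) where

    open GreenUpper n ρ G g j ρ≥4 hG hg 0<j j≤2 hj using (green-corner; walks-vanish)

    instance
      ρ≢0 : NonZero ρ
      ρ≢0 = >-nonZero (≤-trans (s≤s z≤n) ρ≥4)

    far-corner : All (λ b → suc (toℕ b) ≡ n) far
    far-corner = lookup⁻ (λ i → trans (cong (suc ∘ toℕ) (lookup-replicate i last)) (trans (cong suc (toℕ-fromℕ< (≤-reflexive (suc-pred n {{>-nonZero n>0}})))) (suc-pred n {{>-nonZero n>0}})))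

    C₂ : ℕ
    C₂ = 96 ^ d * 9

    -- The cut-off `M` is chosen after the run, from the total `U` of its odometer. With D = (4d)^M,
    -- the truncation error is then at most D/4 and the source term at most D/2, so D · u(v) < D and
    -- the integer `u v` is 0.
    untouched : ∀ k {τ} (r : Topples (count (replicate k far)) τ) → k * C₂ ≤ ρ ^ ε → ∀ v → Small 2 v → odometer r v ≡ 0
    untouched k {τ} r hk v sv = go (walks-vanish d>0 v (4 * suc U))
      where
      open ≤-Reasoning
      u : Config d n
      u = odometer r
      U : ℕ
      U = ∑V u
      go : (∃ λ M → ∀ x → 4 * suc U * walks M v x < (4 * d) ^ M) → u v ≡ 0
      go (M , small) = n≤0⇒n≡0 (≤-pred (*-cancelˡ-< (4 * D) (u v) 1 (begin-strict
        4 * D * u v ≤⟨ ≤-trans (≤-reflexive (*-assoc 4 D (u v))) (*-monoʳ-≤ 4 (≤-trans (m≤n+m _ ⟨ γ₀ , τ ⟩) (≤-reflexive (sym (green-identity M v E τ u (balance r)))))) ⟩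
        4 * (⟨ γ₀ , E ⟩ + ⟨ u , walks M v ⟩) ≡⟨ l₁ ⟨ γ₀ , E ⟩ ⟨ u , walks M v ⟩ ⟩
        2 * (2 * ⟨ γ₀ , E ⟩) + 4 * ⟨ u , walks M v ⟩ ≤⟨ +-mono-≤ (*-monoʳ-≤ 2 source) tail ⟩
        2 * D + D <⟨ m<m+n (2 * D + D) (>-nonZero⁻¹ D {{4d^≢0 M}}) ⟩
        2 * D + D + D ≡⟨ l₂ D ⟩
        4 * D * 1 ∎)))
        where
        D : ℕ
        D = (4 * d) ^ M
        γ₀ E : Config d n
        γ₀ = green M v
        E = count (replicate k far)
        l₁ : ∀ a b → 4 * (a + b) ≡ 2 * (2 * a) + 4 * b
        l₁ = solve-∀
        l₂ : ∀ a → 2 * a + a + a ≡ 4 * a * 1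
        l₂ = solve-∀
        tail : 4 * ⟨ u , walks M v ⟩ ≤ D
        tail = *-cancelˡ-≤ (suc U) (begin
          suc U * (4 * ⟨ u , walks M v ⟩) ≡⟨ l (suc U) ⟨ u , walks M v ⟩ ⟩
          4 * suc U * ⟨ u , walks M v ⟩ ≡⟨ sym (∑V-* (4 * suc U) (λ x → u x * walks M v x)) ⟩
          ∑V (λ x → 4 * suc U * (u x * walks M v x)) ≤⟨ ∑V-mono (λ x → ≤-trans (≤-reflexive (l′ (4 * suc U) (u x) (walks M v x)))
               (≤-trans (*-monoʳ-≤ (u x) (<⇒≤ (small x))) (≤-reflexive (*-comm (u x) D)))) ⟩
          ∑V (λ x → D * u x) ≡⟨ ∑V-* D u ⟩
          D * U ≤⟨ *-monoʳ-≤ D (n≤1+n U) ⟩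
          D * suc U ≡⟨ *-comm D (suc U) ⟩
          suc U * D ∎)
          where
          l : ∀ a b → a * (4 * b) ≡ 4 * a * b
          l = solve-∀
          l′ : ∀ a b c → a * (b * c) ≡ b * (a * c)
          l′ = solve-∀
        source≡ : ⟨ γ₀ , E ⟩ ≡ k * γ₀ far
        source≡ = trans (∑V-cong (λ x → trans (cong (γ₀ x *_) (count-replicate k far x)) (l (γ₀ x) k (eqV far x))))
          (trans (∑V-* k (λ x → eqV far x * γ₀ x)) (cong (k *_) (∑V-eqV far γ₀)))
          where
          l : ∀ a b c → a * (b * c) ≡ b * (c * a)
          l = solve-∀
        R : ℕ
        R = (ρ * ρ * ρ) ^ d
        R≡ : R ≡ ρ * ρ * ρ ^ ε
        R≡ = trans (cong (_^ d) (l ρ)) (trans (cube-power ρ 1 d 2≤d) (trans (cong (λ z → ρ * ρ * (ρ ^ ε * z)) (^-zeroˡ d)) (cong (ρ * ρ *_) (*-identityʳ (ρ ^ ε)))))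
          where
          l : ∀ x → x * x * x ≡ x * (x * x) * 1
          l = solve-∀
        -- `G` is 36ρ², and this ρ² is the difference between ρ^(3d), which is `R`, and ρ^ε, the
        -- number of grains up to the constant `C₂`.
        source : 2 * ⟨ γ₀ , E ⟩ ≤ D
        source = *-cancelˡ-≤ (R * (8 * d)) {{m*n≢0 R (8 * d) {{m^n≢0 (ρ * ρ * ρ) d {{m*n≢0 (ρ * ρ) ρ {{m*n≢0 ρ ρ}}}}}} {{m*n≢0 8 d {{_}} {{>-nonZero d>0}}}}}} (begin
          R * (8 * d) * (2 * ⟨ γ₀ , E ⟩) ≡⟨ cong (λ z → R * (8 * d) * (2 * z)) source≡ ⟩
          R * (8 * d) * (2 * (k * γ₀ far)) ≡⟨ l₃ (R * (8 * d)) k (γ₀ far) ⟩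
          2 * k * (R * (8 * d) * γ₀ far) ≤⟨ *-monoʳ-≤ (2 * k) (green-corner (lookup⁻ sv) far-corner M) ⟩
          2 * k * (96 ^ d * G * D) ≡⟨ cong (λ z → 2 * k * (96 ^ d * z * D)) hG ⟩
          2 * k * (96 ^ d * (9 * (2 * ρ * (2 * ρ))) * D) ≡⟨ l₄ k (96 ^ d) ρ D ⟩
          8 * (k * (96 ^ d * 9)) * (ρ * ρ) * D ≤⟨ *-monoˡ-≤ D (*-monoˡ-≤ (ρ * ρ) (*-monoʳ-≤ 8 hk)) ⟩
          8 * ρ ^ ε * (ρ * ρ) * D ≡⟨ l₅ (ρ ^ ε) (ρ * ρ) D ⟩
          ρ * ρ * ρ ^ ε * 8 * D ≡⟨ cong (λ z → z * 8 * D) (sym R≡) ⟩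
          R * 8 * D ≤⟨ *-monoˡ-≤ D (*-monoʳ-≤ R (m≤m*n 8 d {{>-nonZero d>0}})) ⟩
          R * (8 * d) * D ∎)
          where
          l₃ : ∀ a b c → a * (2 * (b * c)) ≡ 2 * b * (a * c)
          l₃ = solve-∀
          l₄ : ∀ k c r D → 2 * k * (c * (9 * (2 * r * (2 * r))) * D) ≡ 8 * (k * (c * 9)) * (r * r) * D
          l₄ = solve-∀
          l₅ : ∀ a b D → 8 * a * b * D ≡ b * a * 8 * D
          l₅ = solve-∀

    -- The two sites have coordinates at most 1, hence neighbours with coordinates at most 2, and
    -- these never topple. The sites start empty and receive nothing.
    transient-lower : ∀ k → k * C₂ ≤ ρ ^ ε → Transient k
    transient-lower k hk with adjacent-corner d n 2≤d (≤-trans (m≤m+n 2 158) n≥160)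
    ... | v , w , vw , wv , sv , sw = replicate k far , empty-pair⇒transient vw wv (bare v sv) (bare w sw)
      where
      τ : Config d n
      τ = proj₁ (stabilize (count (replicate k far)))
      r : Topples (count (replicate k far)) τ
      r = proj₁ (proj₂ (stabilize (count (replicate k far))))
      not-far : ∀ v → Small 1 v → v ≢ far
      not-far .far s refl = <⇒≱ (≤-trans (m≤m+n 3 157) n≥160) (≤-trans (≤-reflexive (sym at-last)) (s≤s (s i)))
        where
        i : Fin d
        i = fromℕ< d>0
        at-last : suc (toℕ (lookup far i)) ≡ n
        at-last = trans (cong (suc ∘ toℕ) (lookup-replicate i last)) (trans (cong suc (toℕ-fromℕ< (≤-reflexive (suc-pred n {{>-nonZero n>0}})))) (suc-pred n {{>-nonZero n>0}}))
      bare : ∀ v → Small 1 v → τ v ≡ 0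
      bare v s = n≤0⇒n≡0 (≤-trans (m≤m+n (τ v) (2 * d * odometer r v)) (≤-reflexive (trans (sym (balance r v)) (cong₂ _+_
          (trans (count-replicate k far v) (trans (cong (k *_) (eqV-≢ (not-far v s))) (*-zeroʳ k))) (∑V-zero each)))))
        where
        each : ∀ y → adjV v y * odometer r y ≡ 0
        each y with adj-cases v y
        ... | inj₂ (e , _) = cong (_* odometer r y) e
        ... | inj₁ (_ , adj) = trans (cong (adjV v y *_) (untouched k r hk y (small-adj {v = v} {y} s adj))) (*-zeroʳ (adjV v y))

mainTheorem3 : (d : ℕ) → 2 ≤ d →
    Σ ℕ λ C₁ → Σ ℕ λ C₂ → Σ ℕ λ N → (n : ℕ) → N ≤ n →
    Σ ℕ λ t → IsTcl {d} {n} t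
    × t ≤ C₁ * (n ^ (3 * d ∸ 2) * ⌊log₂ n ⌋ ^ (d + 2))
    × n ^ (3 * d ∸ 2) ≤ C₂ * t
-- 160 makes N / 20 at least 8. The summand `2 * c` gives `c ≤ ρ`, so the number of grains `k`, the
-- quotient of ρ^ε by `c`, is positive; then ρ^ε ≤ ck + c ≤ 2ck, and n ≤ 2ρ accounts for 2^ε in the
-- second constant.
mainTheorem3 d 2≤d = greenConstant d * 2 ^ ε * (d * 64) , 2 ^ ε * (c * 2) , 160 + 2 * c , prove
  where
  ε c : ℕ
  ε = 3 * d ∸ 2
  c = 96 ^ d * 9
  instance
    c≢0 : NonZero c
    c≢0 = m*n≢0 (96 ^ d) 9 {{m^n≢0 96 d}}
  prove : ∀ n → 160 + 2 * c ≤ n → Σ ℕ λ t → IsTcl {d} {n} t × t ≤ greenConstant d * 2 ^ ε * (d * 64) * (n ^ ε * ⌊log₂ n ⌋ ^ (d + 2)) × n ^ ε ≤ 2 ^ ε * (c * 2) * t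
  prove n hn = go (supersolution-exists d n 2≤d) (green-bound d 2≤d n n≥160) (radius-exists n n≥160)
    where
    n≥160 : 160 ≤ n
    n≥160 = m+n≤o⇒m≤o 160 hn
    log>0 : 0 < ⌊log₂ n ⌋
    log>0 = ⌊log₂⌋-mono-≤ {2} {n} (≤-trans (m≤m+n 2 158) n≥160)
    N≤2^ : suc n ≤ 2 ^ (2 + ⌊log₂ n ⌋)
    N≤2^ = ≤-trans (n<2^[1+log₂n] n) (^-monoʳ-≤ 2 (n≤1+n (suc ⌊log₂ n ⌋)))
    go : (∃ λ (Q : Config d n) → ∀ v → nb Q v < 2 * d * Q v) →
      (∃ λ M → ∀ (v x : Vertex d n) → (4 * d) ^ M * distV v ≤ greenConstant d * suc n ^ ε * green M v x) → Radius n →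
      Σ ℕ λ t → IsTcl {d} {n} t × t ≤ greenConstant d * 2 ^ ε * (d * 64) * (n ^ ε * ⌊log₂ n ⌋ ^ (d + 2)) × n ^ ε ≤ 2 ^ ε * (c * 2) * t
    go (Q , Q-strict) (M , green-large) (radius ρ j G g ρ≥4 hG hg 0<j j≤2 hj) = conclude (tcl-exists d>0 _
        (transient-upper ⌊log₂ n ⌋ log>0 N≤2^) k
        (transient-lower ρ j G g ρ≥4 hG hg 0<j j≤2 hj k (≤-trans (≤-reflexive (*-comm k c)) (proj₁ quot))))
      where
      open Bounds d n 2≤d n≥160 Q Q-strict M (greenConstant d) green-large using (tcl-exists; transient-upper; transient-lower; d>0)
      open ≤-Reasoning
      k : ℕ
      k = ρ ^ ε / c
      quot : c * k ≤ ρ ^ ε × ρ ^ ε ≤ c * k + c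
      quot = quotient-bounds (ρ ^ ε) c
      n≤2ρ : n ≤ 2 * ρ
      n≤2ρ = ≤-trans (m≤m+n n j) (≤-reflexive hj)
      c≤ρ : c ≤ ρ
      c≤ρ = *-cancelˡ-≤ 2 (≤-trans (m+n≤o⇒n≤o 160 hn) n≤2ρ)
      ε>0 : 1 ≤ ε
      ε>0 = +-cancelʳ-≤ 2 1 ε (≤-trans (≤-trans (m≤m+n 3 3) (*-monoʳ-≤ 3 2≤d)) (≤-reflexive (sym (3d-2+2 2≤d))))
      k>0 : 0 < k
      k>0 = m≥n⇒m/n>0 (≤-trans c≤ρ (≤-trans (≤-reflexive (sym (^-identityʳ ρ))) (^-monoʳ-≤ ρ {{>-nonZero (≤-trans (s≤s z≤n) ρ≥4)}} ε>0)))
      conclude : (∃ λ t → IsTcl {d} {n} t × t ≤ greenConstant d * 2 ^ ε * (d * 64) * (n ^ ε * ⌊log₂ n ⌋ ^ (d + 2)) × k ≤ t) →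
        Σ ℕ λ t → IsTcl {d} {n} t × t ≤ greenConstant d * 2 ^ ε * (d * 64) * (n ^ ε * ⌊log₂ n ⌋ ^ (d + 2)) × n ^ ε ≤ 2 ^ ε * (c * 2) * t
      conclude (t , tcl , upper , k≤t) = t , tcl , upper , (begin
        n ^ ε ≤⟨ ^-monoˡ-≤ ε n≤2ρ ⟩
        (2 * ρ) ^ ε ≡⟨ ^-distribʳ-* 2 ρ ε ⟩
        2 ^ ε * ρ ^ ε ≤⟨ *-monoʳ-≤ (2 ^ ε) (≤-trans (proj₂ quot) (+-monoʳ-≤ (c * k) (m≤m*n c k {{>-nonZero k>0}}))) ⟩
        2 ^ ε * (c * k + c * k) ≡⟨ l (2 ^ ε) c k ⟩
        2 ^ ε * (c * 2) * k ≤⟨ *-monoʳ-≤ (2 ^ ε * (c * 2)) k≤t ⟩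
        2 ^ ε * (c * 2) * t ∎)
        where
        l : ∀ a c k → a * (c * k + c * k) ≡ a * (c * 2) * k
        l = solve-∀
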